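{- Let $\Delta = n^2 - 4$ with an integer $n \ge 0$ such that $\Delta$ is a quadratic discriminant, and let $h_\Delta$ be the (wide) class number of the order $\mathcal{O}_\Delta$. (1) If $\mathcal{O}_\Delta$ is a maximal order, $n = 2m$ is even, and $h_\Delta = 1$, then $m \in \{0, 2\}$, so $n \in \{0,4\}$ and $\Delta \in \{ -4, 12\}$. (2) If $n \equiv 2 \pmod 4$, write $n = 2m$; if $m > 3$, then $h_\Delta$ is even (whether or not $\mathcal{O}_\Delta$ is maximal). For $m = 3$, i.e. $\Delta = 32$, one has $h_\Delta = 1$.
   Context: A quadratic discriminant is a nonsquare integer $\equiv 0,1\pmod 4$. For such $\Delta$, $\mathcal{O}_\Delta = \mathbb{Z}[\frac{\Delta+\sqrt\Delta}{2}]$ is the quadratic order of discriminant $\Delta$; it is maximal iff $\Delta$ is a fundamental discriminant. The (wide) class number $h_\Delta$ is the order of the group of invertible fractional ideals of $\mathcal{O}_\Delta$ modulo principal fractional ideals. -}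

module Defs where

open import Level using (Level)
open import Data.Nat as ℕ using (ℕ; NonZero)
open import Data.Integer as ℤ using (ℤ; +_)
open import Data.Rational as ℚ using (ℚ; 0ℚ)
open import Data.Product using (Σ; ∃; ∃-syntax; _×_; _,_)
open import Data.Sum using (_⊎_)
open import Data.Fin using (Fin)
open import Relation.Binary.PropositionalEquality using (_≡_; _≢_)
open import Relation.Nullary using (¬_)
open import Function.Bundles using (_⇔_)

IsQuadDisc : ℤ → Set
IsQuadDisc Δ =
  ((∃[ t ] Δ ≡ (+ 4) ℤ.* t) ⊎ (∃[ t ] Δ ≡ (+ 4) ℤ.* t ℤ.+ + 1))
  × (¬ (∃[ k ] k ℤ.* k ≡ Δ))

Squarefree : ℤ → Set
Squarefree a = ∀ (d : ℕ) → ∃[ q ] a ≡ (+ d ℤ.* + d) ℤ.* q → d ≡ 1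

IsFundamental : ℤ → Set
IsFundamental Δ =
  ((∃[ t ] Δ ≡ (+ 4) ℤ.* t ℤ.+ + 1) × Squarefree Δ)
  ⊎ (∃[ k ] (Δ ≡ (+ 4) ℤ.* k)
       × ((∃[ t ] k ≡ (+ 4) ℤ.* t ℤ.+ + 2) ⊎ (∃[ t ] k ≡ (+ 4) ℤ.* t ℤ.+ + 3))
       × Squarefree k)

-- The field K = ℚ(√Δ): the pair (a , b) stands for a + b√Δ.

K : Set
K = ℚ × ℚ

module _ (Δ : ℤ) where

  infixl 6 _+K_
  infixl 7 _*K_

  _+K_ : K → K → K
  (a , b) +K (c , d) = (a ℚ.+ c , b ℚ.+ d)

  _*K_ : K → K → K
  (a , b) *K (c , d) = (a ℚ.* c ℚ.+ (Δ ℚ./ 1) ℚ.* b ℚ.* d , a ℚ.* d ℚ.+ b ℚ.* c)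

  0K : K
  0K = (0ℚ , 0ℚ)

  ιℤ : ℤ → K
  ιℤ u = (u ℚ./ 1 , 0ℚ)

  -- membership in O_Δ = ℤ[(Δ+√Δ)/2]:  x = u + v(Δ+√Δ)/2  with u v ∈ ℤ
  InO : K → Set
  InO (a , b) = ∃[ u ] ∃[ v ] (a ≡ (u ℚ./ 1) ℚ.+ (v ℚ./ 1) ℚ.* (Δ ℚ./ 2))
                            × (b ≡ (v ℚ./ 1) ℚ.* ℚ.½)

  _≐_ : (K → Set) → (K → Set) → Set
  I ≐ J = ∀ x → I x ⇔ J x

  record FracIdeal : Set₁ where
    field
      carrier  : K → Set
      has-zero : carrier 0K
      +-closed : ∀ {x y} → carrier x → carrier y → carrier (x +K y)
      O-closed : ∀ {r x} → InO r → carrier x → carrier (r *K x)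
      nonzero  : ∃[ x ] (carrier x × x ≢ 0K)
      bounded  : ∃[ d ] (d ≢ + 0) × (∀ {x} → carrier x → InO (ιℤ d *K x))
  open FracIdeal public

  data Prod (I J : K → Set) : K → Set where
    p-zero : Prod I J 0K
    p-mul  : ∀ {a b} → I a → J b → Prod I J (a *K b)
    p-add  : ∀ {x y} → Prod I J x → Prod I J y → Prod I J (x +K y)

  Invertible : FracIdeal → Set₁
  Invertible I = Σ FracIdeal λ J → Prod (carrier I) (carrier J) ≐ InO

  SameClass : FracIdeal → FracIdeal → Set
  SameClass I J = ∃[ α ] (α ≢ 0K)
    × ((carrier I) ≐ (λ x → ∃[ y ] carrier J y × x ≡ α *K y))

  HasClassNumber : ℕ → Set₁
  HasClassNumber h = Σ (Fin h → FracIdeal) λ rep →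
      (∀ i → Invertible (rep i))
    × (∀ i j → SameClass (rep i) (rep j) → i ≡ j)
    × (∀ I → Invertible I → ∃[ i ] SameClass I (rep i))

discOf : ℕ → ℤ
discOf n = (+ (n ℕ.* n)) ℤ.- + 4

{-# OPTIONS --safe #-}

-- Put m = k + 1, D = m² − 1 and Δ = 4D, so that 𝒪 = ℤ[√D] and ε = m + √D is a unit of norm 1.
-- Multiplying by ε or ε⁻¹ moves any element to an associate u + v√D with 2kv² at most the absolute
-- value of its norm. Elements of norm less than 2k in absolute value are therefore associate to
-- integers, and an invertible ideal (a, b + √D) with ∣a∣ < 2k is principal only if a = ±1. This
-- applies to (2, 1 + √D) for even m ≥ 4, and to (4, 2 + √D) for odd m ≥ 5. The square of the latter
-- is (4), so multiplication by its class is a fixed-point-free involution of the classes.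
--
-- Constructively the class number exists because an equation 1 = Σ aᵢbᵢ with aᵢ ∈ I, bᵢ ∈ I⁻¹ gives a
-- ℤ-basis of I, reduction of the form (a, b, c), b² − D = ac, then leaves finitely many candidates,
-- and the descent by ε bounds the search for an α with I = αJ.
module Submission where

-- The threshold 2k is sharp, and this accounts for the excluded small m: for m = 2 the element 1 +
-- √3 of norm -2 generates (2, 1 + √3), and for m = 3 the element 2 + √8 of norm -4 generates (4, 2
-- + √8). For odd m one has 8 ∣ D, so a form (2, b, c) always has even b and c and its ideal is not
-- invertible; hence the passage to norm 4.
--
-- The second claim asks for an actual class number, while the carriers of fractional ideals are
-- arbitrary predicates on K. The obstacle is to decide equivalence. Reduced indefinite forms are
-- not unique in their class; no cycles are followed here, and any two forms are compared directly,
-- by divisibility conditions on one element u + v√D whose norm is prescribed up to sign. Classes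
-- are wide, so the sign of a norm and the sign of a never matter. Nonsquareness of D, and with it
-- inversion in K, comes from the descent as well.

open import Defs
open import Data.Integer as ℤ using (ℤ; 1ℤ)
open import Data.Nat as ℕ using (ℕ)
open import Data.Product using (∃-syntax; _×_; _,_)
open import Relation.Binary.PropositionalEquality using (_≡_; _≢_)

-- Bézout cofactors, signs, bounded search, and descent by the unit.

module IntegerArithmetic where

  open import Data.Integer hiding (suc)
  open import Data.Integer.DivMod using (n%d<d; a≡a%n+[a/n]*n)
  open import Data.Integer.Properties
  open import Data.Integer.Tactic.RingSolver using (solve; solve-∀)
  import Data.Nat as ℕ
  open import Data.Nat using (ℕ; zero; suc)
  import Data.Nat.Properties as ℕ
  open import Data.Nat.Induction using (<-wellFounded; Acc; acc)
  import Data.Nat.Tactic.RingSolver as ℕ using (solve; solve-∀)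
  open import Data.List using ([]; _∷_)
  open import Data.Product using (_×_; _,_; ∃-syntax)
  open import Data.Sum using (_⊎_; inj₁; inj₂)
  open import Relation.Nullary using (Dec; yes; no; contradiction)
  open import Relation.Nullary.Decidable using (map′; _⊎-dec_)
  open import Relation.Binary.PropositionalEquality

  -- The identity is asked of the cofactors p, q and not as sx + ty = g: it keeps its content when g
  -- = 0, and it says that the matrix with rows (s, t) and (-q, p) has determinant 1, which is how
  -- `join` uses it.
  record Bézout (x y : ℤ) : Set where
    constructor bézout-data
    field
      g s t p q : ℤ
      x≡pg : x ≡ p * g
      y≡qg : y ≡ q * g
      sp+tq≡1 : s * p + t * q ≡ 1ℤ

  bézout : ∀ x y → Bézout x y
  bézout x y = go x y (<-wellFounded ∣ y ∣)
    where
    step : ∀ x y r k → x ≡ r + k * y → Bézout y r → Bézout x y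
    step x y r k x≡ (bézout-data g s t p q y≡pg r≡qg e) = record
      { g = g ; s = t ; t = s - k * t ; p = q + k * p ; q = p
      ; x≡pg = trans x≡ (trans (cong₂ (λ r y → r + k * y) r≡qg y≡pg) (factor k p q g))
      ; y≡qg = y≡pg
      ; sp+tq≡1 = trans (rearranged k s t p q) e
      }
      where
      factor : ∀ k p q g → q * g + k * (p * g) ≡ (q + k * p) * g
      factor = solve-∀
      rearranged : ∀ k s t p q → t * (q + k * p) + (s - k * t) * p ≡ s * p + t * q
      rearranged = solve-∀

    go : ∀ x y → Acc ℕ._<_ ∣ y ∣ → Bézout x y
    go x (+ zero) _ = record
      { g = x ; s = 1ℤ ; t = 0ℤ ; p = 1ℤ ; q = 0ℤ
      ; x≡pg = sym (*-identityˡ x) ; y≡qg = refl ; sp+tq≡1 = refl }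
    go x y@(+[1+ _ ]) (acc rs) =
      step x y (+ (x % y)) (x / y) (a≡a%n+[a/n]*n x y) (go y _ (rs (n%d<d x y)))
    go x y@(-[1+ _ ]) (acc rs) =
      step x y (+ (x % y)) (x / y) (a≡a%n+[a/n]*n x y) (go y _ (rs (n%d<d x y)))

  ∣x∣*∣x∣≡x*x : ∀ x → + (∣ x ∣ ℕ.* ∣ x ∣) ≡ x * x
  ∣x∣*∣x∣≡x*x (+ n) = pos-* n n
  ∣x∣*∣x∣≡x*x -[1+ n ] = refl

  x*x≡0⇒x≡0 : ∀ x → x * x ≡ 0ℤ → x ≡ 0ℤ
  x*x≡0⇒x≡0 x e with i*j≡0⇒i≡0∨j≡0 x e
  ... | inj₁ p = p
  ... | inj₂ p = p

  *-cancelʳ′ : ∀ {x y c} → c ≢ 0ℤ → x * c ≡ y * c → x ≡ y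
  *-cancelʳ′ {x} {y} {c} c≢0 = *-cancelʳ-≡ x y c {{≢-nonZero c≢0}}

  *-cancelˡ′ : ∀ {x y c} → c ≢ 0ℤ → c * x ≡ c * y → x ≡ y
  *-cancelˡ′ {x} {y} {c} c≢0 = *-cancelˡ-≡ c x y {{≢-nonZero c≢0}}

  *≡1⇒∣∣≡1 : ∀ x y → x * y ≡ 1ℤ → ∣ x ∣ ≡ 1
  *≡1⇒∣∣≡1 x y e = ℕ.m*n≡1⇒m≡1 ∣ x ∣ ∣ y ∣ (trans (sym (abs-* x y)) (cong ∣_∣ e))

  ∣x∣≡1⇒x*x≡1 : ∀ x → ∣ x ∣ ≡ 1 → x * x ≡ 1ℤ
  ∣x∣≡1⇒x*x≡1 x e = trans (sym (∣x∣*∣x∣≡x*x x)) (cong (λ n → + (n ℕ.* n)) e)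

  -- A sign is encoded as an e with e · e = 1, so that sign cases become ring identities.
  sign-split : ∀ x → ∃[ e ] (x ≡ e * + ∣ x ∣ × e * e ≡ 1ℤ)
  sign-split x@(+ n) = 1ℤ , sym (*-identityˡ x) , refl
  sign-split x@(-[1+ n ]) = -1ℤ , sym (-1*i≡-i (+ suc n)) , refl

  ∣∣≡∣∣⇒≡± : ∀ x y → ∣ x ∣ ≡ ∣ y ∣ → ∃[ e ] (x ≡ e * y × e * e ≡ 1ℤ)
  ∣∣≡∣∣⇒≡± x y ∣x∣≡∣y∣ with sign-split x | sign-split y
  ... | e , x≡ , ee | f , y≡ , ff =
      e * f
    , trans x≡ (trans (cong (λ n → e * + n) ∣x∣≡∣y∣) (trans (absorb e f (+ ∣ y ∣) ff) (cong (e * f *_) (sym y≡))))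
    , trans (square-* e f) (cong₂ _*_ ee ff)
    where
    absorb : ∀ e f n → f * f ≡ 1ℤ → e * n ≡ e * f * (f * n)
    absorb e f n ff = trans (sym (*-identityʳ (e * n)))
      (trans (cong (e * n *_) (sym ff)) (solve (e ∷ f ∷ n ∷ [])))
    square-* : ∀ e f → e * f * (e * f) ≡ e * e * (f * f)
    square-* = solve-∀

  anyBounded? : ∀ {P : ℤ → Set} → (∀ x → Dec (P x)) → ∀ B → Dec (∃[ x ] (∣ x ∣ ℕ.≤ B × P x))
  anyBounded? {P} P? B =
    map′ from to (ℕ.anyUpTo? (λ n → P? (+ n)) (suc B) ⊎-dec ℕ.anyUpTo? (λ n → P? (- + n)) (suc B))
    where
    from : _ → ∃[ x ] (∣ x ∣ ℕ.≤ B × P x)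
    from (inj₁ (n , ℕ.s≤s n≤B , p)) = + n , n≤B , p
    from (inj₂ (n , ℕ.s≤s n≤B , p)) = - + n , subst (ℕ._≤ B) (sym (∣-i∣≡∣i∣ (+ n))) n≤B , p
    to : ∃[ x ] (∣ x ∣ ℕ.≤ B × P x) → _
    to (+ n , n≤B , p) = inj₁ (n , ℕ.s≤s n≤B , p)
    to (-[1+ n ] , n≤B , p) = inj₂ (suc n , ℕ.s≤s n≤B , p)

  ∣⊖∣<⇒< : ∀ a b c → ∣ a ⊖ b ∣ ℕ.< c → a ℕ.< b ℕ.+ c
  ∣⊖∣<⇒< a b c h with ℕ.≤-total a b
  ... | inj₁ a≤b = ℕ.≤-<-trans a≤b (ℕ.m<m+n b (ℕ.≤-<-trans ℕ.z≤n h))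
  ... | inj₂ b≤a = subst (ℕ._< b ℕ.+ c) (ℕ.m+[n∸m]≡n b≤a)
    (ℕ.+-monoʳ-< b (subst (ℕ._< c) (trans (∣m⊖n∣≡∣n⊖m∣ a b) (∣⊖∣-≤ b≤a)) h))

  <⇒∣⊖∣< : ∀ a b c → a ℕ.< b ℕ.+ c → b ℕ.< a ℕ.+ c → ∣ a ⊖ b ∣ ℕ.< c
  <⇒∣⊖∣< a b c a<b+c b<a+c with ℕ.≤-total a b
  ... | inj₁ a≤b = subst (ℕ._< c) (sym (∣⊖∣-≤ a≤b))
    (ℕ.+-cancelˡ-< a _ _ (subst (ℕ._< a ℕ.+ c) (sym (ℕ.m+[n∸m]≡n a≤b)) b<a+c))
  ... | inj₂ b≤a = subst (ℕ._< c) (sym (trans (∣m⊖n∣≡∣n⊖m∣ a b) (∣⊖∣-≤ b≤a)))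
    (ℕ.+-cancelˡ-< b _ _ (subst (ℕ._< b ℕ.+ c) (sym (ℕ.m+[n∸m]≡n b≤a)) a<b+c))

  -- (k + 1) + √d is a unit of norm one for d = k(k + 2); multiplying by it or by its inverse
  -- shrinks ∣v∣ while 2kv² exceeds the norm of u + v√d, since then k∣v∣ < ∣u∣ < (k + 2)∣v∣.
  module _ (k : ℕ) where

    d : ℕ
    d = k ℕ.* (2 ℕ.+ k)

    norm : ℤ → ℤ → ℤ
    norm u v = u * u - + d * (v * v)

    private
      square-cancel-< : ∀ {a b} → a ℕ.* a ℕ.< b ℕ.* b → a ℕ.< b
      square-cancel-< {a} {b} h with a ℕ.<? b
      ... | yes a<b = a<b
      ... | no a≮b = contradiction (ℕ.*-mono-≤ (ℕ.≮⇒≥ a≮b) (ℕ.≮⇒≥ a≮b)) (ℕ.<⇒≱ h)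

      shrink-ℕ : ∀ u v → u ℕ.* u ℕ.< d ℕ.* (v ℕ.* v) ℕ.+ 2 ℕ.* k ℕ.* (v ℕ.* v)
        → d ℕ.* (v ℕ.* v) ℕ.< u ℕ.* u ℕ.+ 2 ℕ.* k ℕ.* (v ℕ.* v)
        → ∣ (suc k ℕ.* v) ⊖ u ∣ ℕ.< v
      shrink-ℕ u v below above = <⇒∣⊖∣< (suc k ℕ.* v) u v
        (subst (ℕ._< u ℕ.+ v) (ℕ.+-comm (k ℕ.* v) v)
          (ℕ.+-monoˡ-< v (square-cancel-< {k ℕ.* v} {u} (ℕ.+-cancelʳ-< _ _ _ (subst (ℕ._< u ℕ.* u ℕ.+ 2 ℕ.* k ℕ.* (v ℕ.* v)) lower≡ above)))))
        (subst (u ℕ.<_) (upper≡ k v) (square-cancel-< {u} {(2 ℕ.+ k) ℕ.* v} (ℕ.<-≤-trans below upper≤)))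
        where
        -- As D = k² + 2k = (k + 2)² - 2k - 4, the hypotheses amount to (kv)² < u² and u² < ((k +
        -- 2)v)² - 4v².
        lower≡ : k ℕ.* (2 ℕ.+ k) ℕ.* (v ℕ.* v) ≡ (k ℕ.* v) ℕ.* (k ℕ.* v) ℕ.+ 2 ℕ.* k ℕ.* (v ℕ.* v)
        lower≡ = ℕ.solve (k ∷ v ∷ [])
        upper≡ : ∀ k v → (2 ℕ.+ k) ℕ.* v ≡ suc k ℕ.* v ℕ.+ v
        upper≡ = ℕ.solve-∀
        upper-split : ((2 ℕ.+ k) ℕ.* v) ℕ.* ((2 ℕ.+ k) ℕ.* v)
          ≡ (k ℕ.* (2 ℕ.+ k) ℕ.* (v ℕ.* v) ℕ.+ 2 ℕ.* k ℕ.* (v ℕ.* v)) ℕ.+ 4 ℕ.* (v ℕ.* v)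
        upper-split = ℕ.solve (k ∷ v ∷ [])
        upper≤ : d ℕ.* (v ℕ.* v) ℕ.+ 2 ℕ.* k ℕ.* (v ℕ.* v) ℕ.≤ ((2 ℕ.+ k) ℕ.* v) ℕ.* ((2 ℕ.+ k) ℕ.* v)
        upper≤ = ℕ.≤-trans (ℕ.m≤m+n _ _) (ℕ.≤-reflexive (sym upper-split))

    -- The norm sees only ∣u∣ and ∣v∣. If u and v have the same sign, multiplication by ε⁻¹ cancels
    -- in the coefficient mv - u; if the signs differ, ε does so in mv + u.
    shrink : ∀ u v → ∣ norm u v ∣ ℕ.< 2 ℕ.* k ℕ.* (∣ v ∣ ℕ.* ∣ v ∣)
      → ∣ + suc k * v + u ∣ ℕ.< ∣ v ∣ ⊎ ∣ + suc k * v - u ∣ ℕ.< ∣ v ∣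
    shrink u v h = by-signs (+∣i∣≡i⊎+∣i∣≡-i u) (+∣i∣≡i⊎+∣i∣≡-i v)
      where
      U V : ℕ
      U = ∣ u ∣
      V = ∣ v ∣
      norm≡ : norm u v ≡ (U ℕ.* U) ⊖ (d ℕ.* (V ℕ.* V))
      norm≡ = trans (cong₂ (λ x y → x - + d * y) (sym (∣x∣*∣x∣≡x*x u)) (sym (∣x∣*∣x∣≡x*x v)))
        (trans (cong (λ x → + (U ℕ.* U) - x) (sym (pos-* d (V ℕ.* V)))) (m-n≡m⊖n (U ℕ.* U) (d ℕ.* (V ℕ.* V))))
      h′ : ∣ (U ℕ.* U) ⊖ (d ℕ.* (V ℕ.* V)) ∣ ℕ.< 2 ℕ.* k ℕ.* (V ℕ.* V)
      h′ = subst (λ z → ∣ z ∣ ℕ.< 2 ℕ.* k ℕ.* (V ℕ.* V)) norm≡ h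
      small : ∣ + suc k * + V - + U ∣ ℕ.< V
      small = subst (λ z → ∣ z ∣ ℕ.< V)
        (sym (trans (cong (_- + U) (sym (pos-* (suc k) V))) (m-n≡m⊖n (suc k ℕ.* V) U)))
        (shrink-ℕ U V (∣⊖∣<⇒< (U ℕ.* U) (d ℕ.* (V ℕ.* V)) _ h′)
          (∣⊖∣<⇒< (d ℕ.* (V ℕ.* V)) (U ℕ.* U) _ (subst (ℕ._< 2 ℕ.* k ℕ.* (V ℕ.* V)) (∣m⊖n∣≡∣n⊖m∣ (U ℕ.* U) (d ℕ.* (V ℕ.* V))) h′)))
      m : ℤ
      m = + suc k
      neg-both : ∀ m u v → m * (- v) - (- u) ≡ - (m * v - u)
      neg-both = solve-∀
      neg-u : ∀ m u v → m * v - (- u) ≡ m * v + u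
      neg-u = solve-∀
      neg-v : ∀ m u v → m * (- v) - u ≡ - (m * v + u)
      neg-v = solve-∀
      by-signs : + U ≡ u ⊎ + U ≡ - u → + V ≡ v ⊎ + V ≡ - v → _
      by-signs (inj₁ eu) (inj₁ ev) =
        inj₂ (subst (ℕ._< V) (cong ∣_∣ (cong₂ (λ u v → m * v - u) eu ev)) small)
      by-signs (inj₁ eu) (inj₂ ev) =
        inj₁ (subst (ℕ._< V) (trans (cong ∣_∣ (trans (cong₂ (λ u v → m * v - u) eu ev) (neg-v m u v))) (∣-i∣≡∣i∣ (m * v + u))) small)
      by-signs (inj₂ eu) (inj₁ ev) =
        inj₁ (subst (ℕ._< V) (cong ∣_∣ (trans (cong₂ (λ u v → m * v - u) eu ev) (neg-u m u v))) small)
      by-signs (inj₂ eu) (inj₂ ev) =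
        inj₂ (subst (ℕ._< V) (trans (cong ∣_∣ (trans (cong₂ (λ u v → m * v - u) eu ev) (neg-both m u v))) (∣-i∣≡∣i∣ (m * v - u))) small)

    -- `Q` is any property stable under ε and ε⁻¹, so one descent serves both the zeros of the norm
    -- and the comparison of ideals. ∣v∣ decreases until the inequality needed by `shrink` fails,
    -- and that failure is the bound returned.
    descent : (Q : ℤ → ℤ → Set)
      → (∀ {u v} → Q u v → Q (+ suc k * u + + d * v) (+ suc k * v + u))
      → (∀ {u v} → Q u v → Q (+ suc k * u - + d * v) (+ suc k * v - u))
      → ∀ {u v} → Q u v
      → ∃[ u′ ] ∃[ v′ ] (Q u′ v′ × 2 ℕ.* k ℕ.* (∣ v′ ∣ ℕ.* ∣ v′ ∣) ℕ.≤ ∣ norm u′ v′ ∣)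
    descent Q Qε Qε⁻¹ {u} {v} q = go u v q (<-wellFounded ∣ v ∣)
      where
      go : ∀ u v → Q u v → Acc ℕ._<_ ∣ v ∣
        → ∃[ u′ ] ∃[ v′ ] (Q u′ v′ × 2 ℕ.* k ℕ.* (∣ v′ ∣ ℕ.* ∣ v′ ∣) ℕ.≤ ∣ norm u′ v′ ∣)
      go u v q (acc rs) with ∣ norm u v ∣ ℕ.<? 2 ℕ.* k ℕ.* (∣ v ∣ ℕ.* ∣ v ∣)
      ... | no stop = u , v , q , ℕ.≮⇒≥ stop
      ... | yes more with shrink u v more
      ... | inj₁ smaller = go _ _ (Qε q) (rs smaller)
      ... | inj₂ smaller = go _ _ (Qε⁻¹ q) (rs smaller)

    norm-ε : ∀ u v → norm (+ suc k * u + + d * v) (+ suc k * v + u) ≡ norm u v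
    norm-ε u v = trans (cong (λ e → (+ suc k * u + e * v) * (+ suc k * u + e * v)
                          - e * ((+ suc k * v + u) * (+ suc k * v + u))) d≡)
                 (trans (identity (+ k) u v) (cong (λ e → u * u - e * (v * v)) (sym d≡)))
      where
      d≡ : + d ≡ + k * (+ 2 + + k)
      d≡ = pos-* k (2 ℕ.+ k)
      identity : ∀ k u v → let m = 1ℤ + k ; d = k * (+ 2 + k) in
        (m * u + d * v) * (m * u + d * v) - d * ((m * v + u) * (m * v + u)) ≡ u * u - d * (v * v)
      identity = solve-∀

    norm-conj : ∀ u v → norm u (- v) ≡ norm u v
    norm-conj u v = solve-with (+ d) u v
      where
      solve-with : ∀ d u v → u * u - d * ((- v) * (- v)) ≡ u * u - d * (v * v)
      solve-with = solve-∀

    norm-ε⁻¹ : ∀ u v → norm (+ suc k * u - + d * v) (+ suc k * v - u) ≡ norm u v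
    norm-ε⁻¹ u v = trans (reflect (+ suc k) (+ d) u v) (trans (norm-ε u (- v)) (norm-conj u v))
      where
      reflect : ∀ m d u v → (m * u - d * v) * (m * u - d * v) - d * ((m * v - u) * (m * v - u))
        ≡ (m * u + d * (- v)) * (m * u + d * (- v)) - d * ((m * (- v) + u) * (m * (- v) + u))
      reflect = solve-∀

-- Parity from an involution, and representatives of a decidable relation.

module FiniteCounting where

  open import Data.Nat using (ℕ; zero; suc; _+_; _*_)
  open import Data.Nat.Divisibility using (_∣_; divides)
  open import Data.Nat.Properties using (+-0-commutativeMonoid; +-identityʳ; *-comm)
  open import Data.Fin using (Fin; zero; suc; _<?_)
  open import Data.Fin.Permutation using (Permutation; permutation)
  open import Data.Fin.Properties using (any?; <-cmp)
  open import Data.List using (List; []; _∷_)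
  open import Data.List.Relation.Unary.Any using (Any; here; there)
  open import Data.Product using (∃-syntax; _,_)
  open import Data.Vec.Functional as Vec using (Vector)
  open import Algebra.Properties.CommutativeMonoid.Sum +-0-commutativeMonoid
    using (sum; sum-cong-≗; sum-permute; ∑-distrib-+)
  open import Relation.Binary using (Rel; Decidable; Symmetric; Transitive; tri<; tri≈; tri>)
  open import Relation.Binary.PropositionalEquality
  open import Relation.Nullary using (yes; no; contradiction)
  open import Level using (0ℓ)

  -- Every i is counted in exactly one of the numbers of i with i < f i and of i with f i < i.
  -- Reindexing along f turns the second count into the first.
  fixed-point-free-involution⇒even : ∀ {n} (f : Fin n → Fin n)
    → (∀ i → f (f i) ≡ i) → (∀ i → f i ≢ i) → 2 ∣ n
  fixed-point-free-involution⇒even {n} f involutive no-fixed-point =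
    divides (sum ascends) (begin
      n                                            ≡⟨ sum-ones n ⟨
      sum {n} (λ _ → 1)                            ≡⟨ sum-cong-≗ ascends-xor-descends ⟨
      sum (λ i → below i (f i) + below (f i) i)    ≡⟨ ∑-distrib-+ ascends _ ⟩
      sum ascends + sum (λ i → below (f i) i)      ≡⟨ cong (sum ascends +_) (sum-cong-≗ (λ i → cong (below (f i)) (involutive i))) ⟨
      sum ascends + sum (λ i → ascends (f i))      ≡⟨ cong (sum ascends +_) (sum-permute ascends π) ⟨
      sum ascends + sum ascends                    ≡⟨ cong (sum ascends +_) (+-identityʳ (sum ascends)) ⟨
      2 * sum ascends                              ≡⟨ *-comm 2 (sum ascends) ⟩
      sum ascends * 2                              ∎)
    where
    open ≡-Reasoning
    π : Permutation n n
    π = permutation f f involutive involutive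
    below : Fin n → Fin n → ℕ
    below i j with i <? j
    ... | yes _ = 1
    ... | no _ = 0
    ascends : Vector ℕ n
    ascends i = below i (f i)
    sum-ones : ∀ n → sum {n} (λ _ → 1) ≡ n
    sum-ones zero = refl
    sum-ones (suc n) = cong suc (sum-ones n)
    ascends-xor-descends : ∀ i → below i (f i) + below (f i) i ≡ 1
    ascends-xor-descends i with i <? f i | f i <? i | <-cmp i (f i)
    ... | yes _ | no _ | _ = refl
    ... | no _ | yes _ | _ = refl
    ... | yes _ | yes fi<i | tri< _ _ fi≮i = contradiction fi<i fi≮i
    ... | yes i<fi | yes _ | tri> i≮fi _ _ = contradiction i<fi i≮fi
    ... | no i≮fi | no _ | tri< i<fi _ _ = contradiction i<fi i≮fi
    ... | no _ | no fi≮i | tri> _ _ fi<i = contradiction fi<i fi≮i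
    ... | _ | _ | tri≈ _ i≡fi _ = contradiction (sym i≡fi) (no-fixed-point i)

  module _ {A : Set} (_~_ : Rel A 0ℓ) where

    -- `covers` speaks of everything related to an entry, not of the entries alone, because a form
    -- obtained by reduction is found in the list only up to the relation.
    record Transversal (xs : List A) : Set where
      field
        size     : ℕ
        rep      : Fin size → A
        distinct : ∀ i j → rep i ~ rep j → i ≡ j
        covers   : ∀ x → Any (x ~_) xs → ∃[ i ] x ~ rep i

    transversal : Symmetric _~_ → Transitive _~_ → Decidable _~_ → ∀ xs → Transversal xs
    transversal ~-sym ~-trans _~?_ = go
      where
      open Transversal
      go : ∀ xs → Transversal xs
      go [] = record { size = 0 ; rep = λ () ; distinct = λ () ; covers = λ _ () }
      go (y ∷ ys) with go ys
      ... | T with any? (λ i → y ~? rep T i)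
      ... | yes (i , y~rep) = record
        { size = size T ; rep = rep T ; distinct = distinct T
        ; covers = λ { x (here x~y) → i , ~-trans x~y y~rep ; x (there x~ys) → covers T x x~ys } }
      ... | no new = record
        { size = suc (size T) ; rep = y Vec.∷ rep T ; distinct = distinct′
        ; covers = λ { x (here x~y) → zero , x~y
                     ; x (there x~ys) → let (i , x~rep) = covers T x x~ys in suc i , x~rep } }
        where
        distinct′ : ∀ i j → (y Vec.∷ rep T) i ~ (y Vec.∷ rep T) j → i ≡ j
        distinct′ zero zero _ = refl
        distinct′ zero (suc j) y~ = contradiction (j , y~) new
        distinct′ (suc i) zero ~y = contradiction (i , ~-sym ~y) new
        distinct′ (suc i) (suc j) e = cong suc (distinct T i j e)

-- The embedding of ℤ in ℚ.

module RationalArithmetic where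

  open import Data.Integer as ℤ using (ℤ; +_)
  import Data.Integer.Properties as ℤ
  open import Data.Integer.Tactic.RingSolver using () renaming (solve-∀ to solve-ℤ)
  open import Data.Rational
  open import Data.Rational.Properties
  open import Data.Rational.Unnormalised as ℚᵘ using (ℚᵘ; mkℚᵘ; *≡*)
  import Data.Rational.Unnormalised.Properties as ℚᵘ
  open import Level using (0ℓ)
  open import Relation.Nullary.Decidable using (dec⇒maybe)
  open import Relation.Binary.PropositionalEquality
  open import Tactic.RingSolver.Core.AlmostCommutativeRing using (AlmostCommutativeRing; fromCommutativeRing)

  ℚ-ring : AlmostCommutativeRing 0ℓ 0ℓ
  ℚ-ring = fromCommutativeRing +-*-commutativeRing (λ x → dec⇒maybe (0ℚ ≟ x))

  toℚᵘ-/1 : ∀ u → toℚᵘ (u / 1) ℚᵘ.≃ mkℚᵘ u 0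
  toℚᵘ-/1 u = toℚᵘ-fromℚᵘ (mkℚᵘ u 0)

  /1-+ : ∀ u v → (u ℤ.+ v) / 1 ≡ u / 1 + v / 1
  /1-+ u v = toℚᵘ-injective (begin
    toℚᵘ ((u ℤ.+ v) / 1)           ≈⟨ toℚᵘ-/1 (u ℤ.+ v) ⟩
    mkℚᵘ (u ℤ.+ v) 0               ≈⟨ *≡* (identity u v) ⟩
    mkℚᵘ u 0 ℚᵘ.+ mkℚᵘ v 0         ≈⟨ ℚᵘ.+-cong (toℚᵘ-/1 u) (toℚᵘ-/1 v) ⟨
    toℚᵘ (u / 1) ℚᵘ.+ toℚᵘ (v / 1) ≈⟨ toℚᵘ-homo-+ (u / 1) (v / 1) ⟨
    toℚᵘ (u / 1 + v / 1)           ∎)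
    where
    open import Relation.Binary.Reasoning.Setoid ℚᵘ.≃-setoid
    identity : ∀ u v → (u ℤ.+ v) ℤ.* (+ 1) ≡ (u ℤ.* + 1 ℤ.+ v ℤ.* + 1) ℤ.* + 1
    identity = solve-ℤ

  /1-* : ∀ u v → (u ℤ.* v) / 1 ≡ u / 1 * (v / 1)
  /1-* u v = toℚᵘ-injective (begin
    toℚᵘ ((u ℤ.* v) / 1)           ≈⟨ toℚᵘ-/1 (u ℤ.* v) ⟩
    mkℚᵘ (u ℤ.* v) 0               ≈⟨ *≡* refl ⟩
    mkℚᵘ u 0 ℚᵘ.* mkℚᵘ v 0         ≈⟨ ℚᵘ.*-cong (toℚᵘ-/1 u) (toℚᵘ-/1 v) ⟨
    toℚᵘ (u / 1) ℚᵘ.* toℚᵘ (v / 1) ≈⟨ toℚᵘ-homo-* (u / 1) (v / 1) ⟨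
    toℚᵘ (u / 1 * (v / 1))         ∎)
    where
    open import Relation.Binary.Reasoning.Setoid ℚᵘ.≃-setoid

  /1-injective : ∀ {u v} → u / 1 ≡ v / 1 → u ≡ v
  /1-injective {u} {v} e
    with *≡* e′ ← ℚᵘ.≃-trans (ℚᵘ.≃-sym (toℚᵘ-/1 u)) (ℚᵘ.≃-trans (ℚᵘ.≃-reflexive (cong toℚᵘ e)) (toℚᵘ-/1 v))
    = trans (sym (ℤ.*-identityʳ u)) (trans e′ (ℤ.*-identityʳ v))

  /2≡/1*½ : ∀ u → u / 2 ≡ u / 1 * ½
  /2≡/1*½ u = toℚᵘ-injective (begin
    toℚᵘ (u / 2)                   ≈⟨ toℚᵘ-fromℚᵘ (mkℚᵘ u 1) ⟩
    mkℚᵘ u 1                       ≈⟨ *≡* (identity u) ⟩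
    mkℚᵘ u 0 ℚᵘ.* mkℚᵘ (+ 1) 1     ≈⟨ ℚᵘ.*-congʳ (toℚᵘ-/1 u) ⟨
    toℚᵘ (u / 1) ℚᵘ.* toℚᵘ ½       ≈⟨ toℚᵘ-homo-* (u / 1) ½ ⟨
    toℚᵘ (u / 1 * ½)               ∎)
    where
    open import Relation.Binary.Reasoning.Setoid ℚᵘ.≃-setoid
    identity : ∀ u → u ℤ.* + 2 ≡ u ℤ.* + 1 ℤ.* + 2
    identity = solve-ℤ

  p*↧p≡↥p : ∀ p → p * (↧ p / 1) ≡ ↥ p / 1
  p*↧p≡↥p p@record{} = toℚᵘ-injective (begin
    toℚᵘ (p * (↧ p / 1))           ≈⟨ toℚᵘ-homo-* p (↧ p / 1) ⟩
    toℚᵘ p ℚᵘ.* toℚᵘ (↧ p / 1)     ≈⟨ ℚᵘ.*-congˡ (toℚᵘ-/1 (↧ p)) ⟩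
    toℚᵘ p ℚᵘ.* mkℚᵘ (↧ p) 0       ≈⟨ *≡* (identity (↥ p) (↧ p)) ⟩
    mkℚᵘ (↥ p) 0                   ≈⟨ toℚᵘ-/1 (↥ p) ⟨
    toℚᵘ (↥ p / 1)                 ∎)
    where
    open import Relation.Binary.Reasoning.Setoid ℚᵘ.≃-setoid
    identity : ∀ n d → n ℤ.* d ℤ.* + 1 ≡ n ℤ.* (d ℤ.* + 1)
    identity = solve-ℤ

-- The ring ℚ[X]/(X² - Δ).

module FieldRing (Δ : ℤ) where
  open import Data.Integer using (+_)
  open import Data.Product using (_,_)
  open import Data.Rational
  open import Tactic.RingSolver using (solve-∀)
  open import Level using (0ℓ)
  open import Algebra.Bundles using (CommutativeRing)
  open import Relation.Binary.PropositionalEquality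
  open RationalArithmetic using (ℚ-ring)

  K-commutativeRing : CommutativeRing 0ℓ 0ℓ
  K-commutativeRing = record
    { Carrier = K ; _≈_ = _≡_ ; _+_ = _+K_ Δ ; _*_ = _*K_ Δ
    ; -_ = λ { (a , b) → - a , - b } ; 0# = 0K Δ ; 1# = ιℤ Δ (+ 1)
    ; isCommutativeRing = record
      { isRing = record
        { +-isAbelianGroup = record
          { isGroup = record
            { isMonoid = record
              { isSemigroup = record
                { isMagma = record { isEquivalence = isEquivalence ; ∙-cong = cong₂ (_+K_ Δ) }
                ; assoc = λ { (a , b) (c , d) (e , f) → cong₂ _,_ (+-assoc a c e) (+-assoc b d f) } }
              ; identity = (λ { (a , b) → cong₂ _,_ (+-identityˡ a) (+-identityˡ b) })
                         , (λ { (a , b) → cong₂ _,_ (+-identityʳ a) (+-identityʳ b) }) }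
            ; inverse = (λ { (a , b) → cong₂ _,_ (+-inverseˡ a) (+-inverseˡ b) })
                      , (λ { (a , b) → cong₂ _,_ (+-inverseʳ a) (+-inverseʳ b) })
            ; ⁻¹-cong = cong _ }
          ; comm = λ { (a , b) (c , d) → cong₂ _,_ (+-comm a c) (+-comm b d) } }
        ; *-cong = cong₂ (_*K_ Δ)
        ; *-assoc = λ { (a , b) (c , d) (e , f) →
            cong₂ _,_ (assoc₁ (Δ / 1) a b c d e f) (assoc₂ (Δ / 1) a b c d e f) }
        ; *-identity = (λ { (a , b) → cong₂ _,_ (idˡ₁ (Δ / 1) a b) (idˡ₂ a b) })
                     , (λ { (a , b) → cong₂ _,_ (idʳ₁ (Δ / 1) a b) (idʳ₂ a b) })
        ; distrib = (λ { (a , b) (c , d) (e , f) →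
                       cong₂ _,_ (distribˡ₁ (Δ / 1) a b c d e f) (distribˡ₂ a b c d e f) })
                  , (λ { (a , b) (c , d) (e , f) →
                       cong₂ _,_ (distribʳ₁ (Δ / 1) a b c d e f) (distribʳ₂ a b c d e f) })
        }
      ; *-comm = λ { (a , b) (c , d) → cong₂ _,_ (comm₁ (Δ / 1) a b c d) (comm₂ a b c d) }
      }
    }
    where
    open import Data.Rational.Properties
      using (+-assoc; +-comm; +-identityˡ; +-identityʳ; +-inverseˡ; +-inverseʳ)
    assoc₁ : ∀ δ a b c d e f → (a * c + δ * b * d) * e + δ * (a * d + b * c) * f
      ≡ a * (c * e + δ * d * f) + δ * b * (c * f + d * e)
    assoc₁ = solve-∀ ℚ-ring
    assoc₂ : ∀ δ a b c d e f → (a * c + δ * b * d) * f + (a * d + b * c) * e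
      ≡ a * (c * f + d * e) + b * (c * e + δ * d * f)
    assoc₂ = solve-∀ ℚ-ring
    idˡ₁ : ∀ δ a b → 1ℚ * a + δ * 0ℚ * b ≡ a
    idˡ₁ = solve-∀ ℚ-ring
    idˡ₂ : ∀ a b → 1ℚ * b + 0ℚ * a ≡ b
    idˡ₂ = solve-∀ ℚ-ring
    idʳ₁ : ∀ δ a b → a * 1ℚ + δ * b * 0ℚ ≡ a
    idʳ₁ = solve-∀ ℚ-ring
    idʳ₂ : ∀ a b → a * 0ℚ + b * 1ℚ ≡ b
    idʳ₂ = solve-∀ ℚ-ring
    distribˡ₁ : ∀ δ a b c d e f → a * (c + e) + δ * b * (d + f) ≡ a * c + δ * b * d + (a * e + δ * b * f)
    distribˡ₁ = solve-∀ ℚ-ring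
    distribˡ₂ : ∀ a b c d e f → a * (d + f) + b * (c + e) ≡ a * d + b * c + (a * f + b * e)
    distribˡ₂ = solve-∀ ℚ-ring
    distribʳ₁ : ∀ δ a b c d e f → (c + e) * a + δ * (d + f) * b ≡ c * a + δ * d * b + (e * a + δ * f * b)
    distribʳ₁ = solve-∀ ℚ-ring
    distribʳ₂ : ∀ a b c d e f → (c + e) * b + (d + f) * a ≡ c * b + d * a + (e * b + f * a)
    distribʳ₂ = solve-∀ ℚ-ring
    comm₁ : ∀ δ a b c d → a * c + δ * b * d ≡ c * a + δ * d * b
    comm₁ = solve-∀ ℚ-ring
    comm₂ : ∀ a b c d → a * d + b * c ≡ c * b + d * a
    comm₂ = solve-∀ ℚ-ring

-- Products, classes and inverses of fractional ideals, free of coordinates.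

module Ideals (Δ : ℤ)
  (inverse : ∀ x → x ≢ 0K Δ → ∃[ y ] _*K_ Δ x y ≡ ιℤ Δ 1ℤ)
  (ιℤ∈𝒪 : ∀ n → InO Δ (ιℤ Δ n))
  (+-closed-𝒪 : ∀ {x y} → InO Δ x → InO Δ y → InO Δ (_+K_ Δ x y))
  (*-closed-𝒪 : ∀ {x y} → InO Δ x → InO Δ y → InO Δ (_*K_ Δ x y))
  where

  open import Data.Integer using (+_)
  import Data.Integer.Properties as ℤ
  open import Algebra.Bundles using (CommutativeRing; CommutativeSemigroup)
  import Algebra.Properties.CommutativeSemigroup as CommutativeSemigroupProperties
  open import Data.Fin using (Fin)
  open import Data.Nat.Divisibility using (_∣_)
  open import Data.Product using (_×_; proj₁; proj₂)
  open import Data.Rational as ℚ using (ℚ)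
  import Data.Rational.Properties as ℚ
  open import Data.Sum using (inj₁; inj₂)
  open import Function using (_∘_; id; _$_)
  open import Function.Bundles using (Equivalence; mk⇔)
  open import Function.Properties.Equivalence using (⇔-isEquivalence)
  open import Level using (0ℓ) renaming (suc to lsuc)
  open import Relation.Binary.PropositionalEquality
  open import Relation.Nullary using (¬_)
  open RationalArithmetic using (/1-*; /1-injective)
  open FieldRing Δ using (K-commutativeRing)
  open CommutativeRing K-commutativeRing public
    using (*-assoc; *-comm; *-identityˡ; *-identityʳ; distribˡ; distribʳ; zeroˡ; zeroʳ; *-commutativeSemigroup)
  open CommutativeSemigroupProperties *-commutativeSemigroup public
    using (interchange; x∙yz≈y∙xz)

  infixl 7 _·_
  _·_ : K → K → K
  _·_ = _*K_ Δ

  infix 4 _≈_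
  _≈_ : (K → Set) → (K → Set) → Set
  _≈_ = _≐_ Δ

  0# 1# : K
  0# = 0K Δ
  1# = ιℤ Δ (+ 1)

  ⟨_⟩ : FracIdeal Δ → K → Set
  ⟨ I ⟩ = carrier I

  1≢0 : 1# ≢ 0#
  1≢0 ()

  ιℤ-* : ∀ m n → ιℤ Δ (m ℤ.* n) ≡ ιℤ Δ m · ιℤ Δ n
  ιℤ-* m n = cong₂ _,_
    (trans (/1-* m n) (sym (trans (cong (m ℚ./ 1 ℚ.* (n ℚ./ 1) ℚ.+_) (ℚ.*-zeroʳ (Δ ℚ./ 1 ℚ.* ℚ.0ℚ))) (ℚ.+-identityʳ (m ℚ./ 1 ℚ.* (n ℚ./ 1))))))
    (sym (trans (cong₂ ℚ._+_ (ℚ.*-zeroʳ (m ℚ./ 1)) (ℚ.*-zeroˡ (n ℚ./ 1))) refl))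

  ιℤ≢0 : ∀ {n} → n ≢ + 0 → ιℤ Δ n ≢ 0#
  ιℤ≢0 n≢0 e = n≢0 (/1-injective (cong proj₁ e))

  inverse-nonzero : ∀ x y → x · y ≡ 1# → y ≢ 0#
  inverse-nonzero x _ xy≡1 refl = 1≢0 (trans (sym xy≡1) (zeroʳ x))

  ·-nonzero : ∀ x y → x ≢ 0# → y ≢ 0# → x · y ≢ 0#
  ·-nonzero x y x≢0 y≢0 xy≡0 with inverse x x≢0
  ... | x⁻¹ , xx⁻¹≡1 = y≢0 (begin
    y               ≡⟨ *-identityˡ y ⟨
    1# · y          ≡⟨ cong (_· y) xx⁻¹≡1 ⟨
    x · x⁻¹ · y     ≡⟨ cong (_· y) (*-comm x x⁻¹) ⟩
    x⁻¹ · x · y     ≡⟨ *-assoc x⁻¹ x y ⟩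
    x⁻¹ · (x · y)   ≡⟨ cong (x⁻¹ ·_) xy≡0 ⟩
    x⁻¹ · 0#        ≡⟨ zeroʳ x⁻¹ ⟩
    0#              ∎)
    where open ≡-Reasoning

  cancel-inverseˡ : ∀ x x⁻¹ → x · x⁻¹ ≡ 1# → ∀ y → x⁻¹ · (x · y) ≡ y
  cancel-inverseˡ x x⁻¹ e y = begin
    x⁻¹ · (x · y) ≡⟨ *-assoc x⁻¹ x y ⟨
    x⁻¹ · x · y   ≡⟨ cong (_· y) (trans (*-comm x⁻¹ x) e) ⟩
    1# · y        ≡⟨ *-identityˡ y ⟩
    y             ∎
    where open ≡-Reasoning

  cancel-inverseʳ : ∀ x x⁻¹ → x · x⁻¹ ≡ 1# → ∀ y → x · (x⁻¹ · y) ≡ y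
  cancel-inverseʳ x x⁻¹ e = cancel-inverseˡ x⁻¹ x (trans (*-comm x⁻¹ x) e)

  ·-cancelˡ : ∀ x y z → x ≢ 0# → x · y ≡ x · z → y ≡ z
  ·-cancelˡ x y z x≢0 e with inverse x x≢0
  ... | x⁻¹ , xx⁻¹≡1 =
    trans (sym (cancel-inverseˡ x x⁻¹ xx⁻¹≡1 y)) (trans (cong (x⁻¹ ·_) e) (cancel-inverseˡ x x⁻¹ xx⁻¹≡1 z))

  ≈-from : ∀ {P Q : K → Set} → (∀ {x} → P x → Q x) → (∀ {x} → Q x → P x) → P ≈ Q
  ≈-from to from x = mk⇔ to from

  to : ∀ {P Q : K → Set} → P ≈ Q → ∀ {x} → P x → Q x
  to e {x} = Equivalence.to (e x)

  from : ∀ {P Q : K → Set} → P ≈ Q → ∀ {x} → Q x → P x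
  from e {x} = Equivalence.from (e x)

  Product : (K → Set) → (K → Set) → K → Set
  Product = Prod Δ

  Scale : K → (K → Set) → K → Set
  Scale α P x = ∃[ y ] P y × x ≡ α · y

  Product-mono : ∀ {P P′ Q Q′ : K → Set} → (∀ {x} → P x → P′ x) → (∀ {x} → Q x → Q′ x)
    → ∀ {x} → Product P Q x → Product P′ Q′ x
  Product-mono f g p-zero = p-zero
  Product-mono f g (p-mul p q) = p-mul (f p) (g q)
  Product-mono f g (p-add x y) = p-add (Product-mono f g x) (Product-mono f g y)

  Product-swap : ∀ {P Q : K → Set} {x} → Product P Q x → Product Q P x
  Product-swap p-zero = p-zero
  Product-swap {P} {Q} (p-mul {a} {b} p q) = subst (Product Q P) (*-comm b a) (p-mul q p)
  Product-swap (p-add x y) = p-add (Product-swap x) (Product-swap y)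

  Product-reassoc : ∀ {P Q R : K → Set} {x} → Product (Product P Q) R x → Product P (Product Q R) x
  Product-reassoc p-zero = p-zero
  Product-reassoc (p-add x y) = p-add (Product-reassoc x) (Product-reassoc y)
  Product-reassoc {P} {Q} {R} (p-mul {b = c} pq r) = go pq
    where
    go : ∀ {a} → Product P Q a → Product P (Product Q R) (a · c)
    go p-zero = subst (Product P (Product Q R)) (sym (zeroˡ c)) p-zero
    go (p-mul {a} {b} p q) = subst (Product P (Product Q R)) (sym (*-assoc a b c)) (p-mul p (p-mul q r))
    go (p-add {x} {y} u v) = subst (Product P (Product Q R)) (sym (distribʳ c x y)) (p-add (go u) (go v))

  Product-commutativeSemigroup : CommutativeSemigroup (lsuc 0ℓ) 0ℓ
  Product-commutativeSemigroup = record
    { Carrier = K → Set ; _≈_ = _≈_ ; _∙_ = Product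
    ; isCommutativeSemigroup = record
      { isSemigroup = record
        { isMagma = record
          { isEquivalence = record
            { refl = λ x → IsEq.refl ; sym = λ e x → IsEq.sym (e x) ; trans = λ e f x → IsEq.trans (e x) (f x) }
          ; ∙-cong = λ e f → ≈-from (Product-mono (to e) (to f)) (Product-mono (from e) (from f)) }
        -- The reverse inclusion is `Product-reassoc` for R, Q, P, conjugated by commutativity.
        ; assoc = λ P Q R → ≈-from Product-reassoc
            (Product-mono Product-swap id ∘ Product-swap ∘ Product-reassoc ∘ Product-swap ∘ Product-mono id Product-swap) }
      ; comm = λ P Q → ≈-from Product-swap Product-swap
      }
    }
    where
    import Relation.Binary.Structures
    module IsEq = Relation.Binary.Structures.IsEquivalence (⇔-isEquivalence {0ℓ})

  module ⊛ = CommutativeSemigroup Product-commutativeSemigroup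

  Product-scale : ∀ α {P Q : K → Set} → Product P (Scale α Q) ≈ Scale α (Product P Q)
  Product-scale α {P} {Q} = ≈-from pull λ { (y , pq , refl) → push pq }
    where
    pull : ∀ {x} → Product P (Scale α Q) x → Scale α (Product P Q) x
    pull p-zero = 0# , p-zero , sym (zeroʳ α)
    pull (p-mul {a} p (b , q , refl)) = a · b , p-mul p q , x∙yz≈y∙xz a α b
    pull (p-add u v) with pull u | pull v
    ... | a , pa , refl | b , pb , refl = _ , p-add pa pb , sym (distribˡ α a b)
    push : ∀ {y} → Product P Q y → Product P (Scale α Q) (α · y)
    push p-zero = subst (Product P (Scale α Q)) (sym (zeroʳ α)) p-zero
    push (p-mul {a} {b} p q) =
      subst (Product P (Scale α Q)) (x∙yz≈y∙xz a α b) (p-mul p (b , q , refl))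
    push (p-add {x} {y} u v) =
      subst (Product P (Scale α Q)) (sym (distribˡ α x y)) (p-add (push u) (push v))

  Product-𝒪-closed : ∀ {P Q : K → Set} → (∀ {r x} → InO Δ r → P x → P (r · x))
    → ∀ {r x} → InO Δ r → Product P Q x → Product P Q (r · x)
  Product-𝒪-closed {P} {Q} closed {r} r∈ p-zero = subst (Product P Q) (sym (zeroʳ r)) p-zero
  Product-𝒪-closed {P} {Q} closed {r} r∈ (p-mul {a} {b} p q) =
    subst (Product P Q) (*-assoc r a b) (p-mul (closed r∈ p) q)
  Product-𝒪-closed {P} {Q} closed {r} r∈ (p-add {x} {y} u v) =
    subst (Product P Q) (sym (distribˡ r x y))
      (p-add (Product-𝒪-closed closed r∈ u) (Product-𝒪-closed closed r∈ v))

  𝒪 : FracIdeal Δ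
  𝒪 = record
    { carrier = InO Δ
    ; has-zero = ιℤ∈𝒪 (+ 0)
    ; +-closed = +-closed-𝒪
    ; O-closed = *-closed-𝒪
    ; nonzero = 1# , ιℤ∈𝒪 (+ 1) , 1≢0
    ; bounded = + 1 , (λ ()) , *-closed-𝒪 (ιℤ∈𝒪 (+ 1))
    }

  nonzero-product : ∀ {m n} → m ≢ + 0 → n ≢ + 0 → m ℤ.* n ≢ + 0
  nonzero-product {m} m≢0 n≢0 mn≡0 with ℤ.i*j≡0⇒i≡0∨j≡0 m mn≡0
  ... | inj₁ m≡0 = m≢0 m≡0
  ... | inj₂ n≡0 = n≢0 n≡0

  Nonzero Bounded : (K → Set) → Set
  Nonzero P = ∃[ x ] P x × x ≢ 0#
  Bounded P = ∃[ d ] d ≢ + 0 × (∀ {x} → P x → InO Δ (ιℤ Δ d · x))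

  Product-nonzero : ∀ {P Q : K → Set} → Nonzero P → Nonzero Q → Nonzero (Product P Q)
  Product-nonzero (x , p , x≢0) (y , q , y≢0) = x · y , p-mul p q , ·-nonzero x y x≢0 y≢0

  Product-bounded : ∀ {P Q : K → Set} → Bounded P → Bounded Q → Bounded (Product P Q)
  Product-bounded {P} {Q} (d , d≢0 , dP⊆𝒪) (e , e≢0 , eQ⊆𝒪) = d ℤ.* e , nonzero-product d≢0 e≢0 , bound
    where
    bound : ∀ {z} → Product P Q z → InO Δ (ιℤ Δ (d ℤ.* e) · z)
    bound p-zero = subst (InO Δ) (sym (zeroʳ (ιℤ Δ (d ℤ.* e)))) (ιℤ∈𝒪 (+ 0))
    bound (p-mul {a} {b} p q) = subst (InO Δ)
      (trans (interchange (ιℤ Δ d) a (ιℤ Δ e) b) (cong (_· (a · b)) (sym (ιℤ-* d e))))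
      (*-closed-𝒪 (dP⊆𝒪 p) (eQ⊆𝒪 q))
    bound (p-add {x} {y} u v) =
      subst (InO Δ) (sym (distribˡ (ιℤ Δ (d ℤ.* e)) x y)) (+-closed-𝒪 (bound u) (bound v))

  product-ideal : FracIdeal Δ → FracIdeal Δ → FracIdeal Δ
  product-ideal I J = record
    { carrier = Product ⟨ I ⟩ ⟨ J ⟩
    ; has-zero = p-zero
    ; +-closed = p-add
    ; O-closed = Product-𝒪-closed (O-closed I)
    ; nonzero = Product-nonzero (nonzero I) (nonzero J)
    ; bounded = Product-bounded (bounded I) (bounded J)
    }

  -- Opaque, and not itself a record, so that conversion checking never η-expands products.
  infixl 7 _⊗_
  opaque
    _⊗_ : FracIdeal Δ → FracIdeal Δ → FracIdeal Δ
    _⊗_ = product-ideal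

  infix 4 _∼_
  -- `SameClass` unfolds to a statement about the carriers alone; the record keeps the two ideals
  -- visible in the type.
  record _∼_ (I J : FracIdeal Δ) : Set where
    constructor ∼-intro
    field sameClass : SameClass Δ I J
  open _∼_ public

  ≈⇒∼ : ∀ {I J} → ⟨ I ⟩ ≈ ⟨ J ⟩ → I ∼ J
  ≈⇒∼ {I} {J} I≈J = ∼-intro $ 1# , 1≢0 , ≈-from
    (λ {x} x∈I → x , to I≈J x∈I , sym (*-identityˡ x))
    (λ { (y , y∈J , refl) → subst ⟨ I ⟩ (sym (*-identityˡ y)) (from I≈J y∈J) })

  ∼-sym : ∀ {I J} → I ∼ J → J ∼ I
  ∼-sym {I} {J} (∼-intro (α , α≢0 , I≈αJ)) with inverse α α≢0
  ... | α⁻¹ , αα⁻¹≡1 = ∼-intro $ α⁻¹ , inverse-nonzero α α⁻¹ αα⁻¹≡1 , ≈-from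
    (λ {x} x∈J → α · x , from I≈αJ (x , x∈J , refl) , sym (cancel-inverseˡ α α⁻¹ αα⁻¹≡1 x))
    (λ { (y , y∈I , refl) → let (z , z∈J , y≡αz) = to I≈αJ y∈I in
         subst ⟨ J ⟩ (sym (trans (cong (α⁻¹ ·_) y≡αz) (cancel-inverseˡ α α⁻¹ αα⁻¹≡1 z))) z∈J })

  ∼-trans : ∀ {I J L} → I ∼ J → J ∼ L → I ∼ L
  ∼-trans {I} {J} {L} (∼-intro (α , α≢0 , I≈αJ)) (∼-intro (β , β≢0 , J≈βL)) = ∼-intro $ α · β , ·-nonzero α β α≢0 β≢0 , ≈-from
    (λ x∈I → let (y , y∈J , x≡) = to I≈αJ x∈I ; (z , z∈L , y≡) = to J≈βL y∈J in
       z , z∈L , trans x≡ (trans (cong (α ·_) y≡) (sym (*-assoc α β z))))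
    (λ { (z , z∈L , refl) → from I≈αJ (β · z , from J≈βL (z , z∈L , refl) , *-assoc α β z) })

  opaque
    unfolding _⊗_

    ⊗-congˡ : ∀ M {I J} → I ∼ J → M ⊗ I ∼ M ⊗ J
    ⊗-congˡ M {I} {J} (∼-intro (α , α≢0 , I≈αJ)) = ∼-intro $
      α , α≢0 , ⊛.trans (⊛.∙-congˡ {x = ⟨ M ⟩} I≈αJ) (Product-scale α)

  opaque
    unfolding _⊗_

    ⊗-comm : ∀ I J → I ⊗ J ∼ J ⊗ I
    ⊗-comm I J = ≈⇒∼ (⊛.comm ⟨ I ⟩ ⟨ J ⟩)

  ⊗-congʳ : ∀ M {I J} → I ∼ J → I ⊗ M ∼ J ⊗ M
  ⊗-congʳ M {I} {J} I∼J = ∼-trans (⊗-comm I M) (∼-trans (⊗-congˡ M I∼J) (⊗-comm M J))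

  opaque
    unfolding _⊗_

    ⊗-assoc : ∀ I J L → (I ⊗ J) ⊗ L ∼ I ⊗ (J ⊗ L)
    ⊗-assoc I J L = ≈⇒∼ (⊛.assoc ⟨ I ⟩ ⟨ J ⟩ ⟨ L ⟩)

  Product-identityˡ : ∀ I → Product (InO Δ) ⟨ I ⟩ ≈ ⟨ I ⟩
  Product-identityˡ I = ≈-from absorb
    (λ {x} x∈I → subst (Product (InO Δ) ⟨ I ⟩) (*-identityˡ x) (p-mul (ιℤ∈𝒪 (+ 1)) x∈I))
    where
    absorb : ∀ {x} → Product (InO Δ) ⟨ I ⟩ x → ⟨ I ⟩ x
    absorb p-zero = has-zero I
    absorb (p-mul r∈𝒪 x∈I) = O-closed I r∈𝒪 x∈I
    absorb (p-add u v) = +-closed I (absorb u) (absorb v)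

  opaque
    unfolding _⊗_

    ⊗-identityˡ : ∀ I → 𝒪 ⊗ I ∼ I
    ⊗-identityˡ I = ≈⇒∼ (Product-identityˡ I)

    Product≈principal⇒⊗∼𝒪 : ∀ I J {α} → α ≢ 0# → Product ⟨ I ⟩ ⟨ J ⟩ ≈ Scale α (InO Δ) → I ⊗ J ∼ 𝒪
    Product≈principal⇒⊗∼𝒪 I J {α} α≢0 IJ≈α𝒪 = ∼-intro (α , α≢0 , IJ≈α𝒪)

    Product≈𝒪⇒⊗∼𝒪 : ∀ I J → Product ⟨ I ⟩ ⟨ J ⟩ ≈ InO Δ → I ⊗ J ∼ 𝒪
    Product≈𝒪⇒⊗∼𝒪 I J IJ≈𝒪 = ≈⇒∼ IJ≈𝒪

  ⊗-cancelʳ : ∀ {M I} → Invertible Δ I → M ⊗ I ∼ I → M ∼ 𝒪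
  ⊗-cancelʳ {M} {I} (J , IJ≈𝒪) MI∼I =
    ∼-trans (∼-sym (⊗-identityˡ M))
    (∼-trans (⊗-comm 𝒪 M)
    (∼-trans (⊗-congˡ M (∼-sym IJ∼𝒪))
    (∼-trans (∼-sym (⊗-assoc M I J))
    (∼-trans (⊗-congʳ J MI∼I) IJ∼𝒪))))
    where
    IJ∼𝒪 : I ⊗ J ∼ 𝒪
    IJ∼𝒪 = Product≈𝒪⇒⊗∼𝒪 I J IJ≈𝒪

  opaque
    unfolding _⊗_

    ⊗-invertible : ∀ {I J} → Invertible Δ I → Invertible Δ J → Invertible Δ (I ⊗ J)
    ⊗-invertible {I} {J} (I′ , II′≈𝒪) (J′ , JJ′≈𝒪) = I′ ⊗ J′ ,
      ⊛.trans (Interchange.interchange ⟨ I ⟩ ⟨ J ⟩ ⟨ I′ ⟩ ⟨ J′ ⟩)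
      (⊛.trans (⊛.∙-cong II′≈𝒪 JJ′≈𝒪) (Product-identityˡ 𝒪))
      where module Interchange = CommutativeSemigroupProperties Product-commutativeSemigroup

  -- Writing 1 = Σ aᵢbᵢ with aᵢ ∈ I and bᵢ ∈ I⁻¹ exhibits κ = Σ (κaᵢ)bᵢ as an element of I I⁻¹.
  multiplier∈𝒪 : ∀ {I} → Invertible Δ I → ∀ κ → (∀ {x} → ⟨ I ⟩ x → ⟨ I ⟩ (κ · x)) → InO Δ κ
  multiplier∈𝒪 {I} (J , IJ≈𝒪) κ κI⊆I =
    to IJ≈𝒪 (subst (Product ⟨ I ⟩ ⟨ J ⟩) (*-identityʳ κ) (go (from IJ≈𝒪 (ιℤ∈𝒪 (+ 1)))))
    where
    go : ∀ {t} → Product ⟨ I ⟩ ⟨ J ⟩ t → Product ⟨ I ⟩ ⟨ J ⟩ (κ · t)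
    go p-zero = subst (Product ⟨ I ⟩ ⟨ J ⟩) (sym (zeroʳ κ)) p-zero
    go (p-mul {a} {b} p q) = subst (Product ⟨ I ⟩ ⟨ J ⟩) (*-assoc κ a b) (p-mul (κI⊆I p) q)
    go (p-add {x} {y} u v) = subst (Product ⟨ I ⟩ ⟨ J ⟩) (sym (distribˡ κ x y)) (p-add (go u) (go v))

  -- The ideal a⁻¹J, described as the preimage of J under multiplication by a, so that its closure
  -- properties are those of J.
  divide : ∀ a → a ≢ + 0 → FracIdeal Δ → FracIdeal Δ
  divide a a≢0 J = record
    { carrier = λ x → ⟨ J ⟩ (ιℤ Δ a · x)
    ; has-zero = subst ⟨ J ⟩ (sym (zeroʳ (ιℤ Δ a))) (has-zero J)
    ; +-closed = λ {x} {y} p q → subst ⟨ J ⟩ (sym (distribˡ (ιℤ Δ a) x y)) (+-closed J p q)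
    ; O-closed = λ {r} {x} r∈ p → subst ⟨ J ⟩ (x∙yz≈y∙xz r (ιℤ Δ a) x) (O-closed J r∈ p)
    ; nonzero = divide-nonzero (nonzero J) (inverse (ιℤ Δ a) (ιℤ≢0 a≢0))
    ; bounded = divide-bounded (bounded J)
    }
    where
    divide-nonzero : Nonzero ⟨ J ⟩ → ∃[ a⁻¹ ] ιℤ Δ a · a⁻¹ ≡ 1# → Nonzero (λ x → ⟨ J ⟩ (ιℤ Δ a · x))
    divide-nonzero (y , y∈J , y≢0) (a⁻¹ , aa⁻¹≡1) =
      a⁻¹ · y , subst ⟨ J ⟩ (sym (cancel-inverseʳ (ιℤ Δ a) a⁻¹ aa⁻¹≡1 y)) y∈J
              , ·-nonzero a⁻¹ y (inverse-nonzero (ιℤ Δ a) a⁻¹ aa⁻¹≡1) y≢0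
    divide-bounded : Bounded ⟨ J ⟩ → Bounded (λ x → ⟨ J ⟩ (ιℤ Δ a · x))
    divide-bounded (e , e≢0 , eJ⊆𝒪) = e ℤ.* a , nonzero-product e≢0 a≢0 , λ {x} p →
      subst (InO Δ) (sym (trans (cong (_· x) (ιℤ-* e a)) (*-assoc (ιℤ Δ e) (ιℤ Δ a) x))) (eJ⊆𝒪 p)

  -- From IJ = (a) the inverse of I is a⁻¹J. Multiplying a sum of products by a, or by a⁻¹, term by
  -- term carries one equality to the other.
  invertible-by : ∀ {I} J a → a ≢ + 0 → Product ⟨ I ⟩ ⟨ J ⟩ ≈ Scale (ιℤ Δ a) (InO Δ) → Invertible Δ I
  invertible-by {I} J a a≢0 IJ≈a𝒪 = divide a a≢0 J , ≈-from unscale rescale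
    where
    α : K
    α = ιℤ Δ a
    α≢0 : α ≢ 0#
    α≢0 = ιℤ≢0 a≢0
    α⁻¹ : K
    α⁻¹ = proj₁ (inverse α α≢0)
    αα⁻¹≡1 : α · α⁻¹ ≡ 1#
    αα⁻¹≡1 = proj₂ (inverse α α≢0)
    grow : ∀ {x} → Product ⟨ I ⟩ ⟨ divide a a≢0 J ⟩ x → Product ⟨ I ⟩ ⟨ J ⟩ (α · x)
    grow p-zero = subst (Product ⟨ I ⟩ ⟨ J ⟩) (sym (zeroʳ α)) p-zero
    grow (p-mul {x} {y} p q) = subst (Product ⟨ I ⟩ ⟨ J ⟩) (x∙yz≈y∙xz x α y) (p-mul p q)
    grow (p-add {x} {y} u v) = subst (Product ⟨ I ⟩ ⟨ J ⟩) (sym (distribˡ α x y)) (p-add (grow u) (grow v))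
    unscale : ∀ {x} → Product ⟨ I ⟩ ⟨ divide a a≢0 J ⟩ x → InO Δ x
    unscale {x} p with to IJ≈a𝒪 (grow p)
    ... | y , y∈𝒪 , αx≡αy = subst (InO Δ) (sym (·-cancelˡ α x y α≢0 αx≡αy)) y∈𝒪
    shrink : ∀ {z} → Product ⟨ I ⟩ ⟨ J ⟩ z → Product ⟨ I ⟩ ⟨ divide a a≢0 J ⟩ (α⁻¹ · z)
    shrink p-zero = subst (Product ⟨ I ⟩ ⟨ divide a a≢0 J ⟩) (sym (zeroʳ α⁻¹)) p-zero
    shrink (p-mul {x} {y} p q) =
      subst (Product ⟨ I ⟩ ⟨ divide a a≢0 J ⟩) (x∙yz≈y∙xz x α⁻¹ y)
        (p-mul p (subst ⟨ J ⟩ (sym (cancel-inverseʳ α α⁻¹ αα⁻¹≡1 y)) q))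
    shrink (p-add {x} {y} u v) =
      subst (Product ⟨ I ⟩ ⟨ divide a a≢0 J ⟩) (sym (distribˡ α⁻¹ x y)) (p-add (shrink u) (shrink v))
    rescale : ∀ {x} → InO Δ x → Product ⟨ I ⟩ ⟨ divide a a≢0 J ⟩ x
    rescale {x} x∈𝒪 = subst (Product ⟨ I ⟩ ⟨ divide a a≢0 J ⟩) (cancel-inverseˡ α α⁻¹ αα⁻¹≡1 x)
      (shrink (from IJ≈a𝒪 (x , x∈𝒪 , refl)))

  -- Multiplication by a class of order two is a fixed-point-free involution of the class group.
  order-two-class⇒even : ∀ {h M} → HasClassNumber Δ h → Invertible Δ M → M ⊗ M ∼ 𝒪 → ¬ (M ∼ 𝒪) → 2 ∣ h
  order-two-class⇒even {h} {M} (rep , rep-invertible , rep-distinct , rep-covers) M-invertible MM∼𝒪 M≁𝒪 =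
    FiniteCounting.fixed-point-free-involution⇒even f involutive no-fixed-point
    where
    f : Fin h → Fin h
    f i = proj₁ (rep-covers (M ⊗ rep i) (⊗-invertible M-invertible (rep-invertible i)))
    f-class : ∀ i → M ⊗ rep i ∼ rep (f i)
    f-class i = ∼-intro $ proj₂ (rep-covers (M ⊗ rep i) (⊗-invertible M-invertible (rep-invertible i)))
    involutive : ∀ i → f (f i) ≡ i
    involutive i = rep-distinct (f (f i)) i $ sameClass
      (∼-trans (∼-sym (f-class (f i)))
      (∼-trans (⊗-congˡ M (∼-sym (f-class i)))
      (∼-trans (∼-sym (⊗-assoc M M (rep i)))
      (∼-trans (⊗-congʳ (rep i) MM∼𝒪) (⊗-identityˡ (rep i))))))
    no-fixed-point : ∀ i → f i ≢ i
    no-fixed-point i fi≡i =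
      M≁𝒪 (⊗-cancelʳ (rep-invertible i) (subst (λ j → M ⊗ rep i ∼ rep j) fi≡i (f-class i)))

-- The order ℤ[√D] with D = k(k + 2), its norm, and inversion in K.

module EmbeddedOrder (k : ℕ) (k>0 : 0 ℕ.< k) where

  open import Algebra.Bundles using (CommutativeRing)
  import Algebra.Properties.CommutativeSemigroup as CommutativeSemigroupProperties
  open import Data.Integer as ℤ using (ℤ; +_)
  import Data.Integer.Properties as ℤ
  open import Data.Integer.Tactic.RingSolver using () renaming (solve-∀ to solve-ℤ)
  import Data.Nat.Properties as ℕ
  open import Data.Product using (∃-syntax; _×_; _,_; proj₁; proj₂)
  open import Data.Rational using (_+_; _*_; _/_; ½; 0ℚ; 1/_; ↥_; ↧_; ≢-nonZero)
  open import Data.Rational.Properties using (*-inverseʳ)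
  open import Relation.Binary.PropositionalEquality
  open import Relation.Nullary using (contradiction)
  open import Tactic.RingSolver using (solve-∀)
  open RationalArithmetic
  open IntegerArithmetic

  opaque
    D : ℤ
    D = + d k

    D≡+d : D ≡ + d k
    D≡+d = refl

  D≡k[k+2] : D ≡ + k ℤ.* (+ 2 ℤ.+ + k)
  D≡k[k+2] = trans D≡+d (ℤ.pos-* k (2 ℕ.+ k))

  Δ m : ℤ
  Δ = + 4 ℤ.* D
  m = + ℕ.suc k

  N : ℤ → ℤ → ℤ
  N u v = u ℤ.* u ℤ.- D ℤ.* (v ℤ.* v)

  opaque
    unfolding D

    N-ε : ∀ u v → N (m ℤ.* u ℤ.+ D ℤ.* v) (m ℤ.* v ℤ.+ u) ≡ N u v
    N-ε = norm-ε k

    N-ε⁻¹ : ∀ u v → N (m ℤ.* u ℤ.- D ℤ.* v) (m ℤ.* v ℤ.- u) ≡ N u v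
    N-ε⁻¹ = norm-ε⁻¹ k

    N-descent : (Q : ℤ → ℤ → Set)
      → (∀ {u v} → Q u v → Q (m ℤ.* u ℤ.+ D ℤ.* v) (m ℤ.* v ℤ.+ u))
      → (∀ {u v} → Q u v → Q (m ℤ.* u ℤ.- D ℤ.* v) (m ℤ.* v ℤ.- u))
      → ∀ {u v} → Q u v
      → ∃[ u′ ] ∃[ v′ ] (Q u′ v′ × 2 ℕ.* k ℕ.* (ℤ.∣ v′ ∣ ℕ.* ℤ.∣ v′ ∣) ℕ.≤ ℤ.∣ N u′ v′ ∣)
    N-descent = descent k

  open FieldRing Δ using (K-commutativeRing)
  private
    module K = CommutativeRing K-commutativeRing
    module K* = CommutativeSemigroupProperties K.*-commutativeSemigroup
    infixl 7 _·_
    _·_ : K → K → K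
    _·_ = _*K_ Δ
    1# : K
    1# = ιℤ Δ (+ 1)

  opaque
    -- The element u + v√D. Pairs in K are coordinates with respect to √Δ = 2√D, whence the ½.
    emb : ℤ → ℤ → K
    emb u v = u / 1 , v / 1 * ½

    emb-+ : ∀ u v u′ v′ → _+K_ Δ (emb u v) (emb u′ v′) ≡ emb (u ℤ.+ u′) (v ℤ.+ v′)
    emb-+ u v u′ v′ = cong₂ _,_ (sym (/1-+ u u′))
      (trans (factor (v / 1) (v′ / 1)) (cong (_* ½) (sym (/1-+ v v′))))
      where
      factor : ∀ V V′ → V * ½ + V′ * ½ ≡ (V + V′) * ½
      factor = solve-∀ ℚ-ring

  Δ/1≡4D : Δ / 1 ≡ + 4 / 1 * (D / 1)
  Δ/1≡4D = /1-* (+ 4) D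

  opaque
    unfolding emb

    emb-* : ∀ u v u′ v′ → emb u v · emb u′ v′ ≡ emb (u ℤ.* u′ ℤ.+ D ℤ.* (v ℤ.* v′)) (u ℤ.* v′ ℤ.+ v ℤ.* u′)
    emb-* u v u′ v′ = cong₂ _,_
      (trans (cong (λ δ → u / 1 * (u′ / 1) + δ * (v / 1 * ½) * (v′ / 1 * ½)) Δ/1≡4D)
        (trans (rational-part (u / 1) (u′ / 1) (v / 1) (v′ / 1) (D / 1))
          (sym (trans (/1-+ (u ℤ.* u′) (D ℤ.* (v ℤ.* v′)))
            (cong₂ _+_ (/1-* u u′) (trans (/1-* D (v ℤ.* v′)) (cong (λ x → D / 1 * x) (/1-* v v′))))))))
      (trans (irrational-part (u / 1) (u′ / 1) (v / 1) (v′ / 1))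
        (cong (_* ½) (sym (trans (/1-+ (u ℤ.* v′) (v ℤ.* u′)) (cong₂ _+_ (/1-* u v′) (/1-* v u′))))))
      where
      rational-part : ∀ U U′ V V′ E → U * U′ + (+ 4 / 1 * E) * (V * ½) * (V′ * ½) ≡ U * U′ + E * (V * V′)
      rational-part = solve-∀ ℚ-ring
      irrational-part : ∀ U U′ V V′ → U * (V′ * ½) + V * ½ * U′ ≡ (U * V′ + V * U′) * ½
      irrational-part = solve-∀ ℚ-ring

    emb-injective : ∀ {u v u′ v′} → emb u v ≡ emb u′ v′ → u ≡ u′ × v ≡ v′
    emb-injective {v = v} {v′ = v′} e =
        /1-injective (cong proj₁ e)
      , /1-injective (trans (double (v / 1)) (trans (cong (λ x → proj₂ x * (+ 2 / 1)) e) (sym (double (v′ / 1)))))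
      where
      double : ∀ V → V ≡ V * ½ * (+ 2 / 1)
      double = solve-∀ ℚ-ring

    emb-ι : ∀ u → ιℤ Δ u ≡ emb u (+ 0)
    emb-ι u = refl

    emb-0 : emb (+ 0) (+ 0) ≡ 0K Δ
    emb-0 = refl

  emb-scale : ∀ n u v → ιℤ Δ n · emb u v ≡ emb (n ℤ.* u) (n ℤ.* v)
  emb-scale n u v = trans (cong (_· emb u v) (emb-ι n)) (trans (emb-* n (+ 0) u v) (cong₂ emb (first n u v D) (second n u v)))
    where
    first : ∀ n u v D → n ℤ.* u ℤ.+ D ℤ.* (+ 0 ℤ.* v) ≡ n ℤ.* u
    first = solve-ℤ
    second : ∀ n u v → n ℤ.* v ℤ.+ + 0 ℤ.* u ≡ n ℤ.* v
    second = solve-ℤ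

  Δ/2≡2D : Δ / 2 ≡ (+ 2 ℤ.* D) / 1
  Δ/2≡2D = trans (/2≡/1*½ Δ) (trans (cong (_* ½) Δ/1≡4D) (trans (halve (D / 1)) (sym (/1-* (+ 2) D))))
    where
    halve : ∀ E → + 4 / 1 * E * ½ ≡ + 2 / 1 * E
    halve = solve-∀ ℚ-ring

  opaque
    unfolding emb

    -- Since Δ = 4D, the generator (Δ + √Δ)/2 equals 2D + √D. Hence 𝒪 = ℤ[√D], and passing between
    -- the two bases moves the integer part by 2Dv.
    𝒪⇒emb : ∀ {x} → InO Δ x → ∃[ u ] ∃[ v ] x ≡ emb u v
    𝒪⇒emb (u , v , e₁ , e₂) = u ℤ.+ v ℤ.* (+ 2 ℤ.* D) , v , cong₂ _,_
      (trans e₁ (trans (cong (λ δ → u / 1 + v / 1 * δ) Δ/2≡2D)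
        (sym (trans (/1-+ u (v ℤ.* (+ 2 ℤ.* D))) (cong (λ x → u / 1 + x) (/1-* v (+ 2 ℤ.* D)))))))
      e₂

    emb∈𝒪 : ∀ u v → InO Δ (emb u v)
    emb∈𝒪 u v = u ℤ.- v ℤ.* (+ 2 ℤ.* D) , v
      , trans (trans (cong (_/ 1) (shift u (v ℤ.* (+ 2 ℤ.* D)))) (trans (/1-+ (u ℤ.- v ℤ.* (+ 2 ℤ.* D)) (v ℤ.* (+ 2 ℤ.* D)))
          (cong (λ x → (u ℤ.- v ℤ.* (+ 2 ℤ.* D)) / 1 + x) (/1-* v (+ 2 ℤ.* D)))))
          (cong (λ δ → (u ℤ.- v ℤ.* (+ 2 ℤ.* D)) / 1 + v / 1 * δ) (sym Δ/2≡2D))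
      , refl
      where
      shift : ∀ u w → u ≡ u ℤ.- w ℤ.+ w
      shift = solve-ℤ

  ιℤ∈𝒪 : ∀ n → InO Δ (ιℤ Δ n)
  ιℤ∈𝒪 n = subst (InO Δ) (sym (emb-ι n)) (emb∈𝒪 n (+ 0))

  +-closed-𝒪 : ∀ {x y} → InO Δ x → InO Δ y → InO Δ (_+K_ Δ x y)
  +-closed-𝒪 {x} {y} x∈𝒪 y∈𝒪 = let (u , v , x≡) = 𝒪⇒emb {x} x∈𝒪 ; (u′ , v′ , y≡) = 𝒪⇒emb {y} y∈𝒪 in
    subst (InO Δ) (sym (trans (cong₂ (_+K_ Δ) x≡ y≡) (emb-+ u v u′ v′))) (emb∈𝒪 (u ℤ.+ u′) (v ℤ.+ v′))

  *-closed-𝒪 : ∀ {x y} → InO Δ x → InO Δ y → InO Δ (x · y)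
  *-closed-𝒪 {x} {y} x∈𝒪 y∈𝒪 = let (u , v , x≡) = 𝒪⇒emb {x} x∈𝒪 ; (u′ , v′ , y≡) = 𝒪⇒emb {y} y∈𝒪 in
    subst (InO Δ) (sym (trans (cong₂ _·_ x≡ y≡) (emb-* u v u′ v′)))
      (emb∈𝒪 (u ℤ.* u′ ℤ.+ D ℤ.* (v ℤ.* v′)) (u ℤ.* v′ ℤ.+ v ℤ.* u′))

  small-bound⇒v≡0 : ∀ B v → B ℕ.< 2 ℕ.* k → 2 ℕ.* k ℕ.* (ℤ.∣ v ∣ ℕ.* ℤ.∣ v ∣) ℕ.≤ B → v ≡ + 0
  small-bound⇒v≡0 B v B<2k h with ℤ.∣ v ∣ in eq
  ... | ℕ.zero = ℤ.∣i∣≡0⇒i≡0 eq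
  ... | ℕ.suc w = contradiction (ℕ.≤-trans (ℕ.m≤m*n (2 ℕ.* k) (ℕ.suc w ℕ.* ℕ.suc w)) h) (ℕ.<⇒≱ B<2k)

  -- This contains the nonsquareness of D. Descent from a zero of the norm ends at some u′, v′ with
  -- 2kv′² ≤ 0, so v′ = 0 and then u′ = 0. The second half of `Q` carries the vanishing back to the
  -- starting point, which is possible because ε is invertible.
  N≡0⇒0 : ∀ u v → N u v ≡ + 0 → u ≡ + 0 × v ≡ + 0
  N≡0⇒0 u v Nuv≡0 with N-descent Q Qε Qε⁻¹ {u} {v} (Nuv≡0 , λ p → p)
    where
    Q : ℤ → ℤ → Set
    Q u′ v′ = N u′ v′ ≡ + 0 × (u′ ≡ + 0 × v′ ≡ + 0 → u ≡ + 0 × v ≡ + 0)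
    -- The four identities are ε⁻¹ε = 1 and εε⁻¹ = 1 in coordinates. They need m² - D = 1, so D is
    -- written out in terms of k.
    unit₁ : ∀ k u v → let m = + 1 ℤ.+ k ; d = k ℤ.* (+ 2 ℤ.+ k) in
      u ≡ m ℤ.* (m ℤ.* u ℤ.+ d ℤ.* v) ℤ.- d ℤ.* (m ℤ.* v ℤ.+ u)
    unit₁ = solve-ℤ
    unit₂ : ∀ k u v → let m = + 1 ℤ.+ k ; d = k ℤ.* (+ 2 ℤ.+ k) in
      v ≡ m ℤ.* (m ℤ.* v ℤ.+ u) ℤ.- (m ℤ.* u ℤ.+ d ℤ.* v)
    unit₂ = solve-ℤ
    unit₃ : ∀ k u v → let m = + 1 ℤ.+ k ; d = k ℤ.* (+ 2 ℤ.+ k) in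
      u ≡ m ℤ.* (m ℤ.* u ℤ.- d ℤ.* v) ℤ.+ d ℤ.* (m ℤ.* v ℤ.- u)
    unit₃ = solve-ℤ
    unit₄ : ∀ k u v → let m = + 1 ℤ.+ k ; d = k ℤ.* (+ 2 ℤ.+ k) in
      v ≡ m ℤ.* (m ℤ.* v ℤ.- u) ℤ.+ (m ℤ.* u ℤ.- d ℤ.* v)
    unit₄ = solve-ℤ
    Qε : ∀ {u v} → Q u v → Q (m ℤ.* u ℤ.+ D ℤ.* v) (m ℤ.* v ℤ.+ u)
    Qε {u} {v} (e , f) = trans (N-ε u v) e , λ (p , q) →
      f ( trans (unit₁ (+ k) u v) (trans (cong (λ d → m ℤ.* (m ℤ.* u ℤ.+ d ℤ.* v) ℤ.- d ℤ.* (m ℤ.* v ℤ.+ u)) (sym D≡k[k+2]))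
            (trans (cong₂ (λ a b → m ℤ.* a ℤ.- D ℤ.* b) p q) (vanish m D)))
        , trans (unit₂ (+ k) u v) (trans (cong (λ d → m ℤ.* (m ℤ.* v ℤ.+ u) ℤ.- (m ℤ.* u ℤ.+ d ℤ.* v)) (sym D≡k[k+2]))
            (trans (cong₂ (λ a b → m ℤ.* b ℤ.- a) p q) (vanish′ m))))
      where
      vanish : ∀ m d → m ℤ.* + 0 ℤ.- d ℤ.* + 0 ≡ + 0
      vanish = solve-ℤ
      vanish′ : ∀ m → m ℤ.* + 0 ℤ.- + 0 ≡ + 0
      vanish′ = solve-ℤ
    Qε⁻¹ : ∀ {u v} → Q u v → Q (m ℤ.* u ℤ.- D ℤ.* v) (m ℤ.* v ℤ.- u)
    Qε⁻¹ {u} {v} (e , f) = trans (N-ε⁻¹ u v) e , λ (p , q) →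
      f ( trans (unit₃ (+ k) u v) (trans (cong (λ d → m ℤ.* (m ℤ.* u ℤ.- d ℤ.* v) ℤ.+ d ℤ.* (m ℤ.* v ℤ.- u)) (sym D≡k[k+2]))
            (trans (cong₂ (λ a b → m ℤ.* a ℤ.+ D ℤ.* b) p q) (vanish m D)))
        , trans (unit₄ (+ k) u v) (trans (cong (λ d → m ℤ.* (m ℤ.* v ℤ.- u) ℤ.+ (m ℤ.* u ℤ.- d ℤ.* v)) (sym D≡k[k+2]))
            (trans (cong₂ (λ a b → m ℤ.* b ℤ.+ a) p q) (vanish′ m))))
      where
      vanish : ∀ m d → m ℤ.* + 0 ℤ.+ d ℤ.* + 0 ≡ + 0
      vanish = solve-ℤ
      vanish′ : ∀ m → m ℤ.* + 0 ℤ.+ + 0 ≡ + 0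
      vanish′ = solve-ℤ
  ... | u′ , v′ , (Nu′v′≡0 , back) , bound =
    back (x*x≡0⇒x≡0 u′ (trans (sym (no-v D u′)) (trans (cong (N u′) (sym v′≡0)) Nu′v′≡0)) , v′≡0)
    where
    v′≡0 : v′ ≡ + 0
    v′≡0 = small-bound⇒v≡0 0 v′ (ℕ.<-≤-trans k>0 (ℕ.m≤m+n k (k ℕ.+ 0)))
      (subst (λ n → 2 ℕ.* k ℕ.* (ℤ.∣ v′ ∣ ℕ.* ℤ.∣ v′ ∣) ℕ.≤ ℤ.∣ n ∣) Nu′v′≡0 bound)
    no-v : ∀ D u → u ℤ.* u ℤ.- D ℤ.* (+ 0 ℤ.* + 0) ≡ u ℤ.* u
    no-v = solve-ℤ

  ιℤ-inverse : ∀ n → n ≢ + 0 → ∃[ y ] ιℤ Δ n · y ≡ 1#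
  ιℤ-inverse n n≢0 = (1/ (n / 1) , 0ℚ) ,
    cong₂ _,_ (trans (first (n / 1) (1/ (n / 1)) (Δ / 1)) (*-inverseʳ (n / 1))) (second (n / 1) (1/ (n / 1)))
    where
    instance _ = ≢-nonZero {n / 1} (λ e → n≢0 (/1-injective e))
    first : ∀ a b δ → a * b + δ * 0ℚ * 0ℚ ≡ a * b
    first = solve-∀ ℚ-ring
    second : ∀ a b → a * 0ℚ + 0ℚ * b ≡ 0ℚ
    second = solve-∀ ℚ-ring

  opaque
    unfolding emb

    clear-denominators : ∀ x → ∃[ n ] ∃[ u ] ∃[ v ] n ≢ + 0 × ιℤ Δ n · x ≡ emb u v
    clear-denominators (p@record{} , q@record{}) =
      -- The multiplier is the product of the denominators; the factor 2 in the last coordinate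
      -- compensates the ½ of `emb`.
      ↧ p ℤ.* ↧ q , ↥ p ℤ.* ↧ q , + 2 ℤ.* (↥ q ℤ.* ↧ p) , (λ ()) , cong₂ _,_
        (trans (cong (λ n → n * p + Δ / 1 * 0ℚ * q) (/1-* (↧ p) (↧ q)))
          (trans (first p q (↧ p / 1) (↧ q / 1) (Δ / 1))
            (trans (cong (_* (↧ q / 1)) (p*↧p≡↥p p)) (sym (/1-* (↥ p) (↧ q))))))
        (trans (cong (λ n → n * q + 0ℚ * p) (/1-* (↧ p) (↧ q)))
          (trans (second p q (↧ p / 1) (↧ q / 1))
            (cong (_* ½) (trans (cong (λ n → + 2 / 1 * (n * (↧ p / 1))) (p*↧p≡↥p q))
              (trans (cong (λ x → + 2 / 1 * x) (sym (/1-* (↥ q) (↧ p)))) (sym (/1-* (+ 2) (↥ q ℤ.* ↧ p))))))))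
      where
      first : ∀ p q a b δ → a * b * p + δ * 0ℚ * q ≡ p * a * b
      first = solve-∀ ℚ-ring
      second : ∀ p q a b → a * b * q + 0ℚ * p ≡ (+ 2 / 1 * (q * b * a)) * ½
      second = solve-∀ ℚ-ring

  emb-conj : ∀ u v → emb u v · emb u (ℤ.- v) ≡ ιℤ Δ (N u v)
  emb-conj u v =
    trans (emb-* u v u (ℤ.- v)) (trans (cong₂ emb (first u v D) (second u v)) (sym (emb-ι (N u v))))
    where
    first : ∀ u v D → u ℤ.* u ℤ.+ D ℤ.* (v ℤ.* (ℤ.- v)) ≡ u ℤ.* u ℤ.- D ℤ.* (v ℤ.* v)
    first = solve-ℤ
    second : ∀ u v → u ℤ.* (ℤ.- v) ℤ.+ v ℤ.* u ≡ + 0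
    second = solve-ℤ

  -- If nx = u + v√D with integral n ≠ 0, the inverse of x is n(u - v√D)/N(u, v), where N(u, v) ≠ 0
  -- by `N≡0⇒0`.
  K-inverse : ∀ x → x ≢ 0K Δ → ∃[ y ] x · y ≡ 1#
  K-inverse x x≢0 = ιℤ Δ n · (emb u (ℤ.- v) · N⁻¹) , (begin
    x · (ιℤ Δ n · (emb u (ℤ.- v) · N⁻¹))   ≡⟨ K*.x∙yz≈yx∙z x (ιℤ Δ n) (emb u (ℤ.- v) · N⁻¹) ⟩
    ιℤ Δ n · x · (emb u (ℤ.- v) · N⁻¹)     ≡⟨ cong (_· (emb u (ℤ.- v) · N⁻¹)) nx≡ ⟩
    emb u v · (emb u (ℤ.- v) · N⁻¹)        ≡⟨ K.*-assoc (emb u v) (emb u (ℤ.- v)) N⁻¹ ⟨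
    emb u v · emb u (ℤ.- v) · N⁻¹          ≡⟨ cong (_· N⁻¹) (emb-conj u v) ⟩
    ιℤ Δ (N u v) · N⁻¹                     ≡⟨ proj₂ (ιℤ-inverse (N u v) N≢0) ⟩
    1#                                     ∎)
    where
    open ≡-Reasoning
    n u v : ℤ
    n = proj₁ (clear-denominators x)
    u = proj₁ (proj₂ (clear-denominators x))
    v = proj₁ (proj₂ (proj₂ (clear-denominators x)))
    n≢0 : n ≢ + 0
    n≢0 = proj₁ (proj₂ (proj₂ (proj₂ (clear-denominators x))))
    nx≡ : ιℤ Δ n · x ≡ emb u v
    nx≡ = proj₂ (proj₂ (proj₂ (proj₂ (clear-denominators x))))
    n⁻¹ : K
    n⁻¹ = proj₁ (ιℤ-inverse n n≢0)
    emb≡0 : u ≡ + 0 × v ≡ + 0 → emb u v ≡ 0K Δ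
    emb≡0 (u≡0 , v≡0) = trans (cong₂ emb u≡0 v≡0) emb-0
    N≢0 : N u v ≢ + 0
    N≢0 N≡0 = x≢0 (begin
      x                     ≡⟨ K.*-identityˡ x ⟨
      1# · x                ≡⟨ cong (_· x) (proj₂ (ιℤ-inverse n n≢0)) ⟨
      ιℤ Δ n · n⁻¹ · x      ≡⟨ cong (_· x) (K.*-comm (ιℤ Δ n) n⁻¹) ⟩
      n⁻¹ · ιℤ Δ n · x      ≡⟨ K.*-assoc n⁻¹ (ιℤ Δ n) x ⟩
      n⁻¹ · (ιℤ Δ n · x)    ≡⟨ cong (n⁻¹ ·_) (trans nx≡ (emb≡0 (N≡0⇒0 u v N≡0))) ⟩
      n⁻¹ · 0K Δ            ≡⟨ K.zeroʳ n⁻¹ ⟩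
      0K Δ                  ∎)
    N⁻¹ : K
    N⁻¹ = proj₁ (ιℤ-inverse (N u v) N≢0)

  open Ideals Δ K-inverse ιℤ∈𝒪 +-closed-𝒪 *-closed-𝒪 public

-- Binary quadratic forms of discriminant Δ and their ideals.

module Forms (k : ℕ) (k>0 : 0 ℕ.< k) where

  open import Data.Integer hiding (suc)
  open import Data.Integer.Properties using () renaming (*-identityʳ to ℤ-*-identityʳ; *-assoc to ℤ-*-assoc; *-zeroʳ to ℤ-*-zeroʳ)
  open import Data.Integer.Tactic.RingSolver using (solve; solve-∀)
  open import Data.List using ([]; _∷_)
  open import Data.Product using (∃-syntax; _×_; _,_; proj₁; proj₂)
  open import Relation.Binary.PropositionalEquality
  open import Relation.Nullary using (Dec; yes; no; ¬_; contradiction)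
  open IntegerArithmetic
  open EmbeddedOrder k k>0

  -- The relation I = (β/n)J with the denominator cleared: nI = βJ.
  ratio-∼ : ∀ {I J} n β → n ≢ + 0 → β ≢ 0#
    → (∀ {x} → ⟨ I ⟩ x → ∃[ y ] ⟨ J ⟩ y × ιℤ Δ n · x ≡ β · y)
    → (∀ {y} → ⟨ J ⟩ y → ∃[ x ] ⟨ I ⟩ x × ιℤ Δ n · x ≡ β · y)
    → I ∼ J
  ratio-∼ {I} {J} n β n≢0 β≢0 I⇒J J⇒I = ∼-intro
    ( n⁻¹ · β
    , ·-nonzero n⁻¹ β (inverse-nonzero (ιℤ Δ n) n⁻¹ nn⁻¹≡1) β≢0
    , ≈-from
      (λ {x} x∈I → let (y , y∈J , nx≡βy) = I⇒J x∈I in y , y∈J , solve-for x y nx≡βy)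
      (λ { (y , y∈J , x≡) → let (x , x∈I , nx≡βy) = J⇒I y∈J in
           subst ⟨ I ⟩ (trans (solve-for x y nx≡βy) (sym x≡)) x∈I }))
    where
    n⁻¹ : K
    n⁻¹ = proj₁ (ιℤ-inverse n n≢0)
    nn⁻¹≡1 : ιℤ Δ n · n⁻¹ ≡ 1#
    nn⁻¹≡1 = proj₂ (ιℤ-inverse n n≢0)
    solve-for : ∀ x y → ιℤ Δ n · x ≡ β · y → x ≡ n⁻¹ · β · y
    solve-for x y nx≡βy = trans (sym (cancel-inverseˡ (ιℤ Δ n) n⁻¹ nn⁻¹≡1 x))
      (trans (cong (n⁻¹ ·_) nx≡βy) (sym (*-assoc n⁻¹ β y)))

  -- The form ax² + 2bxy + cy², whose discriminant 4(b² - ac) is Δ. The sign of a is left free.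
  record Form : Set where
    constructor form
    field
      a b c : ℤ
      disc : D ≡ b * b - a * c
  open Form

  conj : Form → Form
  conj (form a b c e) = form a (- b) c (trans e (cong (_- a * c) (even b)))
    where
    even : ∀ b → b * b ≡ (- b) * (- b)
    even = solve-∀

  -- The group L(a, b) = ℤa + ℤω with ω = b + √D. The coefficient of ω is the √D-coordinate itself.
  Lattice : ℤ → ℤ → K → Set
  Lattice a b x = ∃[ s ] ∃[ v ] x ≡ emb (s * a + v * b) v

  lattice-∈ : ∀ a b s v → Lattice a b (emb (s * a + v * b) v)
  lattice-∈ a b s v = s , v , refl

  emb≢0 : ∀ {u v} → v ≢ + 0 → emb u v ≢ 0#
  emb≢0 v≢0 e = v≢0 (proj₂ (emb-injective (trans e (sym emb-0))))

  emb-cong : ∀ {u u′ v v′} → u ≡ u′ → v ≡ v′ → emb u v ≡ emb u′ v′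
  emb-cong = cong₂ emb

  ideal : Form → FracIdeal Δ
  ideal (form a b c e) = record
    { carrier = Lattice a b
    ; has-zero = + 0 , + 0 , trans (sym emb-0) (emb-cong (zero-combination a b) refl)
    ; +-closed = λ {x} {y} (s , v , x≡) (s′ , v′ , y≡) → s + s′ , v + v′ ,
        trans (cong₂ (_+K_ Δ) x≡ y≡) (trans (emb-+ (s * a + v * b) v (s′ * a + v′ * b) v′)
          (emb-cong (add a b s v s′ v′) refl))
    -- In the basis a, ω multiplication by √D reads √D · a = -b · a + a · ω and √D · ω = -c · a + b
    -- · ω.
    ; O-closed = λ {r} {x} r∈𝒪 (s , v , x≡) → let (p , q , r≡) = 𝒪⇒emb {r} r∈𝒪 in
        p * s - q * (s * b + v * c) , p * v + q * (s * a + v * b) ,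
        trans (cong₂ _·_ r≡ x≡) (trans (emb-* p q (s * a + v * b) v)
          (emb-cong (multiply a b c p q s v D e) refl))
    ; nonzero = emb (+ 0 * a + 1ℤ * b) 1ℤ , lattice-∈ a b (+ 0) 1ℤ , emb≢0 (λ ())
    ; bounded = 1ℤ , (λ ()) , λ {x} (s , v , x≡) → subst (InO Δ)
        (sym (trans (*-identityˡ x) x≡)) (emb∈𝒪 (s * a + v * b) v)
    }
    where
    zero-combination : ∀ a b → + 0 ≡ + 0 * a + + 0 * b
    zero-combination = solve-∀
    add : ∀ a b s v s′ v′ → s * a + v * b + (s′ * a + v′ * b) ≡ (s + s′) * a + (v + v′) * b
    add = solve-∀
    multiply : ∀ a b c p q s v D → D ≡ b * b - a * c → p * (s * a + v * b) + D * (q * v)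
      ≡ (p * s - q * (s * b + v * c)) * a + (p * v + q * (s * a + v * b)) * b
    multiply a b c p q s v _ refl = solve (a ∷ b ∷ c ∷ p ∷ q ∷ s ∷ v ∷ [])

  square≢D : ∀ b → D ≢ b * b
  square≢D b e = contradiction (proj₂ (N≡0⇒0 b 1ℤ (trans (cong (λ D → b * b - D * 1ℤ) e) (cancel b)))) (λ ())
    where
    cancel : ∀ b → b * b - b * b * 1ℤ ≡ + 0
    cancel = solve-∀

  a≢0 : ∀ P → a P ≢ + 0
  a≢0 (form a b c e) refl = square≢D b (trans e (vanish b c))
    where
    vanish : ∀ b c → b * b - + 0 * c ≡ b * b
    vanish = solve-∀

  c≢0 : ∀ P → c P ≢ + 0
  c≢0 (form a b c e) refl = square≢D b (trans e (vanish b a))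
    where
    vanish : ∀ b a → b * b - a * + 0 ≡ b * b
    vanish = solve-∀

  shift-≈ : ∀ a b l → Lattice a b ≈ Lattice a (b + l * a)
  shift-≈ a b l = ≈-from
    (λ { (s , v , x≡) → s - v * l , v , trans x≡ (emb-cong (forth a b l s v) refl) })
    (λ { (s , v , x≡) → s + v * l , v , trans x≡ (emb-cong (back a b l s v) refl) })
    where
    forth : ∀ a b l s v → s * a + v * b ≡ (s - v * l) * a + v * (b + l * a)
    forth = solve-∀
    back : ∀ a b l s v → s * a + v * (b + l * a) ≡ (s + v * l) * a + v * b
    back = solve-∀

  flip : Form → Form
  flip (form a b c e) = form c (- b) a (trans e (swap a b c))
    where
    swap : ∀ a b c → b * b - a * c ≡ (- b) * (- b) - c * a
    swap = solve-∀

  -- With ω = b + √D one has (−b + √D)ω = −ac, hence c · L(a, b) = ω · L(c, −b).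
  flip-∼ : ∀ P → ideal P ∼ ideal (flip P)
  flip-∼ P@(form a b c e) = ratio-∼ c (emb b 1ℤ) (c≢0 P) (emb≢0 (λ ()))
    (λ {x} (s , v , x≡) → emb (v * c + (- s) * (- b)) (- s) , lattice-∈ c (- b) v (- s) ,
       trans (cong (ιℤ Δ c ·_) x≡) (match s v))
    (λ {y} (s , v , y≡) → emb ((- v) * a + s * b) s , lattice-∈ a b (- v) s ,
       trans (match (- v) s) (trans (cong (emb b 1ℤ ·_) (emb-cong (double-neg s v b c) (neg-neg v))) (cong (emb b 1ℤ ·_) (sym y≡))))
    where
    first : ∀ a b c s v D → D ≡ b * b - a * c →
      c * (s * a + v * b) ≡ b * (v * c + (- s) * (- b)) + D * (1ℤ * (- s))
    first a b c s v _ refl = solve (a ∷ b ∷ c ∷ s ∷ v ∷ [])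
    second : ∀ b c s v → c * v ≡ b * (- s) + 1ℤ * (v * c + (- s) * (- b))
    second = solve-∀
    match : ∀ s v → ιℤ Δ c · emb (s * a + v * b) v ≡ emb b 1ℤ · emb (v * c + (- s) * (- b)) (- s)
    match s v = trans (emb-scale c (s * a + v * b) v)
      (trans (emb-cong (first a b c s v D e) (second b c s v)) (sym (emb-* b 1ℤ (v * c + (- s) * (- b)) (- s))))
    double-neg : ∀ s v b c → s * c + (- (- v)) * (- b) ≡ s * c + v * (- b)
    double-neg = solve-∀
    neg-neg : ∀ v → - (- v) ≡ v
    neg-neg = solve-∀

  -- This is gcd(a, 2b, c) = 1 in Bézout form. The middle coefficient is 2b, and this is the
  -- condition that matches invertibility over 𝒪.
  Primitive : Form → Set
  Primitive P = ∃[ r ] ∃[ s ] ∃[ t ] r * a P + s * (+ 2 * b P) + t * c P ≡ 1ℤ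

  private
    product-⊆ : ∀ P {x} → Product (Lattice (a P) (b P)) (Lattice (a P) (- b P)) x
      → Scale (ιℤ Δ (a P)) (InO Δ) x
    product-⊆ P p-zero = 0# , ιℤ∈𝒪 (+ 0) , sym (zeroʳ (ιℤ Δ (a P)))
    product-⊆ P@(form a b c e) (p-mul {x} {y} (s , v , x≡) (s′ , v′ , y≡)) =
      emb X Y , emb∈𝒪 X Y , trans (cong₂ _·_ x≡ y≡)
        (trans (emb-* (s * a + v * b) v (s′ * a + v′ * (- b)) v′)
          (trans (emb-cong (first a b c s v s′ v′ D e) (second a b s v s′ v′)) (sym (emb-scale a X Y))))
      where
      X Y : ℤ
      X = s * s′ * a - s * v′ * b + v * s′ * b - v * v′ * c
      Y = s * v′ + v * s′
      first : ∀ a b c s v s′ v′ D → D ≡ b * b - a * c →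
        (s * a + v * b) * (s′ * a + v′ * (- b)) + D * (v * v′)
          ≡ a * (s * s′ * a - s * v′ * b + v * s′ * b - v * v′ * c)
      first a b c s v s′ v′ _ refl = solve (a ∷ b ∷ c ∷ s ∷ v ∷ s′ ∷ v′ ∷ [])
      second : ∀ a b s v s′ v′ → (s * a + v * b) * v′ + v * (s′ * a + v′ * (- b)) ≡ a * (s * v′ + v * s′)
      second = solve-∀
    product-⊆ P (p-add {x} {y} u w) =
      let (x′ , x′∈𝒪 , x≡) = product-⊆ P u ; (y′ , y′∈𝒪 , y≡) = product-⊆ P w in
      _+K_ Δ x′ y′ , +-closed-𝒪 x′∈𝒪 y′∈𝒪 ,
      trans (cong₂ (_+K_ Δ) x≡ y≡) (sym (distribˡ (ιℤ Δ (a P)) x′ y′))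

    -- a = r·a·a + s·(aω − aω′) − t·ωω′ with ω = b + √D, ω′ = −b + √D and ωω′ = −ac.
    a∈product : ∀ P → Primitive P → Product (Lattice (a P) (b P)) (Lattice (a P) (- b P)) (ιℤ Δ (a P))
    a∈product (form a b c e) (r , s , t , ra+2sb+tc≡1) =
      subst (Product (Lattice a b) (Lattice a (- b))) total≡
        (p-add (p-add (p-mul (lattice-∈ a b r (+ 0)) (lattice-∈ a (- b) 1ℤ (+ 0)))
                      (p-mul (lattice-∈ a b (+ 0) s) (lattice-∈ a (- b) 1ℤ (+ 0))))
               (p-add (p-mul (lattice-∈ a b s (+ 0)) (lattice-∈ a (- b) (+ 0) -1ℤ))
                      (p-mul (lattice-∈ a b (+ 0) t) (lattice-∈ a (- b) (+ 0) -1ℤ))))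
      where
      _⊕_ : K → K → K
      _⊕_ = _+K_ Δ
      products : ∀ u₁ v₁ u₁′ v₁′ u₂ v₂ u₂′ v₂′ →
        (emb u₁ v₁ · emb u₁′ v₁′) ⊕ (emb u₂ v₂ · emb u₂′ v₂′)
          ≡ emb (u₁ * u₁′ + D * (v₁ * v₁′) + (u₂ * u₂′ + D * (v₂ * v₂′)))
                (u₁ * v₁′ + v₁ * u₁′ + (u₂ * v₂′ + v₂ * u₂′))
      products u₁ v₁ u₁′ v₁′ u₂ v₂ u₂′ v₂′ =
        trans (cong₂ _⊕_ (emb-* u₁ v₁ u₁′ v₁′) (emb-* u₂ v₂ u₂′ v₂′))
          (emb-+ (u₁ * u₁′ + D * (v₁ * v₁′)) (u₁ * v₁′ + v₁ * u₁′)
                 (u₂ * u₂′ + D * (v₂ * v₂′)) (u₂ * v₂′ + v₂ * u₂′))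
      a₁ b₁ b₀ : ℤ → ℤ
      a₁ r = r * a + + 0 * b
      b₁ s = + 0 * a + s * b
      b₀ s = + 0 * a + s * (- b)
      a₀ : ℤ
      a₀ = 1ℤ * a + + 0 * (- b)
      first : ∀ a b c r s t D → D ≡ b * b - a * c →
        ((r * a + + 0 * b) * (1ℤ * a + + 0 * (- b)) + D * (+ 0 * + 0)
          + ((+ 0 * a + s * b) * (1ℤ * a + + 0 * (- b)) + D * (s * + 0)))
        + ((s * a + + 0 * b) * (+ 0 * a + -1ℤ * (- b)) + D * (+ 0 * -1ℤ)
          + ((+ 0 * a + t * b) * (+ 0 * a + -1ℤ * (- b)) + D * (t * -1ℤ)))
        ≡ (r * a + s * (+ 2 * b) + t * c) * a
      first a b c r s t _ refl = solve (a ∷ b ∷ c ∷ r ∷ s ∷ t ∷ [])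
      second : ∀ a b r s t →
        ((r * a + + 0 * b) * + 0 + + 0 * (1ℤ * a + + 0 * (- b))
          + ((+ 0 * a + s * b) * + 0 + s * (1ℤ * a + + 0 * (- b))))
        + ((s * a + + 0 * b) * -1ℤ + + 0 * (+ 0 * a + -1ℤ * (- b))
          + ((+ 0 * a + t * b) * -1ℤ + t * (+ 0 * a + -1ℤ * (- b))))
        ≡ + 0
      second = solve-∀
      total≡ : ((emb (a₁ r) (+ 0) · emb a₀ (+ 0)) ⊕ (emb (b₁ s) s · emb a₀ (+ 0)))
        ⊕ ((emb (a₁ s) (+ 0) · emb (b₀ -1ℤ) -1ℤ) ⊕ (emb (b₁ t) t · emb (b₀ -1ℤ) -1ℤ))
        ≡ ιℤ Δ a
      total≡ = trans (cong₂ _⊕_ (products (a₁ r) (+ 0) a₀ (+ 0) (b₁ s) s a₀ (+ 0))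
                                (products (a₁ s) (+ 0) (b₀ -1ℤ) -1ℤ (b₁ t) t (b₀ -1ℤ) -1ℤ))
        (trans (emb-+ (a₁ r * a₀ + D * (+ 0 * + 0) + (b₁ s * a₀ + D * (s * + 0)))
                      (a₁ r * + 0 + + 0 * a₀ + (b₁ s * + 0 + s * a₀))
                      (a₁ s * b₀ -1ℤ + D * (+ 0 * -1ℤ) + (b₁ t * b₀ -1ℤ + D * (t * -1ℤ)))
                      (a₁ s * -1ℤ + + 0 * b₀ -1ℤ + (b₁ t * -1ℤ + t * b₀ -1ℤ)))
        (trans (emb-cong (trans (first a b c r s t D e) (trans (cong (_* a) ra+2sb+tc≡1) (one a)))
                         (second a b r s t))
               (sym (emb-ι a))))
        where
        one : ∀ a → 1ℤ * a ≡ a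
        one = solve-∀

  -- All products of basis elements, a², aω, aω′ and ωω′ = -ac, are divisible by a. Dividing them by
  -- a leaves combinations of a, ω, ω′ and c, among which primitivity finds 1, because ω + ω′ and ω
  -- - ω′ aside, the combination aω - aω′ = 2ab supplies the coefficient 2b.
  conj-product : ∀ P → Primitive P
    → Product ⟨ ideal P ⟩ ⟨ ideal (conj P) ⟩ ≈ Scale (ιℤ Δ (a P)) (InO Δ)
  conj-product P prim = ≈-from (product-⊆ P)
    (λ { {x} (y , y∈𝒪 , x≡ay) →
      subst (Product ⟨ ideal P ⟩ ⟨ ideal (conj P) ⟩) (trans (*-comm y (ιℤ Δ (a P))) (sym x≡ay))
        (Product-𝒪-closed (O-closed (ideal P)) y∈𝒪 (a∈product P prim)) })

  primitive⇒invertible : ∀ P → Primitive P → Invertible Δ (ideal P)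
  primitive⇒invertible P prim = invertible-by {ideal P} (ideal (conj P)) (a P) (a≢0 P) (conj-product P prim)

  -- The gcd g of a, 2b and c with its cofactors. Primitivity is ∣g∣ = 1, hence decidable, and A, B,
  -- C express the action of ω/g on L(a, b) while g is not yet known to be a unit.
  record Content (P : Form) : Set where
    field
      g A B C R S T : ℤ
      a≡Ag : a P ≡ A * g
      2b≡Bg : + 2 * b P ≡ B * g
      c≡Cg : c P ≡ C * g
      RA+SB+TC≡1 : R * A + S * B + T * C ≡ 1ℤ

  content : ∀ P → Content P
  content P with bézout (a P) (+ 2 * b P)
  ... | bézout-data g₁ s₁ t₁ p₁ q₁ a≡ 2b≡ e₁ with bézout g₁ (c P)
  ... | bézout-data g s₂ t₂ p₂ q₂ g₁≡ c≡ e₂ = record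
    { g = g ; A = p₁ * p₂ ; B = q₁ * p₂ ; C = q₂ ; R = s₂ * s₁ ; S = s₂ * t₁ ; T = t₂
    ; a≡Ag = trans a≡ (trans (cong (p₁ *_) g₁≡) (sym (ℤ-*-assoc p₁ p₂ g)))
    ; 2b≡Bg = trans 2b≡ (trans (cong (q₁ *_) g₁≡) (sym (ℤ-*-assoc q₁ p₂ g)))
    ; c≡Cg = c≡
    ; RA+SB+TC≡1 = trans (regroup s₁ t₁ p₁ q₁ s₂ t₂ p₂ q₂)
        (trans (cong (λ n → s₂ * p₂ * n + t₂ * q₂) e₁) (trans (cong (_+ t₂ * q₂) (ℤ-*-identityʳ (s₂ * p₂))) e₂))
    }
    where
    regroup : ∀ s₁ t₁ p₁ q₁ s₂ t₂ p₂ q₂ → s₂ * s₁ * (p₁ * p₂) + s₂ * t₁ * (q₁ * p₂) + t₂ * q₂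
      ≡ s₂ * p₂ * (s₁ * p₁ + t₁ * q₁) + t₂ * q₂
    regroup = solve-∀

  unit-content⇒primitive : ∀ P (χ : Content P) → ∣ Content.g χ ∣ ≡ 1 → Primitive P
  unit-content⇒primitive P χ ∣g∣≡1 = R * g , S * g , T * g , (begin
    R * g * a P + S * g * (+ 2 * b P) + T * g * c P
      ≡⟨ cong₂ _+_ (cong₂ (λ x y → R * g * x + S * g * y) a≡Ag 2b≡Bg) (cong (T * g *_) c≡Cg) ⟩
    R * g * (A * g) + S * g * (B * g) + T * g * (C * g)
      ≡⟨ regroup A B C R S T g ⟩
    (R * A + S * B + T * C) * (g * g)
      ≡⟨ cong₂ _*_ RA+SB+TC≡1 (∣x∣≡1⇒x*x≡1 g ∣g∣≡1) ⟩
    1ℤ ∎)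
    where
    open ≡-Reasoning
    open Content χ
    regroup : ∀ A B C R S T g → R * g * (A * g) + S * g * (B * g) + T * g * (C * g) ≡ (R * A + S * B + T * C) * (g * g)
    regroup = solve-∀

  primitive⇒unit-content : ∀ P (χ : Content P) → Primitive P → ∣ Content.g χ ∣ ≡ 1
  primitive⇒unit-content P χ (r , s , t , e) = *≡1⇒∣∣≡1 g (r * A + s * B + t * C) (trans (sym (begin
    r * a P + s * (+ 2 * b P) + t * c P
      ≡⟨ cong₂ _+_ (cong₂ (λ x y → r * x + s * y) a≡Ag 2b≡Bg) (cong (t *_) c≡Cg) ⟩
    r * (A * g) + s * (B * g) + t * (C * g)
      ≡⟨ regroup A B C r s t g ⟩
    g * (r * A + s * B + t * C) ∎)) e)
    where
    open ≡-Reasoning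
    open Content χ
    regroup : ∀ A B C r s t g → r * (A * g) + s * (B * g) + t * (C * g) ≡ g * (r * A + s * B + t * C)
    regroup = solve-∀

  primitive? : ∀ P → Dec (Primitive P)
  primitive? P with ∣ Content.g (content P) ∣ ℕ.≟ 1
  ... | yes unit = yes (unit-content⇒primitive P (content P) unit)
  ... | no non-unit = no λ prim → non-unit (primitive⇒unit-content P (content P) prim)

  -- If g divides a, 2b and c, then ω = b + √D satisfies ω² = 2bω − ac, so ω / g
  -- multiplies L(a, b) into itself.
  invertible⇒primitive : ∀ {I} P → Invertible Δ I → I ∼ ideal P → Primitive P
  invertible⇒primitive {I} P@(form a b c e) I-invertible (∼-intro (α , α≢0 , I≈αL)) =
    unit-content⇒primitive P (content P) (*≡1⇒∣∣≡1 g (proj₁ (proj₂ κ≡emb)) gq≡1)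
    where
    open Content (content P)
    g≢0 : g ≢ + 0
    g≢0 g≡0 = a≢0 P (trans a≡Ag (trans (cong (A *_) g≡0) (ℤ-*-zeroʳ A)))
    g⁻¹ κ : K
    g⁻¹ = proj₁ (ιℤ-inverse g g≢0)
    κ = g⁻¹ · emb b 1ℤ
    gg⁻¹≡1 : ιℤ Δ g · g⁻¹ ≡ 1#
    gg⁻¹≡1 = proj₂ (ιℤ-inverse g g≢0)
    first : ∀ g A b C s v D → D ≡ b * b - (A * g) * (C * g) → ∀ B → + 2 * b ≡ B * g →
      b * (s * (A * g) + v * b) + D * (1ℤ * v) ≡ g * ((- (v * C)) * (A * g) + (s * A + v * B) * b)
    first g A b C s v _ refl B 2b≡Bg =
      trans (lhs g A b C s v) (trans (cong (λ n → v * b * n + (s * A * b * g - A * C * v * g * g)) 2b≡Bg) (rhs g A b C s v B))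
      where
      lhs : ∀ g A b C s v → b * (s * (A * g) + v * b) + (b * b - (A * g) * (C * g)) * (1ℤ * v)
        ≡ v * b * (+ 2 * b) + (s * A * b * g - A * C * v * g * g)
      lhs = solve-∀
      rhs : ∀ g A b C s v B → v * b * (B * g) + (s * A * b * g - A * C * v * g * g)
        ≡ g * ((- (v * C)) * (A * g) + (s * A + v * B) * b)
      rhs = solve-∀
    second : ∀ g A b s v B → + 2 * b ≡ B * g → b * v + 1ℤ * (s * (A * g) + v * b) ≡ g * (s * A + v * B)
    second g A b s v B 2b≡Bg = trans (lhs g A b s v) (trans (cong (λ n → v * n + s * A * g) 2b≡Bg) (rhs g A s v B))
      where
      lhs : ∀ g A b s v → b * v + 1ℤ * (s * (A * g) + v * b) ≡ v * (+ 2 * b) + s * A * g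
      lhs = solve-∀
      rhs : ∀ g A s v B → v * (B * g) + s * A * g ≡ g * (s * A + v * B)
      rhs = solve-∀
    κ-multiplies : ∀ s v → κ · emb (s * a + v * b) v ≡ emb ((- (v * C)) * a + (s * A + v * B) * b) (s * A + v * B)
    κ-multiplies s v = begin
      g⁻¹ · emb b 1ℤ · emb (s * a + v * b) v
        ≡⟨ *-assoc g⁻¹ (emb b 1ℤ) (emb (s * a + v * b) v) ⟩
      g⁻¹ · (emb b 1ℤ · emb (s * a + v * b) v)
        ≡⟨ cong (g⁻¹ ·_) (emb-* b 1ℤ (s * a + v * b) v) ⟩
      g⁻¹ · emb (b * (s * a + v * b) + D * (1ℤ * v)) (b * v + 1ℤ * (s * a + v * b))
        ≡⟨ cong (g⁻¹ ·_) (emb-cong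
             (subst (λ a → b * (s * a + v * b) + D * (1ℤ * v) ≡ g * ((- (v * C)) * a + (s * A + v * B) * b))
               (sym a≡Ag) (first g A b C s v D (trans e (cong₂ (λ a c → b * b - a * c) a≡Ag c≡Cg)) B 2b≡Bg))
             (subst (λ a → b * v + 1ℤ * (s * a + v * b) ≡ g * (s * A + v * B)) (sym a≡Ag) (second g A b s v B 2b≡Bg))) ⟩
      g⁻¹ · emb (g * ((- (v * C)) * a + (s * A + v * B) * b)) (g * (s * A + v * B))
        ≡⟨ cong (g⁻¹ ·_) (sym (emb-scale g ((- (v * C)) * a + (s * A + v * B) * b) (s * A + v * B))) ⟩
      g⁻¹ · (ιℤ Δ g · emb ((- (v * C)) * a + (s * A + v * B) * b) (s * A + v * B))
        ≡⟨ cancel-inverseˡ (ιℤ Δ g) g⁻¹ gg⁻¹≡1 (emb ((- (v * C)) * a + (s * A + v * B) * b) (s * A + v * B)) ⟩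
      emb ((- (v * C)) * a + (s * A + v * B) * b) (s * A + v * B) ∎
      where open ≡-Reasoning
    κI⊆I : ∀ {x} → ⟨ I ⟩ x → ⟨ I ⟩ (κ · x)
    κI⊆I {x} x∈I = let (y , (s , v , y≡) , x≡αy) = to I≈αL x∈I in
      from I≈αL
        ( emb ((- (v * C)) * a + (s * A + v * B) * b) (s * A + v * B)
        , lattice-∈ a b (- (v * C)) (s * A + v * B)
        , trans (cong (κ ·_) x≡αy) (trans (x∙yz≈y∙xz κ α y)
            (cong (α ·_) (trans (cong (κ ·_) y≡) (κ-multiplies s v)))))
    κ≡emb : ∃[ p ] ∃[ q ] κ ≡ emb p q
    κ≡emb = 𝒪⇒emb {κ} (multiplier∈𝒪 {I} I-invertible κ κI⊆I)
    -- A multiplier of an invertible ideal lies in 𝒪, so κ = p + q√D; the √D-coordinate of gκ = b +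
    -- √D then reads gq = 1.
    gq≡1 : g * proj₁ (proj₂ κ≡emb) ≡ 1ℤ
    gq≡1 = let (p , q , κ≡) = κ≡emb in proj₂ (emb-injective (trans (sym (emb-scale g p q))
      (trans (cong (ιℤ Δ g ·_) (sym κ≡)) (cancel-inverseʳ (ιℤ Δ g) g⁻¹ gg⁻¹≡1 (emb b 1ℤ)))))

-- Triangular bases of subgroups of ℤ².

module HermiteNormalForm where

  open import Data.Integer hiding (suc)
  open import Data.Integer.Tactic.RingSolver using (solve-∀)
  open import Data.Product using (∃-syntax; _×_; _,_)
  open import Relation.Binary.PropositionalEquality
  open IntegerArithmetic using (bézout; bézout-data)

  Combinable : (ℤ → ℤ → Set) → Set
  Combinable S = ∀ n n′ {u v u′ v′} → S u v → S u′ v′ → S (n * u + n′ * u′) (n * v + n′ * v′)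

  -- The subgroup spanned by the rows (A, 0) and (B, C), degenerate cases included.
  Span : ℤ → ℤ → ℤ → ℤ → ℤ → Set
  Span A B C u v = ∃[ s ] ∃[ t ] (u ≡ s * A + t * B × v ≡ t * C)

  Span-combinable : ∀ {A B C} → Combinable (Span A B C)
  Span-combinable {A} {B} {C} n n′ (s , t , u≡ , v≡) (s′ , t′ , u′≡ , v′≡) =
    n * s + n′ * s′ , n * t + n′ * t′ ,
    trans (cong₂ (λ u u′ → n * u + n′ * u′) u≡ u′≡) (first n n′ s s′ t t′ A B) ,
    trans (cong₂ (λ v v′ → n * v + n′ * v′) v≡ v′≡) (second n n′ t t′ C)
    where
    first : ∀ n n′ s s′ t t′ A B → n * (s * A + t * B) + n′ * (s′ * A + t′ * B)
      ≡ (n * s + n′ * s′) * A + (n * t + n′ * t′) * B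
    first = solve-∀
    second : ∀ n n′ t t′ C → n * (t * C) + n′ * (t′ * C) ≡ (n * t + n′ * t′) * C
    second = solve-∀

  Span-least : ∀ {S A B C} → Combinable S → S A (+ 0) → S B C → ∀ {u v} → Span A B C u v → S u v
  Span-least {S} {A} {B} {C} comb SA SBC (s , t , u≡ , v≡) =
    subst₂ S (sym u≡) (trans (no-A s t C) (sym v≡)) (comb s t SA SBC)
    where
    no-A : ∀ s t C → s * + 0 + t * C ≡ t * C
    no-A = solve-∀

  -- The subgroup is enlarged by the vector (u, v). Minimality is tested against every additively
  -- closed predicate S, so it applies to the undecidable carrier of an ideal.
  record Join (A B C u v : ℤ) : Set₁ where
    field
      A′ B′ C′ : ℤ
      A∈  : Span A′ B′ C′ A (+ 0)
      BC∈ : Span A′ B′ C′ B C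
      uv∈ : Span A′ B′ C′ u v
      least : ∀ {S} → Combinable S → S A (+ 0) → S B C → S u v → S A′ (+ 0) × S B′ C′

  -- The first gcd is a unimodular change of the rows (B, C) and (u, v), which leaves second
  -- coordinates C′ and 0. The row (pu - qB, 0) so obtained is merged with (A, 0) by a second gcd.
  join : ∀ A B C u v → Join A B C u v
  join A B C u v with bézout C v
  ... | bézout-data C′ s t p q C≡ v≡ sp+tq≡1 with bézout A (p * u - q * B)
  ... | bézout-data A′ s′ t′ p′ q′ A≡ w≡ s′p′+t′q′≡1 = record
    { A′ = A′ ; B′ = s * B + t * u ; C′ = C′
    ; A∈ = p′ , + 0 , trans A≡ (pad (p′ * A′) (s * B + t * u)) , refl
    ; BC∈ = - (t * q′) , p , trans (first-BC s t p q B u sp+tq≡1)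
              (trans (cong (λ w → (- t) * w + p * (s * B + t * u)) w≡) (regroup t q′ A′ p (s * B + t * u))) , C≡
    ; uv∈ = s * q′ , q , trans (first-uv s t p q B u sp+tq≡1)
              (trans (cong (λ w → s * w + q * (s * B + t * u)) w≡) (regroup′ s q′ A′ q (s * B + t * u))) , v≡
    ; least = λ {S} comb SA SBC Suv →
        let Sw = subst (S (p * u + (- q) * B)) (second-w p q C C′ v C≡ v≡) (comb p (- q) Suv SBC) in
        subst₂ S (first-A s′ t′ p′ q′ A A′ p u q B A≡ w≡ s′p′+t′q′≡1) (zeros s′ t′) (comb s′ t′ SA Sw) ,
        subst (S (s * B + t * u)) (second-C s t p q C C′ v C≡ v≡ sp+tq≡1) (comb s t SBC Suv)
    }
    where
    one : ∀ {n} x → n ≡ 1ℤ → n * x ≡ x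
    one x refl = unit x where
      unit : ∀ x → 1ℤ * x ≡ x
      unit = solve-∀
    pad : ∀ x y → x ≡ x + + 0 * y
    pad = solve-∀
    first-BC : ∀ s t p q B u → s * p + t * q ≡ 1ℤ → B ≡ (- t) * (p * u - q * B) + p * (s * B + t * u)
    first-BC s t p q B u e = trans (sym (one B e)) (identity s t p q B u)
      where
      identity : ∀ s t p q B u → (s * p + t * q) * B ≡ (- t) * (p * u - q * B) + p * (s * B + t * u)
      identity = solve-∀
    first-uv : ∀ s t p q B u → s * p + t * q ≡ 1ℤ → u ≡ s * (p * u - q * B) + q * (s * B + t * u)
    first-uv s t p q B u e = trans (sym (one u e)) (identity s t p q B u)
      where
      identity : ∀ s t p q B u → (s * p + t * q) * u ≡ s * (p * u - q * B) + q * (s * B + t * u)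
      identity = solve-∀
    regroup : ∀ t q′ A′ p X → (- t) * (q′ * A′) + p * X ≡ (- (t * q′)) * A′ + p * X
    regroup = solve-∀
    regroup′ : ∀ s q′ A′ q X → s * (q′ * A′) + q * X ≡ s * q′ * A′ + q * X
    regroup′ = solve-∀
    second-w : ∀ p q C C′ v → C ≡ p * C′ → v ≡ q * C′ → p * v + (- q) * C ≡ + 0
    second-w p q _ C′ _ refl refl = identity p q C′
      where
      identity : ∀ p q C′ → p * (q * C′) + (- q) * (p * C′) ≡ + 0
      identity = solve-∀
    second-C : ∀ s t p q C C′ v → C ≡ p * C′ → v ≡ q * C′ → s * p + t * q ≡ 1ℤ → s * C + t * v ≡ C′
    second-C s t p q _ C′ _ refl refl e = trans (identity s t p q C′) (one C′ e)
      where
      identity : ∀ s t p q C′ → s * (p * C′) + t * (q * C′) ≡ (s * p + t * q) * C′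
      identity = solve-∀
    zeros : ∀ s t → s * + 0 + t * + 0 ≡ + 0
    zeros = solve-∀
    first-A : ∀ s′ t′ p′ q′ A A′ p u q B → A ≡ p′ * A′ → p * u - q * B ≡ q′ * A′ → s′ * p′ + t′ * q′ ≡ 1ℤ →
      s′ * A + t′ * (p * u + (- q) * B) ≡ A′
    first-A s′ t′ p′ q′ A A′ p u q B A≡ w≡ e =
      trans (cong₂ (λ A w → s′ * A + t′ * w) A≡ (trans (minus p u q B) w≡))
        (trans (identity s′ t′ p′ q′ A′) (one A′ e))
      where
      minus : ∀ p u q B → p * u + (- q) * B ≡ p * u - q * B
      minus = solve-∀
      identity : ∀ s t p q C′ → s * (p * C′) + t * (q * C′) ≡ (s * p + t * q) * C′
      identity = solve-∀

-- From an invertible ideal to a reduced primitive form.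

module Reduction (k : ℕ) (k>0 : 0 ℕ.< k) where

  open import Data.Integer hiding (suc)
  import Data.Integer.Properties as ℤ
  open import Data.Integer.DivMod using (n%d<d; a≡a%n+[a/n]*n)
  open import Data.Integer.Tactic.RingSolver using (solve-∀)
  open import Data.Nat.Induction using (<-wellFounded; Acc; acc)
  import Data.Nat.Properties as ℕ
  open import Data.Product using (∃-syntax; _×_; _,_; proj₁; proj₂)
  open import Data.Sum using (inj₁; inj₂)
  open import Relation.Binary.PropositionalEquality
  open import Relation.Nullary using (Dec; yes; no; contradiction)
  open IntegerArithmetic
  open HermiteNormalForm
  open EmbeddedOrder k k>0
  open Forms k k>0
  open Form

  module _ (I : FracIdeal Δ) where

    private
      δ : ℤ
      δ = proj₁ (bounded I)
      δ≢0 : δ ≢ + 0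
      δ≢0 = proj₁ (proj₂ (bounded I))
      δI⊆𝒪 : ∀ {x} → ⟨ I ⟩ x → InO Δ (ιℤ Δ δ · x)
      δI⊆𝒪 = proj₂ (proj₂ (bounded I))

      S : ℤ → ℤ → Set
      S u v = ∃[ x ] ⟨ I ⟩ x × ιℤ Δ δ · x ≡ emb u v

      𝒪-multiple : ∀ {x} p q u v → ⟨ I ⟩ x → ιℤ Δ δ · x ≡ emb u v →
        ⟨ I ⟩ (emb p q · x) × ιℤ Δ δ · (emb p q · x) ≡ emb (p * u + D * (q * v)) (p * v + q * u)
      𝒪-multiple {x} p q u v x∈I δx≡ =
        O-closed I (emb∈𝒪 p q) x∈I ,
        trans (x∙yz≈y∙xz (ιℤ Δ δ) (emb p q) x) (trans (cong (emb p q ·_) δx≡) (emb-* p q u v))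

      S-combinable : Combinable S
      S-combinable n n′ {u} {v} {u′} {v′} (x , x∈I , δx≡) (x′ , x′∈I , δx′≡) =
        _+K_ Δ (ιℤ Δ n · x) (ιℤ Δ n′ · x′) ,
        +-closed I (O-closed I (ιℤ∈𝒪 n) x∈I) (O-closed I (ιℤ∈𝒪 n′) x′∈I) ,
        trans (distribˡ (ιℤ Δ δ) (ιℤ Δ n · x) (ιℤ Δ n′ · x′))
          (trans (cong₂ (_+K_ Δ) (scaled n x u v δx≡) (scaled n′ x′ u′ v′ δx′≡))
            (emb-+ (n * u) (n * v) (n′ * u′) (n′ * v′)))
        where
        scaled : ∀ n x u v → ιℤ Δ δ · x ≡ emb u v → ιℤ Δ δ · (ιℤ Δ n · x) ≡ emb (n * u) (n * v)
        scaled n x u v e = trans (x∙yz≈y∙xz (ιℤ Δ δ) (ιℤ Δ n) x) (trans (cong (ιℤ Δ n ·_) e) (emb-scale n u v))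

      -- A finitely generated subgroup of δI that contains δtI. It can be built up along a
      -- derivation of t ∈ IJ, and at t = 1 it is all of δI.
      record Generators (t : K) : Set where
        field
          A B C : ℤ
          A∈ : S A (+ 0)
          BC∈ : S B C
          covers : ∀ {x} → ⟨ I ⟩ x → ∃[ u ] ∃[ v ] (ιℤ Δ δ · (t · x) ≡ emb u v × Span A B C u v)

      -- If t = Σ aᵢbᵢ with bᵢI ⊆ 𝒪, then tI ⊆ Σ 𝒪aᵢ, so the aᵢ yield a ℤ-basis when t = 1.
      generators : ∀ {J t} → (∀ {x y} → ⟨ I ⟩ x → J y → InO Δ (y · x)) → Product ⟨ I ⟩ J t → Generators t
      generators JI⊆𝒪 p-zero = record
        { A = + 0 ; B = + 0 ; C = + 0
        ; A∈ = zero∈ ; BC∈ = zero∈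
        ; covers = λ {x} _ → + 0 , + 0
          , trans (cong (ιℤ Δ δ ·_) (zeroˡ x)) (trans (zeroʳ (ιℤ Δ δ)) (sym emb-0)) , + 0 , + 0 , refl , refl }
        where
        zero∈ : S (+ 0) (+ 0)
        zero∈ = 0# , has-zero I , trans (zeroʳ (ιℤ Δ δ)) (sym emb-0)
      generators JI⊆𝒪 (p-mul {a} {b} a∈I b∈J) = record
        { A = Join.A′ J₂ ; B = Join.B′ J₂ ; C = Join.C′ J₂
        ; A∈ = proj₁ in-I ; BC∈ = proj₂ in-I ; covers = covers }
        where
        u v : ℤ
        u = proj₁ (𝒪⇒emb (δI⊆𝒪 a∈I))
        v = proj₁ (proj₂ (𝒪⇒emb (δI⊆𝒪 a∈I)))
        δa≡ : ιℤ Δ δ · a ≡ emb u v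
        δa≡ = proj₂ (proj₂ (𝒪⇒emb (δI⊆𝒪 a∈I)))
        -- Adjoining δa and then √D · δa gives the span 𝒪 · δa, which contains δ(ab)x = δa · (bx)
        -- because bx ∈ 𝒪.
        J₁ = join (+ 0) (+ 0) (+ 0) u v
        J₂ = join (Join.A′ J₁) (Join.B′ J₁) (Join.C′ J₁) (+ 0 * u + D * (1ℤ * v)) (+ 0 * v + 1ℤ * u)
        zero∈ : S (+ 0) (+ 0)
        zero∈ = 0# , has-zero I , trans (zeroʳ (ιℤ Δ δ)) (sym emb-0)
        in-I : S (Join.A′ J₂) (+ 0) × S (Join.B′ J₂) (Join.C′ J₂)
        in-I = let (A₁∈ , BC₁∈) = Join.least J₁ S-combinable zero∈ zero∈ (a , a∈I , δa≡) in
          Join.least J₂ S-combinable A₁∈ BC₁∈ (emb (+ 0) 1ℤ · a , 𝒪-multiple (+ 0) 1ℤ u v a∈I δa≡)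
        uv∈ : Span (Join.A′ J₂) (Join.B′ J₂) (Join.C′ J₂) u v
        uv∈ = Span-least Span-combinable (Join.A∈ J₂) (Join.BC∈ J₂) (Join.uv∈ J₁)
        covers : ∀ {x} → ⟨ I ⟩ x → ∃[ u ] ∃[ v ] (ιℤ Δ δ · (a · b · x) ≡ emb u v
          × Span (Join.A′ J₂) (Join.B′ J₂) (Join.C′ J₂) u v)
        covers {x} x∈I = p * u + q * (+ 0 * u + D * (1ℤ * v)) , p * v + q * (+ 0 * v + 1ℤ * u)
          , trans (cong (ιℤ Δ δ ·_) (*-assoc a b x)) (trans (sym (*-assoc (ιℤ Δ δ) a (b · x)))
              (trans (cong₂ _·_ δa≡ bx≡) (trans (emb-* u v p q) (emb-cong (first p q u v D) (second p q u v)))))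
          , Span-combinable p q uv∈ (Join.uv∈ J₂)
          where
          p q : ℤ
          p = proj₁ (𝒪⇒emb (JI⊆𝒪 x∈I b∈J))
          q = proj₁ (proj₂ (𝒪⇒emb (JI⊆𝒪 x∈I b∈J)))
          bx≡ : b · x ≡ emb p q
          bx≡ = proj₂ (proj₂ (𝒪⇒emb (JI⊆𝒪 x∈I b∈J)))
          first : ∀ p q u v D → u * p + D * (v * q) ≡ p * u + q * (+ 0 * u + D * (1ℤ * v))
          first = solve-∀
          second : ∀ p q u v → u * q + v * p ≡ p * v + q * (+ 0 * v + 1ℤ * u)
          second = solve-∀
      generators JI⊆𝒪 (p-add {y} {z} py pz) = record
        { A = Join.A′ J₂ ; B = Join.B′ J₂ ; C = Join.C′ J₂
        ; A∈ = proj₁ in-I ; BC∈ = proj₂ in-I ; covers = covers }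
        where
        module Y = Generators (generators JI⊆𝒪 py)
        module Z = Generators (generators JI⊆𝒪 pz)
        J₁ = join Y.A Y.B Y.C Z.A (+ 0)
        J₂ = join (Join.A′ J₁) (Join.B′ J₁) (Join.C′ J₁) Z.B Z.C
        in-I : S (Join.A′ J₂) (+ 0) × S (Join.B′ J₂) (Join.C′ J₂)
        in-I = let (A₁∈ , BC₁∈) = Join.least J₁ S-combinable Y.A∈ Y.BC∈ Z.A∈ in
          Join.least J₂ S-combinable A₁∈ BC₁∈ Z.BC∈
        J₁⊆J₂ : ∀ {u v} → Span (Join.A′ J₁) (Join.B′ J₁) (Join.C′ J₁) u v
          → Span (Join.A′ J₂) (Join.B′ J₂) (Join.C′ J₂) u v
        J₁⊆J₂ = Span-least Span-combinable (Join.A∈ J₂) (Join.BC∈ J₂)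
        covers : ∀ {x} → ⟨ I ⟩ x → ∃[ u ] ∃[ v ] (ιℤ Δ δ · (_+K_ Δ y z · x) ≡ emb u v
          × Span (Join.A′ J₂) (Join.B′ J₂) (Join.C′ J₂) u v)
        covers {x} x∈I =
          let (u , v , yx≡ , uv∈) = Y.covers x∈I ; (u′ , v′ , zx≡ , u′v′∈) = Z.covers x∈I in
          1ℤ * u + 1ℤ * u′ , 1ℤ * v + 1ℤ * v′
          , trans (cong (ιℤ Δ δ ·_) (distribʳ x y z)) (trans (distribˡ (ιℤ Δ δ) (y · x) (z · x))
              (trans (cong₂ (_+K_ Δ) yx≡ zx≡) (trans (emb-+ u v u′ v′) (emb-cong (ones u u′) (ones v v′)))))
          , Span-combinable 1ℤ 1ℤ
              (J₁⊆J₂ (Span-least Span-combinable (Join.A∈ J₁) (Join.BC∈ J₁) uv∈))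
              (Span-least Span-combinable (J₁⊆J₂ (Join.uv∈ J₁)) (Join.uv∈ J₂) u′v′∈)
          where
          ones : ∀ x y → x + y ≡ 1ℤ * x + 1ℤ * y
          ones = solve-∀

      -- If C divides A and B, then δI is C times ℤt + ℤ(t′ + √D). Cancelling C in DC = s′A + t′B
      -- gives the discriminant equation with third coefficient -s′.
      basis⇒form : ∀ {A B C s′ t t′} → C ≢ + 0 → S A (+ 0) → S B C
        → (∀ {x} → ⟨ I ⟩ x → ∃[ u ] ∃[ v ] (ιℤ Δ δ · x ≡ emb u v × Span A B C u v))
        → A ≡ t * C → B ≡ t′ * C → D * C ≡ s′ * A + t′ * B → ∃[ P ] I ∼ ideal P
      basis⇒form {A} {B} {C} {s′} {t} {t′} C≢0 A∈ BC∈ in-span A≡tC B≡t′C DC≡ =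
        form t t′ (- s′) disc≡ , ratio-∼ δ (ιℤ Δ C) δ≢0 (ιℤ≢0 C≢0)
        (λ {x} x∈I → let (u , v , δx≡ , s , w , u≡ , v≡) = in-span x∈I in
          emb (s * t + w * t′) w , lattice-∈ t t′ s w ,
          trans δx≡ (trans (emb-cong (trans u≡ (trans (cong₂ (λ A B → s * A + w * B) A≡tC B≡t′C) (factor s t w t′ C)))
                                     (trans v≡ (ℤ.*-comm w C)))
                           (sym (emb-scale C (s * t + w * t′) w))))
        (λ {y} (s , w , y≡) → let (x , x∈I , δx≡) = S-combinable s w A∈ BC∈ in
          x , x∈I , trans δx≡ (trans
            (emb-cong (trans (cong₂ (λ A B → s * A + w * B) A≡tC B≡t′C) (factor s t w t′ C)) (no-A s w C))
            (trans (sym (emb-scale C (s * t + w * t′) w)) (cong (ιℤ Δ C ·_) (sym y≡)))))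
        where
        disc≡ : D ≡ t′ * t′ - t * (- s′)
        disc≡ = *-cancelʳ′ C≢0 (trans DC≡ (trans (cong₂ (λ A B → s′ * A + t′ * B) A≡tC B≡t′C) (quadratic s′ t t′ C)))
          where
          quadratic : ∀ s′ t t′ C → s′ * (t * C) + t′ * (t′ * C) ≡ (t′ * t′ - t * (- s′)) * C
          quadratic = solve-∀
        factor : ∀ s t w t′ C → s * (t * C) + w * (t′ * C) ≡ C * (s * t + w * t′)
        factor = solve-∀
        no-A : ∀ s w C → s * + 0 + w * C ≡ C * w
        no-A = solve-∀

      -- The span is stable under √D. Applied to A this gives C ∣ A; applied to B + C√D it gives C ∣
      -- B and DC = s′A + t′B. If C vanished, so would A and B, and then I.
      form-of : Generators 1# → ∃[ P ] I ∼ ideal P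
      form-of record { A = A ; B = B ; C = C ; A∈ = A∈ ; BC∈ = BC∈ ; covers = covers } =
        let (s , t , _ , A≡tC) = √D-multiple A∈
            (s′ , t′ , DC≡ , B≡t′C) = √D-multiple BC∈
            A≡tC = trans (√D-second A (+ 0)) A≡tC
            B≡t′C = trans (√D-second B C) B≡t′C in
        basis⇒form {s′ = s′} {t} {t′} (C≢0 t t′ A≡tC B≡t′C) A∈ BC∈ in-span A≡tC B≡t′C (trans (√D-first D B C) DC≡)
        where
        in-span : ∀ {x} → ⟨ I ⟩ x → ∃[ u ] ∃[ v ] (ιℤ Δ δ · x ≡ emb u v × Span A B C u v)
        in-span {x} x∈I = let (u , v , δx≡ , uv∈) = covers x∈I in
          u , v , trans (cong (ιℤ Δ δ ·_) (sym (*-identityˡ x))) δx≡ , uv∈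
        S⇒Span : ∀ {u v} → S u v → Span A B C u v
        S⇒Span (x , x∈I , δx≡) = let (u′ , v′ , δx≡′ , u′v′∈) = in-span x∈I
                                     (u≡ , v≡) = emb-injective (trans (sym δx≡′) δx≡) in
          subst₂ (Span A B C) u≡ v≡ u′v′∈
        √D-multiple : ∀ {u v} → S u v → Span A B C (+ 0 * u + D * (1ℤ * v)) (+ 0 * v + 1ℤ * u)
        √D-multiple {u} {v} (x , x∈I , δx≡) =
          S⇒Span (emb (+ 0) 1ℤ · x , 𝒪-multiple (+ 0) 1ℤ u v x∈I δx≡)
        √D-second : ∀ u v → u ≡ + 0 * v + 1ℤ * u
        √D-second = solve-∀
        √D-first : ∀ D u v → D * v ≡ + 0 * u + D * (1ℤ * v)
        √D-first = solve-∀
        C≢0 : ∀ t t′ → A ≡ t * C → B ≡ t′ * C → C ≢ + 0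
        C≢0 t t′ A≡tC B≡t′C C≡0 =
          let (x , x∈I , x≢0) = nonzero I
              (u , v , δx≡ , s , w , u≡ , v≡) = in-span x∈I in
          ·-nonzero (ιℤ Δ δ) x (ιℤ≢0 δ≢0) x≢0 (trans δx≡ (trans (emb-cong
            (trans u≡ (trans (cong₂ (λ A B → s * A + w * B) (vanish t A≡tC) (vanish t′ B≡t′C)) (zeros s w)))
            (trans v≡ (trans (cong (w *_) C≡0) (ℤ.*-zeroʳ w)))) emb-0))
          where
          vanish : ∀ {X} t → X ≡ t * C → X ≡ + 0
          vanish t e = trans e (trans (cong (t *_) C≡0) (ℤ.*-zeroʳ t))
          zeros : ∀ s w → s * + 0 + w * + 0 ≡ + 0
          zeros = solve-∀

    invertible⇒form : Invertible Δ I → ∃[ P ] I ∼ ideal P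
    invertible⇒form (J , IJ≈𝒪) = form-of (generators
      (λ {x} {y} x∈I y∈J → to IJ≈𝒪 (subst (Product ⟨ I ⟩ ⟨ J ⟩) (*-comm x y) (p-mul x∈I y∈J)))
      (from IJ≈𝒪 (ιℤ∈𝒪 1ℤ)))

  -- Only finiteness is wanted: a² ≤ D bounds a and b, and c follows from the discriminant. Several
  -- reduced forms may share a class.
  Reduced : Form → Set
  Reduced P = ∃[ n ] (b P ≡ + n × n ℕ.< ∣ a P ∣ × ∣ a P ∣ ℕ.* ∣ a P ∣ ℕ.≤ d k)

  shift : ℤ → Form → Form
  shift l (form a b c e) = form a (b + l * a) (c + + 2 * l * b + l * l * a) (trans e (identity a b c l))
    where
    identity : ∀ a b c l → b * b - a * c ≡ (b + l * a) * (b + l * a) - a * (c + + 2 * l * b + l * l * a)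
    identity = solve-∀

  shift-∼ : ∀ l P → ideal P ∼ ideal (shift l P)
  shift-∼ l (form a b c e) = ≈⇒∼ (shift-≈ a b l)

  aa≤∣nn-d∣ : ∀ a c n → D ≡ + n * + n - a * c → ∣ a ∣ ℕ.≤ ∣ c ∣ → ∣ a ∣ ℕ.* ∣ a ∣ ℕ.≤ ∣ (n ℕ.* n) ⊖ d k ∣
  aa≤∣nn-d∣ a c n e ∣a∣≤∣c∣ = ℕ.≤-trans (ℕ.*-monoʳ-≤ ∣ a ∣ ∣a∣≤∣c∣) (ℕ.≤-reflexive
    (trans (sym (ℤ.abs-* a c)) (cong ∣_∣ (trans (isolate a c (+ n) D e)
      (trans (cong₂ _-_ (sym (ℤ.pos-* n n)) D≡+d) (ℤ.m-n≡m⊖n (n ℕ.* n) (d k)))))))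
    where
    isolate : ∀ a c b D → D ≡ b * b - a * c → a * c ≡ b * b - D
    isolate a c b _ refl = identity a c b
      where
      identity : ∀ a c b → a * c ≡ b * b - (b * b - a * c)
      identity = solve-∀

  -- With 0 ≤ b < ∣a∣ and ∣a∣ ≤ ∣c∣, the case b² ≥ D would give ∣ac∣ ≤ b² < a².
  stop-bound : ∀ P n → b P ≡ + n → n ℕ.< ∣ a P ∣ → ∣ a P ∣ ℕ.≤ ∣ c P ∣ → ∣ a P ∣ ℕ.* ∣ a P ∣ ℕ.≤ d k
  stop-bound (form a _ c e) n refl n<∣a∣ ∣a∣≤∣c∣ with ℕ.≤-total (n ℕ.* n) (d k)
  ... | inj₁ nn≤d = ℕ.≤-trans (aa≤∣nn-d∣ a c n e ∣a∣≤∣c∣) (subst (ℕ._≤ d k) (sym (ℤ.∣⊖∣-≤ nn≤d)) (ℕ.m∸n≤m (d k) (n ℕ.* n)))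
  ... | inj₂ d≤nn = contradiction
      (ℕ.≤-trans (aa≤∣nn-d∣ a c n e ∣a∣≤∣c∣) (subst (ℕ._≤ n ℕ.* n)
        (sym (trans (ℤ.∣m⊖n∣≡∣n⊖m∣ (n ℕ.* n) (d k)) (ℤ.∣⊖∣-≤ d≤nn))) (ℕ.m∸n≤m (n ℕ.* n) (d k))))
      (ℕ.<⇒≱ (ℕ.*-mono-< n<∣a∣ n<∣a∣))

  residue : ∀ b a → a ≢ + 0 → ∃[ l ] ∃[ n ] (b + l * a ≡ + n × n ℕ.< ∣ a ∣)
  residue b a a≢0 = - q , r , trans (cong (λ x → x + (- q) * a) b≡) (cancel (+ r) q a) , n%d<d b a
    where
    instance _ = ≢-nonZero a≢0
    q : ℤ
    q = b / a
    r : ℕ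
    r = b % a
    b≡ : b ≡ + r + q * a
    b≡ = a≡a%n+[a/n]*n b a
    cancel : ∀ r q a → r + q * a + (- q) * a ≡ r
    cancel = solve-∀

  -- Gauss reduction: b is moved into the range 0 ≤ b < ∣a∣, and the form is flipped as long as ∣c∣
  -- < ∣a∣. Every flip makes ∣a∣ smaller.
  reduce : ∀ P → ∃[ Q ] (Reduced Q × ideal P ∼ ideal Q)
  reduce P = go P (<-wellFounded ∣ a P ∣)
    where
    go : ∀ P → Acc ℕ._<_ ∣ a P ∣ → ∃[ Q ] (Reduced Q × ideal P ∼ ideal Q)
    go P (acc rs) = let (l , n , b≡n , n<∣a∣) = residue (b P) (a P) (a≢0 P) in
      step l n b≡n n<∣a∣ (∣ c (shift l P) ∣ ℕ.<? ∣ a P ∣)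
      where
      step : ∀ l n → b P + l * a P ≡ + n → n ℕ.< ∣ a P ∣ → Dec (∣ c (shift l P) ∣ ℕ.< ∣ a P ∣)
        → ∃[ Q ] (Reduced Q × ideal P ∼ ideal Q)
      step l n b≡n n<∣a∣ (yes smaller) =
        let (Q , reduced , ∼Q) = go (flip (shift l P)) (rs smaller) in
        Q , reduced ,
        ∼-trans {ideal P} {ideal (shift l P)} {ideal Q} (shift-∼ l P)
          (∼-trans {ideal (shift l P)} {ideal (flip (shift l P))} {ideal Q} (flip-∼ (shift l P)) ∼Q)
      step l n b≡n n<∣a∣ (no stop) =
          shift l P
        , (n , b≡n , n<∣a∣ , stop-bound (shift l P) n b≡n n<∣a∣ (ℕ.≮⇒≥ stop))
        , shift-∼ l P

  -- Primitivity is not tracked through the reduction; it is recovered at the end, since the class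
  -- still contains the invertible I.
  invertible⇒reduced : ∀ I → Invertible Δ I → ∃[ P ] (Primitive P × Reduced P × I ∼ ideal P)
  invertible⇒reduced I I-invertible =
    let (P , I∼P) = invertible⇒form I I-invertible
        (Q , reduced , P∼Q) = reduce P
        I∼Q = ∼-trans {I} {ideal P} {ideal Q} I∼P P∼Q in
    Q , invertible⇒primitive {I} Q I-invertible I∼Q , reduced , I∼Q

-- Deciding whether two forms have equivalent ideals.

module FormComparison (k : ℕ) (k>0 : 0 ℕ.< k) where

  open import Data.Integer hiding (suc)
  open import Data.Integer.Divisibility.Signed using (_∣_; divides; _∣?_)
  import Data.Integer.Properties as ℤ
  open import Data.Integer.Tactic.RingSolver using (solve; solve-∀)
  open import Data.List using ([]; _∷_)
  import Data.Nat.Properties as ℕ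
  open import Data.Product using (∃-syntax; _×_; _,_; proj₁; proj₂)
  open import Relation.Binary.PropositionalEquality
  open import Relation.Nullary using (Dec)
  open import Relation.Nullary.Decidable using (map′; _×-dec_)
  open IntegerArithmetic
  open EmbeddedOrder k k>0
  open Forms k k>0
  open Form

  -- For z = u + v√D this is the rational part of zω_Q minus b_P times its √D-coordinate, that is,
  -- the part of zω_Q left over after its multiple of ω_P is removed.
  cross : Form → Form → ℤ → ℤ → ℤ
  cross P Q u v = u * (b Q - b P) + v * (D - b P * b Q)

  -- For z = u + v√D these say z ∈ L(P), z̄ ∈ L(Q) and, given the first two, zω_Q ∈ a_Q L(P).
  Divides : Form → Form → ℤ → ℤ → Set
  Divides P Q u v = (a P ∣ u - v * b P) × (a Q ∣ u + v * b Q) × (a Q * a P ∣ cross P Q u v)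

  -- z L(Q) = a_Q L(P), the norm condition forcing equality of the two lattices.
  Ratio : Form → Form → ℤ → ℤ → Set
  Ratio P Q u v = Divides P Q u v × ∣ N u v ∣ ≡ ∣ a P * a Q ∣

  Divides-combinable : ∀ P Q n n′ u v u′ v′ → Divides P Q u v → Divides P Q u′ v′
    → Divides P Q (n * u + n′ * u′) (n * v + n′ * v′)
  Divides-combinable (form a b _ _) (form a′ b′ _ _) n n′ u v u′ v′
    (divides p₁ e₁ , divides p₂ e₂ , divides p₃ e₃) (divides q₁ f₁ , divides q₂ f₂ , divides q₃ f₃) =
      divides (n * p₁ + n′ * q₁) (combine (minus n n′ u v u′ v′ b) e₁ f₁)
    , divides (n * p₂ + n′ * q₂) (combine (plus n n′ u v u′ v′ b′) e₂ f₂)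
    , divides (n * p₃ + n′ * q₃) (combine (bilinear n n′ u v u′ v′ b b′ D) e₃ f₃)
    where
    combine : ∀ {X Y Z p q a} → X ≡ n * Y + n′ * Z → Y ≡ p * a → Z ≡ q * a → X ≡ (n * p + n′ * q) * a
    combine {p = p} {q} {a} e f g = trans e (trans (cong₂ (λ Y Z → n * Y + n′ * Z) f g) (factor n n′ p q a))
      where
      factor : ∀ n n′ p q a → n * (p * a) + n′ * (q * a) ≡ (n * p + n′ * q) * a
      factor = solve-∀
    minus : ∀ n n′ u v u′ v′ b → n * u + n′ * u′ - (n * v + n′ * v′) * b ≡ n * (u - v * b) + n′ * (u′ - v′ * b)
    minus = solve-∀
    plus : ∀ n n′ u v u′ v′ b → n * u + n′ * u′ + (n * v + n′ * v′) * b ≡ n * (u + v * b) + n′ * (u′ + v′ * b)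
    plus = solve-∀
    bilinear : ∀ n n′ u v u′ v′ b b′ D →
      (n * u + n′ * u′) * (b′ - b) + (n * v + n′ * v′) * (D - b * b′)
      ≡ n * (u * (b′ - b) + v * (D - b * b′)) + n′ * (u′ * (b′ - b) + v′ * (D - b * b′))
    bilinear = solve-∀

  -- The z satisfying `Divides` form an 𝒪-module; in particular the condition survives
  -- multiplication by ε = m + √D and ε⁻¹ = m - √D.
  Divides-√D : ∀ P Q u v → Divides P Q u v → Divides P Q (D * v) u
  Divides-√D (form a b c e) (form a′ b′ c′ e′) u v (divides p₁ f₁ , divides p₂ f₂ , divides p₃ f₃) =
      divides (- (b * p₁) - v * c) (trans (first a b c u v D e) (trans (cong (λ x → - (b * x) - v * c * a) f₁) (first′ a b c v p₁)))
    , divides (b′ * p₂ - v * c′) (trans (second a′ b′ c′ u v D e′) (trans (cong (λ x → b′ * x - v * c′ * a′) f₂) (second′ a′ b′ c′ v p₂)))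
    , divides (- (p₃ * b) - c * p₂) (trans (third a b c b′ u v D e)
        (trans (cong₂ (λ x y → - (x * b) - a * c * y) f₃ f₂) (third′ a b c a′ p₂ p₃)))
    where
    first : ∀ a b c u v D → D ≡ b * b - a * c → D * v - u * b ≡ - (b * (u - v * b)) - v * c * a
    first a b c u v _ refl = solve (a ∷ b ∷ c ∷ u ∷ v ∷ [])
    first′ : ∀ a b c v p → - (b * (p * a)) - v * c * a ≡ (- (b * p) - v * c) * a
    first′ = solve-∀
    second : ∀ a b c u v D → D ≡ b * b - a * c → D * v + u * b ≡ b * (u + v * b) - v * c * a
    second a b c u v _ refl = solve (a ∷ b ∷ c ∷ u ∷ v ∷ [])
    second′ : ∀ a b c v p → b * (p * a) - v * c * a ≡ (b * p - v * c) * a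
    second′ = solve-∀
    third : ∀ a b c b′ u v D → D ≡ b * b - a * c → D * v * (b′ - b) + u * (D - b * b′)
      ≡ - ((u * (b′ - b) + v * (D - b * b′)) * b) - a * c * (u + v * b′)
    third a b c b′ u v _ refl = solve (a ∷ b ∷ c ∷ b′ ∷ u ∷ v ∷ [])
    third′ : ∀ a b c a′ p₂ p₃ → - (p₃ * (a′ * a) * b) - a * c * (p₂ * a′) ≡ (- (p₃ * b) - c * p₂) * (a′ * a)
    third′ = solve-∀

  Ratio-ε : ∀ P Q u v → Ratio P Q u v → Ratio P Q (m * u + D * v) (m * v + u)
  Ratio-ε P Q u v (div , ∣N∣≡) =
    subst₂ (Divides P Q) (one m u (D * v)) (one m v u)
      (Divides-combinable P Q m 1ℤ u v (D * v) u div (Divides-√D P Q u v div)) ,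
    trans (cong ∣_∣ (N-ε u v)) ∣N∣≡
    where
    one : ∀ m x y → m * x + 1ℤ * y ≡ m * x + y
    one = solve-∀

  Ratio-ε⁻¹ : ∀ P Q u v → Ratio P Q u v → Ratio P Q (m * u - D * v) (m * v - u)
  Ratio-ε⁻¹ P Q u v (div , ∣N∣≡) =
    subst₂ (Divides P Q) (one m u (D * v)) (one m v u)
      (Divides-combinable P Q m -1ℤ u v (D * v) u div (Divides-√D P Q u v div)) ,
    trans (cong ∣_∣ (N-ε⁻¹ u v)) ∣N∣≡
    where
    one : ∀ m x y → m * x + -1ℤ * y ≡ m * x - y
    one = solve-∀

  Ratio-descent : ∀ P Q u v → Ratio P Q u v
    → ∃[ u ] ∃[ v ] (Ratio P Q u v × 2 ℕ.* k ℕ.* (∣ v ∣ ℕ.* ∣ v ∣) ℕ.≤ ∣ a P * a Q ∣)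
  Ratio-descent P Q u v ratio =
    let (u , v , ratio′ , bound) = N-descent (Ratio P Q) (λ {u} {v} → Ratio-ε P Q u v) (λ {u} {v} → Ratio-ε⁻¹ P Q u v) {u} {v} ratio in
    u , v , ratio′ , subst (2 ℕ.* k ℕ.* (∣ v ∣ ℕ.* ∣ v ∣) ℕ.≤_) (proj₂ ratio′) bound

  N-factors : ∀ u v b b′ D → u * u - D * (v * v)
    ≡ (u - v * b) * (u + v * b′) - v * (u * (b′ - b) + v * (D - b * b′))
  N-factors = solve-∀

  -- The quotients are matrix entries: za_Q = a_Q(pa_P + vω_P) and zω_Q = a_Q(ra_P + qω_P). The norm
  -- of z is a_P a_Q times the determinant.
  N≡det : ∀ P Q u v p q r → u - v * b P ≡ p * a P → u + v * b Q ≡ q * a Q → cross P Q u v ≡ r * (a Q * a P)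
    → N u v ≡ (p * q - v * r) * (a P * a Q)
  N≡det (form a b _ _) (form a′ b′ _ _) u v p q r e₁ e₂ e₃ = trans (N-factors u v b b′ D)
    (trans (cong₂ (λ x y → x - v * y) (cong₂ _*_ e₁ e₂) e₃) (factor a a′ v p q r))
    where
    factor : ∀ a a′ v p q r → p * a * (q * a′) - v * (r * (a′ * a)) ≡ (p * q - v * r) * (a * a′)
    factor = solve-∀

  aa≢0 : ∀ P Q → a P * a Q ≢ + 0
  aa≢0 P Q = nonzero-product (a≢0 P) (a≢0 Q)

  -- By the norm condition the matrix of `N≡det` has determinant ±1, so zL(Q) is all of a_Q L(P).
  Ratio⇒∼ : ∀ P Q u v → Ratio P Q u v → ideal P ∼ ideal Q
  Ratio⇒∼ P@(form a b c e) Q@(form a′ b′ c′ e′) u v ((divides p e₁ , divides q e₂ , divides r e₃) , ∣N∣≡) =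
    ratio-∼ a′ (emb u v) (a≢0 Q) z≢0
      -- The coefficients s′, w′ are those of x multiplied by the inverse matrix, which is ε times
      -- the adjugate.
      (λ {x} (s , w , x≡) → let s′ = ε * (s * q - w * r) ; w′ = ε * (w * p - s * v) in
        emb (s′ * a′ + w′ * b′) w′ , lattice-∈ a′ b′ s′ w′ ,
        trans (cong (ιℤ Δ a′ ·_) (trans x≡ (emb-cong
          (cong₂ (λ s w → s * a + w * b) (invert₁ s w) (invert₂ s w)) (invert₂ s w)))) (match s′ w′))
      (λ {y} (s , w , y≡) → let s′ = s * p + w * r ; w′ = s * v + w * q in
        emb (s′ * a + w′ * b) w′ , lattice-∈ a b s′ w′ , trans (match s w) (cong (emb u v ·_) (sym y≡)))
    where
    z≢0 : emb u v ≢ 0#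
    z≢0 z≡0 = let (u≡0 , v≡0) = emb-injective (trans z≡0 (sym emb-0)) in
      aa≢0 P Q (ℤ.∣i∣≡0⇒i≡0 (trans (sym ∣N∣≡) (cong ∣_∣ (trans (cong₂ N u≡0 v≡0) (N0≡0 D)))))
      where
      N0≡0 : ∀ D → + 0 * + 0 - D * (+ 0 * + 0) ≡ + 0
      N0≡0 = solve-∀
    unit : ∃[ ε ] (N u v ≡ ε * (a * a′) × ε * ε ≡ 1ℤ)
    unit = ∣∣≡∣∣⇒≡± (N u v) (a * a′) ∣N∣≡
    -- A sign, not the unit m + √D.
    ε : ℤ
    ε = proj₁ unit
    det≡ε : p * q - v * r ≡ ε
    det≡ε = *-cancelʳ′ (aa≢0 P Q) (trans (sym (N≡det P Q u v p q r e₁ e₂ e₃)) (proj₁ (proj₂ unit)))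
    absorb : ∀ s → s ≡ ε * (p * q - v * r) * s
    absorb s = sym (trans (cong (_* s) (trans (cong (ε *_) det≡ε) (proj₂ (proj₂ unit)))) (ℤ.*-identityˡ s))
    invert₁ : ∀ s w → s ≡ ε * (s * q - w * r) * p + ε * (w * p - s * v) * r
    invert₁ s w = trans (absorb s) (identity ε p q r v s w)
      where
      identity : ∀ ε p q r v s w → ε * (p * q - v * r) * s ≡ ε * (s * q - w * r) * p + ε * (w * p - s * v) * r
      identity = solve-∀
    invert₂ : ∀ s w → w ≡ ε * (s * q - w * r) * v + ε * (w * p - s * v) * q
    invert₂ s w = trans (absorb w) (identity ε p q r v s w)
      where
      identity : ∀ ε p q r v s w → ε * (p * q - v * r) * w ≡ ε * (s * q - w * r) * v + ε * (w * p - s * v) * q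
      identity = solve-∀
    first : ∀ s w → u * (s * a′ + w * b′) + D * (v * w) ≡ a′ * ((s * p + w * r) * a + (s * v + w * q) * b)
    first s w = trans (expand u v a′ b b′ D s w)
      (trans (cong₂ (λ x y → s * a′ * (x + v * b) + w * y) e₁ (cong₂ (λ x y → x + y * b) e₃ e₂)) (collect a b a′ p q r v s w))
      where
      expand : ∀ u v a′ b b′ D s w → u * (s * a′ + w * b′) + D * (v * w)
        ≡ s * a′ * (u - v * b + v * b) + w * ((u * (b′ - b) + v * (D - b * b′)) + (u + v * b′) * b)
      expand = solve-∀
      collect : ∀ a b a′ p q r v s w → s * a′ * (p * a + v * b) + w * (r * (a′ * a) + q * a′ * b)
        ≡ a′ * ((s * p + w * r) * a + (s * v + w * q) * b)
      collect = solve-∀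
    second : ∀ s w → u * w + v * (s * a′ + w * b′) ≡ a′ * (s * v + w * q)
    second s w = trans (expand u v a′ b′ s w) (trans (cong (λ x → s * v * a′ + w * x) e₂) (collect a′ q v s w))
      where
      expand : ∀ u v a′ b′ s w → u * w + v * (s * a′ + w * b′) ≡ s * v * a′ + w * (u + v * b′)
      expand = solve-∀
      collect : ∀ a′ q v s w → s * v * a′ + w * (q * a′) ≡ a′ * (s * v + w * q)
      collect = solve-∀
    match : ∀ s w → ιℤ Δ a′ · emb ((s * p + w * r) * a + (s * v + w * q) * b) (s * v + w * q)
      ≡ emb u v · emb (s * a′ + w * b′) w
    match s w = trans (emb-scale a′ ((s * p + w * r) * a + (s * v + w * q) * b) (s * v + w * q))
      (trans (sym (emb-cong (first s w) (second s w))) (sym (emb-* u v (s * a′ + w * b′) w)))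

  -- The transition matrix between the bases (αa_Q, αω_Q) and (a_P, ω_P) of the same lattice is unimodular.
  ∼⇒Ratio : ∀ P Q → ideal P ∼ ideal Q → ∃[ u ] ∃[ v ] Ratio P Q u v
  ∼⇒Ratio P@(form a b c e) Q@(form a′ b′ c′ e′) (∼-intro (α , _ , I≈αJ)) =
    from-bases (from I≈αJ (emb (1ℤ * a′ + + 0 * b′) (+ 0) , lattice-∈ a′ b′ 1ℤ (+ 0) , refl))
               (from I≈αJ (emb (+ 0 * a′ + 1ℤ * b′) 1ℤ , lattice-∈ a′ b′ (+ 0) 1ℤ , refl))
               (to I≈αJ (lattice-∈ a b 1ℤ (+ 0))) (to I≈αJ (lattice-∈ a b (+ 0) 1ℤ))
    where
    z₁ z₂ : K
    z₁ = α · emb (1ℤ * a′ + + 0 * b′) (+ 0)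
    z₂ = α · emb (+ 0 * a′ + 1ℤ * b′) 1ℤ
    from-bases : Lattice a b z₁ → Lattice a b z₂
      → ∃[ y ] Lattice a′ b′ y × emb (1ℤ * a + + 0 * b) (+ 0) ≡ α · y
      → ∃[ y ] Lattice a′ b′ y × emb (+ 0 * a + 1ℤ * b) 1ℤ ≡ α · y
      → ∃[ u ] ∃[ v ] Ratio P Q u v
    from-bases (t₁₁ , t₁₂ , z₁≡) (t₂₁ , t₂₂ , z₂≡) (y₁ , (s₁₁ , s₁₂ , y₁≡) , a≡αy₁) (y₂ , (s₂₁ , s₂₂ , y₂≡) , ω≡αy₂) =
      u , v , (divides t₁₁ (first a b t₁₁ t₁₂) , divides t₂₂ eq₂ , divides t₂₁ eq₃) ,
      trans (cong ∣_∣ (N≡det P Q u v t₁₁ t₂₂ t₂₁ (first a b t₁₁ t₁₂) eq₂ eq₃))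
        (trans (ℤ.abs-* (t₁₁ * t₂₂ - v * t₂₁) (a * a′))
          (trans (cong (ℕ._* ∣ a * a′ ∣) (*≡1⇒∣∣≡1 (t₁₁ * t₂₂ - v * t₂₁) (s₁₁ * s₂₂ - s₁₂ * s₂₁) det*det≡1))
            (ℕ.*-identityˡ ∣ a * a′ ∣)))
      where
      u v u₂ : ℤ
      u = t₁₁ * a + t₁₂ * b
      v = t₁₂
      u₂ = t₂₁ * a + t₂₂ * b
      first : ∀ a b p v → p * a + v * b - v * b ≡ p * a
      first = solve-∀
      -- Here z = αa_Q, and zω_Q = (αω_Q)a_Q. Comparing coordinates identifies t₂₂ and t₂₁ as the
      -- second and third quotients in `Divides`.
      products : emb u v · emb b′ 1ℤ ≡ emb u₂ t₂₂ · emb a′ (+ 0)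
      products = begin
        emb u v · emb b′ 1ℤ       ≡⟨ cong₂ _·_ (sym z₁≡) (emb-cong (pad₂ a′ b′) refl) ⟩
        α · x₁ · x₂               ≡⟨ *-assoc α x₁ x₂ ⟩
        α · (x₁ · x₂)             ≡⟨ cong (α ·_) (*-comm x₁ x₂) ⟩
        α · (x₂ · x₁)             ≡⟨ *-assoc α x₂ x₁ ⟨
        α · x₂ · x₁               ≡⟨ cong₂ _·_ z₂≡ (emb-cong (sym (pad₁ a′ b′)) refl) ⟩
        emb u₂ t₂₂ · emb a′ (+ 0) ∎
        where
        open ≡-Reasoning
        x₁ x₂ : K
        x₁ = emb (1ℤ * a′ + + 0 * b′) (+ 0)
        x₂ = emb (+ 0 * a′ + 1ℤ * b′) 1ℤ
        pad₁ : ∀ a b → a ≡ 1ℤ * a + + 0 * b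
        pad₁ = solve-∀
        pad₂ : ∀ a b → b ≡ + 0 * a + 1ℤ * b
        pad₂ = solve-∀
      components : u * b′ + D * (v * 1ℤ) ≡ u₂ * a′ + D * (t₂₂ * + 0) × u * 1ℤ + v * b′ ≡ u₂ * + 0 + t₂₂ * a′
      components = emb-injective (trans (sym (emb-* u v b′ 1ℤ)) (trans products (emb-* u₂ t₂₂ a′ (+ 0))))
      eq₂ : u + v * b′ ≡ t₂₂ * a′
      eq₂ = trans (one u v b′) (trans (proj₂ components) (zero u₂ t₂₂ a′))
        where
        one : ∀ u v b → u + v * b ≡ u * 1ℤ + v * b
        one = solve-∀
        zero : ∀ u t a → u * + 0 + t * a ≡ t * a
        zero = solve-∀
      eq₃ : u * (b′ - b) + v * (D - b * b′) ≡ t₂₁ * (a′ * a)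
      eq₃ = trans (split u v b b′ D) (trans (cong₂ (λ x y → x - y * b) (proj₁ components) eq₂) (collect a b a′ D t₂₁ t₂₂))
        where
        split : ∀ u v b b′ D → u * (b′ - b) + v * (D - b * b′) ≡ u * b′ + D * (v * 1ℤ) - (u + v * b′) * b
        split = solve-∀
        collect : ∀ a b a′ D t₂₁ t₂₂ →
          (t₂₁ * a + t₂₂ * b) * a′ + D * (t₂₂ * + 0) - t₂₂ * a′ * b ≡ t₂₁ * (a′ * a)
        collect = solve-∀
      expand : ∀ s w → α · emb (s * a′ + w * b′) w ≡ emb (s * u + w * u₂) (s * v + w * t₂₂)
      expand s w = begin
        α · emb (s * a′ + w * b′) w
          ≡⟨ cong (α ·_) (emb-cong (pad₁ a′ b′ s w) (pad₂ s w)) ⟩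
        α · emb (s * (1ℤ * a′ + + 0 * b′) + w * (+ 0 * a′ + 1ℤ * b′)) (s * + 0 + w * 1ℤ)
          ≡⟨ cong (α ·_) (sym (trans (cong₂ _⊕_ (emb-scale s (1ℤ * a′ + + 0 * b′) (+ 0)) (emb-scale w (+ 0 * a′ + 1ℤ * b′) 1ℤ))
               (emb-+ (s * (1ℤ * a′ + + 0 * b′)) (s * + 0) (w * (+ 0 * a′ + 1ℤ * b′)) (w * 1ℤ)))) ⟩
        α · ((ιℤ Δ s · x₁) ⊕ (ιℤ Δ w · x₂))
          ≡⟨ distribˡ α (ιℤ Δ s · x₁) (ιℤ Δ w · x₂) ⟩
        (α · (ιℤ Δ s · x₁)) ⊕ (α · (ιℤ Δ w · x₂))
          ≡⟨ cong₂ _⊕_ (x∙yz≈y∙xz α (ιℤ Δ s) x₁) (x∙yz≈y∙xz α (ιℤ Δ w) x₂) ⟩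
        (ιℤ Δ s · (α · x₁)) ⊕ (ιℤ Δ w · (α · x₂))
          ≡⟨ cong₂ _⊕_ (trans (cong (ιℤ Δ s ·_) z₁≡) (emb-scale s u v)) (trans (cong (ιℤ Δ w ·_) z₂≡) (emb-scale w u₂ t₂₂)) ⟩
        emb (s * u) (s * v) ⊕ emb (w * u₂) (w * t₂₂)
          ≡⟨ emb-+ (s * u) (s * v) (w * u₂) (w * t₂₂) ⟩
        emb (s * u + w * u₂) (s * v + w * t₂₂) ∎
        where
        open ≡-Reasoning
        _⊕_ : K → K → K
        _⊕_ = _+K_ Δ
        x₁ x₂ : K
        x₁ = emb (1ℤ * a′ + + 0 * b′) (+ 0)
        x₂ = emb (+ 0 * a′ + 1ℤ * b′) 1ℤ
        pad₁ : ∀ a b s w → s * a + w * b ≡ s * (1ℤ * a + + 0 * b) + w * (+ 0 * a + 1ℤ * b)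
        pad₁ = solve-∀
        pad₂ : ∀ s w → w ≡ s * + 0 + w * 1ℤ
        pad₂ = solve-∀
      row₁ : 1ℤ * a + + 0 * b ≡ s₁₁ * u + s₁₂ * u₂ × + 0 ≡ s₁₁ * v + s₁₂ * t₂₂
      row₁ = emb-injective (trans a≡αy₁ (trans (cong (α ·_) y₁≡) (expand s₁₁ s₁₂)))
      row₂ : + 0 * a + 1ℤ * b ≡ s₂₁ * u + s₂₂ * u₂ × 1ℤ ≡ s₂₁ * v + s₂₂ * t₂₂
      row₂ = emb-injective (trans ω≡αy₂ (trans (cong (α ·_) y₂≡) (expand s₂₁ s₂₂)))
      split-row : ∀ a b s w t₁₁ t₁₂ t₂₁ t₂₂ → s * (t₁₁ * a + t₁₂ * b) + w * (t₂₁ * a + t₂₂ * b)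
        ≡ (s * t₁₁ + w * t₂₁) * a + (s * t₁₂ + w * t₂₂) * b
      split-row = solve-∀
      +-cancelʳ : ∀ {x y} z → x + z ≡ y + z → x ≡ y
      +-cancelʳ {x} {y} z e = trans (sym (minus x z)) (trans (cong (_- z) e) (minus y z))
        where
        minus : ∀ x z → x + z - z ≡ x
        minus = solve-∀
      entry : ∀ s w x y → x * a + y * b ≡ s * u + w * u₂ → y ≡ s * v + w * t₂₂ → x ≡ s * t₁₁ + w * t₂₁
      entry s w x y e f = *-cancelʳ′ (a≢0 P) (+-cancelʳ (y * b)
        (trans e (trans (split-row a b s w t₁₁ t₁₂ t₂₁ t₂₂) (cong (λ y → (s * t₁₁ + w * t₂₁) * a + y * b) (sym f)))))
      det*det≡1 : (t₁₁ * t₂₂ - v * t₂₁) * (s₁₁ * s₂₂ - s₁₂ * s₂₁) ≡ 1ℤ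
      det*det≡1 = trans (identity s₁₁ s₁₂ s₂₁ s₂₂ t₁₁ t₁₂ t₂₁ t₂₂)
        (cong₂ _-_ (cong₂ _*_ (sym (entry s₁₁ s₁₂ 1ℤ (+ 0) (proj₁ row₁) (proj₂ row₁))) (sym (proj₂ row₂)))
                   (cong₂ _*_ (sym (proj₂ row₁)) (sym (entry s₂₁ s₂₂ (+ 0) 1ℤ (proj₁ row₂) (proj₂ row₂)))))
        where
        identity : ∀ s₁₁ s₁₂ s₂₁ s₂₂ t₁₁ t₁₂ t₂₁ t₂₂ → (t₁₁ * t₂₂ - t₁₂ * t₂₁) * (s₁₁ * s₂₂ - s₁₂ * s₂₁)
          ≡ (s₁₁ * t₁₁ + s₁₂ * t₂₁) * (s₂₁ * t₁₂ + s₂₂ * t₂₂) - (s₁₁ * t₁₂ + s₁₂ * t₂₂) * (s₂₁ * t₁₁ + s₂₂ * t₂₁)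
        identity = solve-∀

  m≤m*m : ∀ n → n ℕ.≤ n ℕ.* n
  m≤m*m ℕ.zero = ℕ.z≤n
  m≤m*m (ℕ.suc n) = ℕ.m≤m*n (ℕ.suc n) (ℕ.suc n)

  Ratio? : ∀ P Q u v → Dec (Ratio P Q u v)
  Ratio? P Q u v = (a P ∣? (u - v * b P) ×-dec a Q ∣? (u + v * b Q) ×-dec (a Q * a P) ∣? cross P Q u v)
    ×-dec (∣ N u v ∣ ℕ.≟ ∣ a P * a Q ∣)

  v-bounded : ∀ M v → 2 ℕ.* k ℕ.* (∣ v ∣ ℕ.* ∣ v ∣) ℕ.≤ M → ∣ v ∣ ℕ.≤ M
  v-bounded M v bound = ℕ.≤-trans (m≤m*m ∣ v ∣) (ℕ.≤-trans (ℕ.m≤n*m (∣ v ∣ ℕ.* ∣ v ∣) (2 ℕ.* k)) bound)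
    where
    instance _ = ℕ.>-nonZero (ℕ.<-≤-trans k>0 (ℕ.m≤m+n k (k ℕ.+ 0)))

  u-bounded : ∀ M u v → ∣ N u v ∣ ≡ M → ∣ v ∣ ℕ.≤ M → ∣ u ∣ ℕ.≤ M ℕ.+ d k ℕ.* (M ℕ.* M)
  u-bounded M u v ∣N∣≡M ∣v∣≤M = begin
    ∣ u ∣                                     ≤⟨ m≤m*m ∣ u ∣ ⟩
    ∣ u ∣ ℕ.* ∣ u ∣                           ≡⟨ ℤ.abs-* u u ⟨
    ∣ u * u ∣                                 ≡⟨ cong ∣_∣ (restore u v D) ⟩
    ∣ N u v + D * (v * v) ∣                   ≤⟨ ℤ.∣i+j∣≤∣i∣+∣j∣ (N u v) (D * (v * v)) ⟩
    ∣ N u v ∣ ℕ.+ ∣ D * (v * v) ∣             ≡⟨ cong₂ ℕ._+_ ∣N∣≡M ∣Dvv∣≡ ⟩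
    M ℕ.+ d k ℕ.* (∣ v ∣ ℕ.* ∣ v ∣)           ≤⟨ ℕ.+-monoʳ-≤ M (ℕ.*-monoʳ-≤ (d k) (ℕ.*-mono-≤ ∣v∣≤M ∣v∣≤M)) ⟩
    M ℕ.+ d k ℕ.* (M ℕ.* M)                   ∎
    where
    open ℕ.≤-Reasoning
    restore : ∀ u v D → u * u ≡ u * u - D * (v * v) + D * (v * v)
    restore = solve-∀
    ∣Dvv∣≡ : ∣ D * (v * v) ∣ ≡ d k ℕ.* (∣ v ∣ ℕ.* ∣ v ∣)
    ∣Dvv∣≡ = trans (ℤ.abs-* D (v * v)) (cong₂ ℕ._*_ (cong ∣_∣ D≡+d) (ℤ.abs-* v v))

  -- After descent 2kv² ≤ M = ∣a_P a_Q∣ bounds v, and u² = N(u, v) + Dv² with ∣N(u, v)∣ = M bounds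
  -- u. Divisibility and norm are then tested in a finite box.
  ratio? : ∀ P Q → Dec (∃[ u ] ∃[ v ] Ratio P Q u v)
  ratio? P Q = map′ forget bound
    (anyBounded? (λ u → anyBounded? (Ratio? P Q u) M) (M ℕ.+ d k ℕ.* (M ℕ.* M)))
    where
    M : ℕ
    M = ∣ a P * a Q ∣
    BoundedRatio : Set
    BoundedRatio = ∃[ u ] (∣ u ∣ ℕ.≤ M ℕ.+ d k ℕ.* (M ℕ.* M) × ∃[ v ] (∣ v ∣ ℕ.≤ M × Ratio P Q u v))
    forget : BoundedRatio → ∃[ u ] ∃[ v ] Ratio P Q u v
    forget (u , _ , v , _ , ratio) = u , v , ratio
    bound : ∃[ u ] ∃[ v ] Ratio P Q u v → BoundedRatio
    bound (u₀ , v₀ , ratio₀) =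
      let (u , v , ratio , small) = Ratio-descent P Q u₀ v₀ ratio₀
          ∣v∣≤M = v-bounded M v small in
      u , u-bounded M u v (proj₂ ratio) ∣v∣≤M , v , ∣v∣≤M , ratio

  _∼?_ : ∀ P Q → Dec (ideal P ∼ ideal Q)
  P ∼? Q = map′ (λ (u , v , ratio) → Ratio⇒∼ P Q u v ratio) (∼⇒Ratio P Q) (ratio? P Q)

-- Existence of the class number, and principality criteria.

module ClassNumber (k : ℕ) (k>0 : 0 ℕ.< k) where

  open import Data.Integer hiding (suc)
  open import Data.Integer.Divisibility.Signed using (_∣_; divides; _∣?_)
  import Data.Integer.Properties as ℤ
  open import Data.Integer.Tactic.RingSolver using (solve-∀)
  open import Data.Fin using (zero)
  open import Data.List using (List; []; _∷_; _++_; map; upTo; concatMap)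
  open import Data.List.Membership.Propositional using (_∈_; lose)
  open import Data.List.Membership.Propositional.Properties using (∈-++⁺ˡ; ∈-++⁺ʳ; ∈-map⁺; ∈-upTo⁺)
  open import Data.List.Relation.Unary.Any as Any using (Any; here)
  open import Data.List.Relation.Unary.Any.Properties using (concatMap⁺)
  import Data.Nat.Properties as ℕ
  open import Data.Product using (Σ; ∃-syntax; _×_; _,_; proj₁; proj₂)
  open import Relation.Binary.PropositionalEquality
  open import Relation.Nullary using (Dec; yes; no; contradiction)
  open IntegerArithmetic
  open FiniteCounting using (Transversal; transversal)
  open EmbeddedOrder k k>0
  open Forms k k>0
  open Reduction k k>0
  open FormComparison k k>0
  open Form

  PrimitiveForm : Set
  PrimitiveForm = Σ Form Primitive

  integers : ℕ → List ℤ
  integers n = map +_ (upTo (ℕ.suc n)) ++ map (λ i → - (+ i)) (upTo (ℕ.suc n))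

  ∈-integers : ∀ {n} x → ∣ x ∣ ℕ.≤ n → x ∈ integers n
  ∈-integers (+ i) i≤n = ∈-++⁺ˡ (∈-map⁺ +_ (∈-upTo⁺ (ℕ.s≤s i≤n)))
  ∈-integers {n} -[1+ i ] i<n =
    ∈-++⁺ʳ (map +_ (upTo (ℕ.suc n))) (∈-map⁺ (λ i → - (+ i)) (∈-upTo⁺ (ℕ.s≤s i<n)))

  disc⇒quotient : ∀ a b c D → D ≡ b * b - a * c → b * b - D ≡ c * a
  disc⇒quotient a b c _ refl = identity a b c
    where
    identity : ∀ a b c → b * b - (b * b - a * c) ≡ c * a
    identity = solve-∀

  quotient⇒disc : ∀ a b c D → b * b - D ≡ c * a → D ≡ b * b - a * c
  quotient⇒disc a b c D e = trans (double-negation b D) (cong (λ x → b * b - x) (trans e (ℤ.*-comm c a)))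
    where
    double-negation : ∀ b D → D ≡ b * b - (b * b - D)
    double-negation = solve-∀

  if-primitive : ∀ P → Dec (Primitive P) → List PrimitiveForm
  if-primitive P (yes prim) = (P , prim) ∷ []
  if-primitive P (no _) = []

  if-divides : ∀ a b → Dec (a ∣ b * b - D) → List PrimitiveForm
  if-divides a b (yes (divides c e)) =
    let P = form a b c (quotient⇒disc a b c D e) in if-primitive P (primitive? P)
  if-divides a b (no _) = []

  with-coefficients : ℤ → ℤ → List PrimitiveForm
  with-coefficients a b = if-divides a b (a ∣? (b * b - D))

  -- Since a ≠ 0, the discriminant determines c. The proofs found by the search need not be those
  -- the given form carries, so equality of a and b is the relation to use, and it already fixes the
  -- ideal.
  _≗ab_ : PrimitiveForm → PrimitiveForm → Set
  (P , _) ≗ab (Q , _) = a P ≡ a Q × b P ≡ b Q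

  ∈-if-primitive : ∀ P Q → a (proj₁ P) ≡ a Q × b (proj₁ P) ≡ b Q → Primitive Q →
    ∀ dec → Any (P ≗ab_) (if-primitive Q dec)
  ∈-if-primitive P Q same prim (yes _) = here same
  ∈-if-primitive P Q same prim (no ¬prim) = contradiction prim ¬prim

  ∈-if-divides : ∀ P dec → Any (P ≗ab_) (if-divides (a (proj₁ P)) (b (proj₁ P)) dec)
  ∈-if-divides (form a b c e , prim) (no a∤) = contradiction (divides c (disc⇒quotient a b c D e)) a∤
  ∈-if-divides P@(form a b c e , prim) (yes (divides c′ e′)) =
    let Q = form a b c′ (quotient⇒disc a b c′ D e′) in
    ∈-if-primitive P Q (refl , refl)
      (subst (λ c → ∃[ r ] ∃[ s ] ∃[ t ] r * a + s * (+ 2 * b) + t * c ≡ 1ℤ) c≡c′ prim) (primitive? Q)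
    where
    c≡c′ : c ≡ c′
    c≡c′ = *-cancelʳ′ (a≢0 (form a b c e)) (trans (sym (disc⇒quotient a b c D e)) e′)

  ∈-with-coefficients : ∀ P → Any (P ≗ab_) (with-coefficients (a (proj₁ P)) (b (proj₁ P)))
  ∈-with-coefficients P = ∈-if-divides P (a (proj₁ P) ∣? (b (proj₁ P) * b (proj₁ P) - D))

  -- The box is crude: ∣b∣ < ∣a∣ ≤ a² ≤ D. Further forms and repeated classes do no harm, as
  -- `transversal` keeps one form of each class.
  reduced-forms : List PrimitiveForm
  reduced-forms = concatMap (λ a → concatMap (with-coefficients a) (integers (d k))) (integers (d k))

  ∈-reduced-forms : ∀ P → Reduced (proj₁ P) → Any (P ≗ab_) reduced-forms
  ∈-reduced-forms P@(form a _ c e , prim) (n , refl , n<∣a∣ , aa≤d) =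
    concatMap⁺ _ (lose (∈-integers a ∣a∣≤d)
      (concatMap⁺ _ (lose (∈-integers (+ n) (ℕ.≤-trans (ℕ.<⇒≤ n<∣a∣) ∣a∣≤d)) (∈-with-coefficients P))))
    where
    ∣a∣≤d : ∣ a ∣ ℕ.≤ d k
    ∣a∣≤d = ℕ.≤-trans (m≤m*m ∣ a ∣) aa≤d

  _≃_ : PrimitiveForm → PrimitiveForm → Set
  P ≃ Q = ideal (proj₁ P) ∼ ideal (proj₁ Q)

  ≗ab⇒≃ : ∀ {P Q} → P ≗ab Q → P ≃ Q
  ≗ab⇒≃ {form a b _ _ , _} {form _ _ _ _ , _} (refl , refl) = ≈⇒∼ ⊛.refl

  classes : Transversal _≃_ reduced-forms
  classes = transversal _≃_
    (λ {P} {Q} → ∼-sym {ideal (proj₁ P)} {ideal (proj₁ Q)})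
    (λ {P} {Q} {R} → ∼-trans {ideal (proj₁ P)} {ideal (proj₁ Q)} {ideal (proj₁ R)})
    (λ P Q → proj₁ P ∼? proj₁ Q)
    reduced-forms

  class-number : HasClassNumber Δ (Transversal.size classes)
  class-number =
      (λ i → ideal (proj₁ (rep i)))
    , (λ i → primitive⇒invertible (proj₁ (rep i)) (proj₂ (rep i)))
    , (λ i j same → distinct i j (∼-intro same))
    , λ I I-invertible →
        let (P , prim , reduced , I∼P) = invertible⇒reduced I I-invertible
            (i , P≃rep) = covers (P , prim) (Any.map (λ {Q} → ≗ab⇒≃ {P , prim} {Q}) (∈-reduced-forms (P , prim) reduced)) in
        i , sameClass (∼-trans {I} {ideal P} {ideal (proj₁ (rep i))} I∼P P≃rep)
    where open Transversal classes

  unit-form : Form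
  unit-form = form 1ℤ (+ 0) (- D) (identity D)
    where
    identity : ∀ D → D ≡ + 0 * + 0 - 1ℤ * (- D)
    identity = solve-∀

  unit-a⇒principal : ∀ P → ∣ a P ∣ ≡ 1 → ideal P ∼ 𝒪
  unit-a⇒principal (form a b c e) ∣a∣≡1 = ≈⇒∼ (≈-from
    (λ { (s , v , x≡) → subst (InO Δ) (sym x≡) (emb∈𝒪 (s * a + v * b) v) })
    (λ {x} x∈𝒪 → let (u , v , x≡) = 𝒪⇒emb {x} x∈𝒪 in
      (u - v * b) * a , v , trans x≡ (emb-cong (trans (sym (split u v b (∣x∣≡1⇒x*x≡1 a ∣a∣≡1)))
        (cong (_+ v * b) (sym (ℤ.*-assoc (u - v * b) a a)))) refl)))
    where
    split : ∀ u v b → a * a ≡ 1ℤ → (u - v * b) * (a * a) + v * b ≡ u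
    split u v b aa≡1 = trans (cong (λ x → (u - v * b) * x + v * b) aa≡1) (identity u v b)
      where
      identity : ∀ u v b → (u - v * b) * 1ℤ + v * b ≡ u
      identity = solve-∀

  -- Descent moves a generator of norm ±a into ℤ; being divisible by a, it has norm q²a².
  principal⇒unit-a : ∀ P → ∣ a P ∣ ℕ.< 2 ℕ.* k → ideal P ∼ 𝒪 → ∣ a P ∣ ≡ 1
  principal⇒unit-a P ∣a∣<2k P∼𝒪 =
    -- 𝒪 is the ideal of the form (1, 0, -D), so principality is a comparison of two forms and the
    -- ratio has norm ±a.
    let (u₀ , v₀ , ratio₀) = ∼⇒Ratio P unit-form
          (∼-trans {ideal P} {𝒪} {ideal unit-form} P∼𝒪 (∼-sym {ideal unit-form} {𝒪} (unit-a⇒principal unit-form refl)))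
        (u , v , ratio , bound) = Ratio-descent P unit-form u₀ v₀ ratio₀ in
    finish u v ratio bound
    where
    finish : ∀ u v → Ratio P unit-form u v → 2 ℕ.* k ℕ.* (∣ v ∣ ℕ.* ∣ v ∣) ℕ.≤ ∣ a P * 1ℤ ∣ → ∣ a P ∣ ≡ 1
    finish u v ((divides q u-vb≡qa , _) , ∣N∣≡) bound = ℕ.m*n≡1⇒n≡1 ∣ q * q ∣ ∣ a P ∣
      (ℕ.*-cancelʳ-≡ _ _ ∣ a P ∣ {{∣a∣≢0}} (trans (trans (cong (ℕ._* ∣ a P ∣) (sym (ℤ.abs-* (q * q) (a P))))
        (trans (sym (ℤ.abs-* (q * q * a P) (a P))) (trans (cong ∣_∣ (sym N≡)) (trans ∣N∣≡ (cong ∣_∣ (ℤ.*-identityʳ (a P)))))))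
        (sym (ℕ.*-identityˡ ∣ a P ∣))))
      where
      ∣a∣≢0 : ℕ.NonZero ∣ a P ∣
      ∣a∣≢0 = ≢-nonZero (a≢0 P)
      v≡0 : v ≡ + 0
      v≡0 = small-bound⇒v≡0 ∣ a P * 1ℤ ∣ v (subst (λ x → ∣ x ∣ ℕ.< 2 ℕ.* k) (sym (ℤ.*-identityʳ (a P))) ∣a∣<2k) bound
      u≡qa : u ≡ q * a P
      u≡qa = trans (no-v u (b P)) (trans (cong (λ v → u - v * b P) (sym v≡0)) u-vb≡qa)
        where
        no-v : ∀ u b → u ≡ u - + 0 * b
        no-v = solve-∀
      N≡ : N u v ≡ q * q * a P * a P
      N≡ = trans (cong₂ N u≡qa v≡0) (square q (a P) D)
        where
        square : ∀ q a D → q * a * (q * a) - D * (+ 0 * + 0) ≡ q * q * a * a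
        square = solve-∀

  conj-inverse : ∀ P → Primitive P → ideal P ⊗ ideal (conj P) ∼ 𝒪
  conj-inverse P prim = Product≈principal⇒⊗∼𝒪 (ideal P) (ideal (conj P)) {ιℤ Δ (a P)} (ιℤ≢0 {a P} (a≢0 P)) (conj-product P prim)

  -- If a divides 2b, then L(a, b) = L(a, -b) is its own conjugate, and an ideal times its conjugate
  -- is (a).
  ambiguous⇒order-two : ∀ P l → Primitive P → b P ≡ - b P + l * a P → ideal P ⊗ ideal P ∼ 𝒪
  ambiguous⇒order-two P@(form a b c e) l prim b≡ =
    ∼-trans {ideal P ⊗ ideal P} {ideal P ⊗ ideal (conj P)} {𝒪}
      (⊗-congˡ (ideal P) {ideal P} {ideal (conj P)} (≈⇒∼ (⊛.sym (subst (λ b′ → Lattice a (- b) ≈ Lattice a b′) (sym b≡) (shift-≈ a (- b) l)))))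
      (conj-inverse P prim)

  one-class⇒principal : HasClassNumber Δ 1 → ∀ I → Invertible Δ I → I ∼ 𝒪
  one-class⇒principal (rep , _ , _ , covers) I I-invertible =
    same-rep (covers I I-invertible) (covers 𝒪 (𝒪 , Product-identityˡ 𝒪))
    where
    same-rep : ∃[ i ] SameClass Δ I (rep i) → ∃[ i ] SameClass Δ 𝒪 (rep i) → I ∼ 𝒪
    same-rep (zero , I∼) (zero , 𝒪∼) = ∼-trans {I} {rep zero} {𝒪} (∼-intro I∼) (∼-sym {𝒪} {rep zero} (∼-intro 𝒪∼))

  all-principal⇒class-number-1 : (∀ P → Primitive P → Reduced P → ideal P ∼ 𝒪) → HasClassNumber Δ 1
  all-principal⇒class-number-1 principal =
      (λ _ → 𝒪)
    , (λ _ → 𝒪 , Product-identityˡ 𝒪)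
    , (λ { zero zero _ → refl })
    , λ I I-invertible → let (P , prim , reduced , I∼P) = invertible⇒reduced I I-invertible in
        zero , sameClass (∼-trans {I} {ideal P} {𝒪} I∼P (principal P prim reduced))

-- The two families of discriminants, and Δ = 32.

module Families where

  open import Data.Integer hiding (suc; NonZero)
  import Data.Integer.Properties as ℤ
  open import Data.Integer.Divisibility.Signed using (∣⇒∣ᵤ) renaming (divides to dividesℤ)
  open import Data.Integer.Tactic.RingSolver using (solve-∀)
  open import Data.Nat as ℕ using (ℕ; zero; suc; s≤s; z≤n)
  import Data.Nat.Divisibility as ℕ
  import Data.Nat.Properties as ℕ
  import Data.Nat.Tactic.RingSolver as ℕ-Solver
  open import Data.Product using (∃-syntax; _×_; _,_; proj₁; proj₂)
  open import Data.Sum using (_⊎_; inj₁; inj₂)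
  open import Relation.Binary.PropositionalEquality
  open import Relation.Nullary using (¬_; contradiction)
  open IntegerArithmetic

  discOf≡Δ : ∀ k (k>0 : 0 ℕ.< k) → discOf (2 ℕ.* suc k) ≡ EmbeddedOrder.Δ k k>0
  discOf≡Δ k k>0 = trans (cong (_- + 4) (trans (ℤ.pos-* (2 ℕ.* suc k) (2 ℕ.* suc k)) (cong₂ _*_ (ℤ.pos-* 2 (suc k)) (ℤ.pos-* 2 (suc k)))))
    (trans (identity (+ k)) (cong (+ 4 *_) (sym (EmbeddedOrder.D≡k[k+2] k k>0))))
    where
    identity : ∀ k → + 2 * (1ℤ + k) * (+ 2 * (1ℤ + k)) - + 4 ≡ + 4 * (k * (+ 2 + k))
    identity = solve-∀

  even∨odd : ∀ n → (∃[ j ] n ≡ 2 ℕ.* j) ⊎ (∃[ j ] n ≡ suc (2 ℕ.* j))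
  even∨odd zero = inj₁ (0 , refl)
  even∨odd (suc n) with even∨odd n
  ... | inj₁ (j , refl) = inj₂ (j , refl)
  ... | inj₂ (j , refl) = inj₁ (suc j , cong suc (sym (ℕ.+-suc j (j ℕ.+ 0))))

  4x≢4t+r : ∀ x t r .{{_ : ℕ.NonZero r}} → r ℕ.< 4 → + 4 * x ≢ + 4 * t + + r
  4x≢4t+r x t r r<4 e = ℕ.>⇒∤ r<4 (∣⇒∣ᵤ (dividesℤ (x - t) (sym (trans (identity x t) (trans (cong (_- + 4 * t) e) (cancel (+ 4 * t) (+ r)))))))
    where
    identity : ∀ x t → (x - t) * + 4 ≡ + 4 * x - + 4 * t
    identity = solve-∀
    cancel : ∀ a r → a + r - a ≡ r
    cancel = solve-∀

  -- For n = 2m with m odd, Δ / 4 = m² − 1 is divisible by 4.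
  odd-half⇒non-fundamental : ∀ j → ¬ IsFundamental (discOf (2 ℕ.* suc (2 ℕ.* j)))
  odd-half⇒non-fundamental j = λ
    { (inj₁ ((t , Δ≡4t+1) , _)) → 4x≢4t+r (+ 4 * x) t 1 (s≤s (s≤s z≤n)) (trans (sym Δ≡16x) Δ≡4t+1)
    ; (inj₂ (κ , Δ≡4κ , inj₁ (t , κ≡4t+2) , _)) →
        4x≢4t+r x t 2 (s≤s (s≤s (s≤s z≤n))) (trans (sym (κ≡4x κ Δ≡4κ)) κ≡4t+2)
    ; (inj₂ (κ , Δ≡4κ , inj₂ (t , κ≡4t+3) , _)) →
        4x≢4t+r x t 3 (s≤s (s≤s (s≤s (s≤s z≤n)))) (trans (sym (κ≡4x κ Δ≡4κ)) κ≡4t+3)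
    }
    where
    x : ℤ
    x = + j * (1ℤ + + j)
    2j+1≡ : + (2 ℕ.* suc (2 ℕ.* j)) ≡ + 2 * (1ℤ + + 2 * + j)
    2j+1≡ = trans (ℤ.pos-* 2 (suc (2 ℕ.* j))) (cong (λ y → + 2 * (1ℤ + y)) (ℤ.pos-* 2 j))
    Δ≡16x : discOf (2 ℕ.* suc (2 ℕ.* j)) ≡ + 4 * (+ 4 * x)
    Δ≡16x = trans (cong (_- + 4) (trans (ℤ.pos-* (2 ℕ.* suc (2 ℕ.* j)) (2 ℕ.* suc (2 ℕ.* j))) (cong₂ _*_ 2j+1≡ 2j+1≡))) (identity (+ j))
      where
      identity : ∀ j → + 2 * (1ℤ + + 2 * j) * (+ 2 * (1ℤ + + 2 * j)) - + 4 ≡ + 4 * (+ 4 * (j * (1ℤ + j)))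
      identity = solve-∀
    κ≡4x : ∀ κ → discOf (2 ℕ.* suc (2 ℕ.* j)) ≡ + 4 * κ → κ ≡ + 4 * x
    κ≡4x κ Δ≡4κ = *-cancelˡ′ {c = + 4} (λ ()) (trans (sym Δ≡4κ) Δ≡16x)

  -- For even m = k + 1 = 2j the ideal (2, 1 + √D) has norm 2.
  even-half⇒many-classes : ∀ k (k>0 : 0 ℕ.< k) j → suc k ≡ 2 ℕ.* j → 3 ℕ.≤ k
    → ¬ HasClassNumber (EmbeddedOrder.Δ k k>0) 1
  even-half⇒many-classes k k>0 j sk≡2j 3≤k h≡1 = contradiction
    (principal⇒unit-a P (ℕ.<-≤-trans (s≤s (s≤s (s≤s z≤n))) (ℕ.*-monoʳ-≤ 2 3≤k))
      (one-class⇒principal h≡1 (ideal P) (primitive⇒invertible P prim)))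
    (λ ())
    where
    open EmbeddedOrder k k>0
    open Forms k k>0
    open ClassNumber k k>0
    m≡ : 1ℤ + + k ≡ + 2 * + j
    m≡ = trans (cong +_ sk≡2j) (ℤ.pos-* 2 j)
    disc≡ : D ≡ 1ℤ * 1ℤ - + 2 * (1ℤ - + 2 * (+ j * + j))
    disc≡ = trans D≡k[k+2] (trans (square (+ k)) (trans (cong (λ m → m * m - 1ℤ) m≡) (identity (+ j))))
      where
      square : ∀ k → k * (+ 2 + k) ≡ (1ℤ + k) * (1ℤ + k) - 1ℤ
      square = solve-∀
      identity : ∀ j → + 2 * j * (+ 2 * j) - 1ℤ ≡ 1ℤ * 1ℤ - + 2 * (1ℤ - + 2 * (j * j))
      identity = solve-∀
    P : Form
    -- With m = 2j one has D = 4j² - 1, so 1 - D = 2(1 - 2j²). The odd third coefficient makes the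
    -- form primitive.
    P = form (+ 2) 1ℤ (1ℤ - + 2 * (+ j * + j)) disc≡
    prim : Primitive P
    prim = + j * + j , + 0 , 1ℤ , identity (+ j)
      where
      identity : ∀ j → j * j * + 2 + + 0 * (+ 2 * 1ℤ) + 1ℤ * (1ℤ - + 2 * (j * j)) ≡ 1ℤ
      identity = solve-∀

  t[t+1]-even : ∀ t → ∃[ w ] t ℕ.* suc t ≡ 2 ℕ.* w
  t[t+1]-even zero = 0 , refl
  t[t+1]-even (suc t) = let (w , e) = t[t+1]-even t in
    w ℕ.+ suc t , trans (expand t) (trans (cong (ℕ._+ 2 ℕ.* suc t) e) (sym (ℕ.*-distribˡ-+ 2 w (suc t))))
    where
    expand : ∀ t → suc t ℕ.* suc (suc t) ≡ t ℕ.* suc t ℕ.+ 2 ℕ.* suc t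
    expand = ℕ-Solver.solve-∀

  -- For odd m = k + 1 = 2t + 1 the ideal (4, 2 + √D) has norm 4 and square (4).
  odd-half⇒even-class-number : ∀ k (k>0 : 0 ℕ.< k) t → k ≡ 2 ℕ.* t → 3 ℕ.≤ k
    → ∃[ h ] (HasClassNumber (EmbeddedOrder.Δ k k>0) h × 2 ℕ.∣ h)
  odd-half⇒even-class-number k k>0 t k≡2t 3≤k = _ , class-number ,
    order-two-class⇒even {M = ideal P} class-number (primitive⇒invertible P prim)
      -- Ambiguity with l = 1: 2 = -2 + 4.
      (ambiguous⇒order-two P 1ℤ prim refl)
      (λ principal → contradiction (principal⇒unit-a P (ℕ.<-≤-trans (s≤s (s≤s (s≤s (s≤s (s≤s z≤n))))) (ℕ.*-monoʳ-≤ 2 3≤k)) principal) (λ ()))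
    where
    open EmbeddedOrder k k>0
    open Forms k k>0
    open ClassNumber k k>0
    w : ℤ
    w = + proj₁ (t[t+1]-even t)
    t[t+1]≡2w : + t * (1ℤ + + t) ≡ + 2 * w
    t[t+1]≡2w = trans (sym (ℤ.pos-* t (suc t))) (trans (cong +_ (proj₂ (t[t+1]-even t))) (ℤ.pos-* 2 (proj₁ (t[t+1]-even t))))
    disc≡ : D ≡ + 2 * + 2 - + 4 * (1ℤ - + 2 * w)
    disc≡ = trans D≡k[k+2] (trans (cong (λ k → k * (+ 2 + k)) (trans (cong +_ k≡2t) (ℤ.pos-* 2 t)))
      (trans (factor (+ t)) (trans (cong (+ 4 *_) t[t+1]≡2w) (identity w))))
      where
      factor : ∀ t → + 2 * t * (+ 2 + + 2 * t) ≡ + 4 * (t * (1ℤ + t))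
      factor = solve-∀
      identity : ∀ w → + 4 * (+ 2 * w) ≡ + 2 * + 2 - + 4 * (1ℤ - + 2 * w)
      identity = solve-∀
    P : Form
    -- With w = t(t + 1)/2 one has D = 4t(t + 1) = 8w, so 4 - D = 4(1 - 2w), and the third
    -- coefficient is odd.
    P = form (+ 4) (+ 2) (1ℤ - + 2 * w) disc≡
    prim : Primitive P
    -- The witnesses come from (1 - 2w)² = 1 - 4(w - w²).
    prim = w - w * w , + 0 , 1ℤ - + 2 * w , identity w
      where
      identity : ∀ w → (w - w * w) * + 4 + + 0 * (+ 2 * + 2) + (1ℤ - + 2 * w) * (1ℤ - + 2 * w) ≡ 1ℤ
      identity = solve-∀

  2∤1 : ∀ x → 1ℤ ≢ + 2 * x
  2∤1 x e = ℕ.>⇒∤ (s≤s (s≤s z≤n)) (∣⇒∣ᵤ (dividesℤ x (trans e (ℤ.*-comm (+ 2) x))))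

  -- Here D = 8, so a reduced form has ∣a∣ ≤ 2. If ∣a∣ = 2, then b = 1 is impossible since b² - 8 =
  -- ac is even, and b = 0 gives c = ±4, where a, 2b and c are all even. Primitive reduced forms
  -- thus have ∣a∣ = 1.
  Δ=32-class-number : HasClassNumber (EmbeddedOrder.Δ 2 (s≤s z≤n)) 1
  Δ=32-class-number = all-principal⇒class-number-1 λ P prim reduced → unit-a⇒principal P (unit-a P prim reduced)
    where
    open EmbeddedOrder 2 (s≤s z≤n)
    open Forms 2 (s≤s z≤n)
    open Reduction 2 (s≤s z≤n)
    open ClassNumber 2 (s≤s z≤n)
    open Form

    norm-two-impossible : ∀ P n → b P ≡ + n → n ℕ.< 2 → ∣ a P ∣ ≡ 2 → ¬ Primitive P
    norm-two-impossible (form a _ c e) n refl n<2 ∣a∣≡2 (r , s , t , bezout) with sign-split a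
    ... | ε , a≡ , εε≡1 = by-b n n<2 e bezout
      where
      a≡2ε : a ≡ + 2 * ε
      a≡2ε = trans a≡ (trans (cong (λ x → ε * + x) ∣a∣≡2) (ℤ.*-comm ε (+ 2)))
      8≡ : ∀ {n} → D ≡ + n * + n - a * c → + 8 ≡ + n * + n - + 2 * ε * c
      8≡ {n} e = trans (sym D≡+d) (trans e (cong (λ a → + n * + n - a * c) a≡2ε))
      by-b : ∀ n → n ℕ.< 2 → D ≡ + n * + n - a * c → r * a + s * (+ 2 * + n) + t * c ≢ 1ℤ
      by-b 1 _ e _ = 2∤1 (+ 4 + ε * c) (odd (ε * c) (trans (8≡ {1} e) (assoc ε c)))
        where
        assoc : ∀ ε c → 1ℤ * 1ℤ - + 2 * ε * c ≡ 1ℤ - + 2 * (ε * c)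
        assoc = solve-∀
        odd : ∀ x → + 8 ≡ 1ℤ - + 2 * x → 1ℤ ≡ + 2 * (+ 4 + x)
        odd x e = trans (insert x) (trans (cong (_+ + 2 * x) (sym e)) (double x))
          where
          insert : ∀ x → 1ℤ ≡ 1ℤ - + 2 * x + + 2 * x
          insert = solve-∀
          double : ∀ x → + 8 + + 2 * x ≡ + 2 * (+ 4 + x)
          double = solve-∀
      by-b 0 _ e bezout = 2∤1 (r * ε + t * (- (+ 2 * ε)))
        (trans (sym bezout) (trans (cong₂ (λ a c → r * a + s * (+ 2 * + 0) + t * c) a≡2ε c≡) (collect r s t ε)))
        where
        εc≡-4 : ε * c ≡ - (+ 4)
        εc≡-4 = *-cancelˡ′ {c = + 2} (λ ()) (trans (isolate ε c) (cong -_ (sym (8≡ {0} e))))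
          where
          isolate : ∀ ε c → + 2 * (ε * c) ≡ - (+ 0 * + 0 - + 2 * ε * c)
          isolate = solve-∀
        c≡ : c ≡ + 2 * (- (+ 2 * ε))
        c≡ = trans (sym (ℤ.*-identityˡ c)) (trans (cong (_* c) (sym εε≡1)) (trans (ℤ.*-assoc ε ε c)
          (trans (cong (ε *_) εc≡-4) (regroup ε))))
          where
          regroup : ∀ ε → ε * (- (+ 4)) ≡ + 2 * (- (+ 2 * ε))
          regroup = solve-∀
        collect : ∀ r s t ε → r * (+ 2 * ε) + s * (+ 2 * + 0) + t * (+ 2 * (- (+ 2 * ε)))
          ≡ + 2 * (r * ε + t * (- (+ 2 * ε)))
        collect = solve-∀
      by-b (suc (suc _)) (s≤s (s≤s ()))

    unit-a : ∀ P → Primitive P → Reduced P → ∣ a P ∣ ≡ 1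
    unit-a P prim (n , b≡n , n<∣a∣ , aa≤8) = by-size ∣ a P ∣ refl n<∣a∣ aa≤8
      where
      by-size : ∀ A → ∣ a P ∣ ≡ A → n ℕ.< A → A ℕ.* A ℕ.≤ 8 → ∣ a P ∣ ≡ 1
      by-size 1 ∣a∣≡1 _ _ = ∣a∣≡1
      by-size 2 ∣a∣≡2 n<2 _ = contradiction prim (norm-two-impossible P n b≡n n<2 ∣a∣≡2)
      by-size (suc (suc (suc A))) _ _ AA≤8 =
        contradiction (ℕ.≤-trans (ℕ.*-mono-≤ {3} {3 ℕ.+ A} {3} {3 ℕ.+ A} (ℕ.m≤m+n 3 A) (ℕ.m≤m+n 3 A)) AA≤8) (ℕ.<⇒≱ ℕ.≤-refl)

  -- Maximality removes the odd m, and for even m ≥ 4 the ideal (2, 1 + √D) is a second class.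
  maximal-one-class : ∀ m → IsFundamental (discOf (2 ℕ.* m))
    → HasClassNumber (discOf (2 ℕ.* m)) 1 → m ≡ 0 ⊎ m ≡ 2
  maximal-one-class m fund h≡1 with even∨odd m
  ... | inj₂ (j , refl) = contradiction fund (odd-half⇒non-fundamental j)
  ... | inj₁ (0 , refl) = inj₁ refl
  ... | inj₁ (1 , refl) = inj₂ refl
  ... | inj₁ (suc (suc j) , refl) = contradiction
      (subst (λ Δ → HasClassNumber Δ 1) (discOf≡Δ _ (s≤s z≤n)) h≡1)
      (even-half⇒many-classes _ (s≤s z≤n) (suc (suc j)) refl 3≤)
    where
    3≤ : 3 ℕ.≤ suc j ℕ.+ (2 ℕ.+ j ℕ.+ 0)
    3≤ = ℕ.≤-trans (ℕ.m≤m+n 3 (j ℕ.+ j)) (ℕ.≤-reflexive (regroup j))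
      where
      regroup : ∀ j → 3 ℕ.+ (j ℕ.+ j) ≡ suc j ℕ.+ (2 ℕ.+ j ℕ.+ 0)
      regroup = ℕ-Solver.solve-∀

  2mod4-even-class-number : ∀ m t → 2 ℕ.* m ≡ 4 ℕ.* t ℕ.+ 2 → 3 ℕ.< m
    → ∃[ h ] (HasClassNumber (discOf (2 ℕ.* m)) h × 2 ℕ.∣ h)
  2mod4-even-class-number (suc k) t 2m≡4t+2 (s≤s 3≤k) =
    subst (λ Δ → ∃[ h ] (HasClassNumber Δ h × 2 ℕ.∣ h)) (sym (discOf≡Δ k k>0))
      (odd-half⇒even-class-number k k>0 t k≡2t 3≤k)
    where
    k>0 : 0 ℕ.< k
    k>0 = ℕ.≤-trans (s≤s z≤n) 3≤k
    k≡2t : k ≡ 2 ℕ.* t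
    k≡2t = ℕ.suc-injective (ℕ.*-cancelˡ-≡ (suc k) (suc (2 ℕ.* t)) 2 (trans 2m≡4t+2 (regroup t)))
      where
      regroup : ∀ t → 4 ℕ.* t ℕ.+ 2 ≡ 2 ℕ.* suc (2 ℕ.* t)
      regroup = ℕ-Solver.solve-∀

open import Data.Nat using (ℕ; _*_; _+_; _<_)
open import Data.Nat.Divisibility using (_∣_)
open import Data.Product using (_×_; ∃-syntax)
open import Data.Sum using (_⊎_)
open import Relation.Binary.PropositionalEquality using (_≡_)
open import Data.Product using (_,_)
open import Data.Nat using (s≤s; z≤n)
open import Relation.Binary.PropositionalEquality using (refl; sym; subst)

theorem4p5 : (∀ (n m : ℕ) → IsQuadDisc (discOf n) → IsFundamental (discOf n)
    → n ≡ 2 * m → HasClassNumber (discOf n) 1 → m ≡ 0 ⊎ m ≡ 2)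
    × (∀ (n m : ℕ) → IsQuadDisc (discOf n) → (∃[ t ] n ≡ 4 * t + 2)
    → n ≡ 2 * m → 3 < m → ∃[ h ] (HasClassNumber (discOf n) h × 2 ∣ h))
    × HasClassNumber (discOf 6) 1
theorem4p5 =
    (λ { _ m _ fund refl h≡1 → Families.maximal-one-class m fund h≡1 })
  , (λ { _ m _ (t , 2m≡4t+2) refl 3<m → Families.2mod4-even-class-number m t 2m≡4t+2 3<m })
  , subst (λ Δ → HasClassNumber Δ 1) (sym (Families.discOf≡Δ 2 (s≤s z≤n))) Families.Δ=32-class-number
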